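{- Let $n,k\ge1$ and let $\mathcal{S}_n^k$ be the extended Shi arrangement in $\mathbb{R}^n$ consisting of the hyperplanes $x_i-x_j=l$ for all $1\le i<j\le n$ and all integers $-k+1\le l\le k$. The map $\sigma_n^k$ (defined below) is a bijection between the regions of $\mathcal{S}_n^k$ and the $k$-parking functions on $[n]$.
   Context: A region of an arrangement is a connected component of the complement of the union of its hyperplanes. A $k$-parking function on $[n]$ is a sequence of positive integers $(a_1,\ldots,a_n)$ whose increasing rearrangement $b_1\le\cdots\le b_n$ satisfies $b_i\le 1+k(i-1)$ for all $i$. The diagram of a region $R$ of $\mathcal{S}_n^k$ is defined as follows. Let $y=y_1y_2\cdots y_{kn}$ be the unique ordering of the $kn$ expressions $x_i+m$ ($1\le i\le n$, $0\le m\le k-1$) such that $y_1>y_2>\cdots>y_{kn}$ holds on $R$ (determined by the hyperplanes $x_i-x_j=l$, $-k+1\le l\le k-1$); the position of $y_p$ is $p$. Draw an arc from $x_i+m$ to $x_i+m-1$ for all $i$ and all $0<m\le k-1$, and draw an arc from $x_i$ to $x_j+k-1$ whenever $i<j$ and $x_i-x_j>k$ holds on $R$ (arcs go rightwards). Remove every arc that contains another arc, i.e. an arc from $p$ to $q$ is removed if there is a different arc from $p'$ to $q'$ with $p$ weakly left of $p'$ and $q'$ weakly left of $q$. Replace each $x_i+m$ by $i$. The remaining arcs partition the multiset $\{1^k,2^k,\ldots,n^k\}$ into chains (connected components) of weakly increasing integers, with all $k$ copies of $i$ in the same chain. The map $\sigma_n^k$ sends $R$ to $(a_1,\ldots,a_n)$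 where $a_i$ is the position of the leftmost element of the chain containing the copies of $i$. -}

module Defs where

open import Data.Empty using (⊥)
open import Data.Fin as Fin using (Fin; toℕ)
open import Data.Fin.Permutation using (Permutation′; _⟨$⟩ʳ_)
open import Data.Integer as ℤ using (ℤ; +_)
open import Data.Nat as ℕ using (ℕ; suc)
import Data.Nat.Properties as ℕₚ
open import Data.Product using (Σ-syntax; ∃; ∃-syntax; ∃₂; _×_; _,_)
open import Data.Rational as ℚ using (ℚ; 0ℚ; ½; ∣_∣)
import Data.Rational.Properties as ℚₚ
open import Data.Rational.Solver using (module +-*-Solver)
open import Data.Sum using (_⊎_; inj₁; inj₂; [_,_]′)
open import Function.Bundles using (_↔_; module Inverse)
open import Level using (0ℓ) renaming (suc to lsuc)
open import Relation.Binary.Bundles using (Setoid)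
open import Relation.Binary.Construct.Closure.Equivalence using (EqClosure)
open import Relation.Binary.PropositionalEquality
  using (_≡_; _≢_; _≗_; refl; sym; trans; cong; subst)
open import Relation.Nullary using (¬_)
open import Relation.Unary using (Pred; _∈_; _⊆_; _∪_; _∩_; ∅; Satisfiable)

------------------------------------------------------------------------
-- Real numbers

IsCauchy : (ℕ → ℚ) → Set
IsCauchy s = ∀ (ε : ℚ) → 0ℚ ℚ.< ε →
  ∃[ N ] (∀ m n → N ℕ.≤ m → N ℕ.≤ n → ∣ s m ℚ.- s n ∣ ℚ.< ε)

-- A real number is given by a Cauchy sequence of rationals.  There is no
-- quotient: sequences x and y with neither x < y nor y < x represent the
-- same real.
record ℝ : Set where
  constructor mkℝ
  field
    seq    : ℕ → ℚ
    cauchy : IsCauchy seq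

open ℝ public

infix 4 _<_ _#_
infixl 6 _+_ _-_

_<_ : ℝ → ℝ → Set
x < y = ∃[ ε ] ∃[ N ] (0ℚ ℚ.< ε × (∀ n → N ℕ.≤ n → seq x n ℚ.+ ε ℚ.≤ seq y n))

-- Apartness, the constructive form of x ≠ y.
_#_ : ℝ → ℝ → Set
x # y = x < y ⊎ y < x

fromℚ : ℚ → ℝ
fromℚ q = mkℝ (λ _ → q) λ ε 0<ε → 0 , λ _ _ _ _ →
  subst (λ d → ∣ d ∣ ℚ.< ε) (sym (ℚₚ.+-inverseʳ q)) 0<ε

fromℤ : ℤ → ℝ
fromℤ z = fromℚ (z ℚ./ 1)

private
  0<½ε : ∀ {ε} → 0ℚ ℚ.< ε → 0ℚ ℚ.< ½ ℚ.* ε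
  0<½ε 0<ε = ℚₚ.*-monoʳ-<-pos ½ 0<ε

  halves : ∀ ε → ½ ℚ.* ε ℚ.+ ½ ℚ.* ε ≡ ε
  halves ε = trans (sym (ℚₚ.*-distribʳ-+ ε ½ ½)) (ℚₚ.*-identityˡ ε)

  diff-+ : ∀ a b c d → (a ℚ.+ b) ℚ.- (c ℚ.+ d) ≡ (a ℚ.- c) ℚ.+ (b ℚ.- d)
  diff-+ = solve 4 (λ a b c d →
    (a :+ b) :- (c :+ d) := (a :- c) :+ (b :- d)) refl
    where open +-*-Solver

  diff-neg : ∀ a b → (ℚ.- a) ℚ.- (ℚ.- b) ≡ ℚ.- (a ℚ.- b)
  diff-neg = solve 2 (λ a b → (:- a) :- (:- b) := :- (a :- b)) refl
    where open +-*-Solver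

_+_ : ℝ → ℝ → ℝ
x + y = mkℝ (λ n → seq x n ℚ.+ seq y n) λ ε 0<ε →
  let M , p = cauchy x (½ ℚ.* ε) (0<½ε 0<ε)
      N , q = cauchy y (½ ℚ.* ε) (0<½ε 0<ε)
  in M ℕ.⊔ N , λ m n M⊔N≤m M⊔N≤n →
    let open ℚₚ.≤-Reasoning in begin-strict
      ∣ (seq x m ℚ.+ seq y m) ℚ.- (seq x n ℚ.+ seq y n) ∣
        ≡⟨ cong ∣_∣ (diff-+ (seq x m) (seq y m) (seq x n) (seq y n)) ⟩
      ∣ (seq x m ℚ.- seq x n) ℚ.+ (seq y m ℚ.- seq y n) ∣
        ≤⟨ ℚₚ.∣p+q∣≤∣p∣+∣q∣ (seq x m ℚ.- seq x n) (seq y m ℚ.- seq y n) ⟩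
      ∣ seq x m ℚ.- seq x n ∣ ℚ.+ ∣ seq y m ℚ.- seq y n ∣
        <⟨ ℚₚ.+-mono-<
             (p m n (ℕₚ.m⊔n≤o⇒m≤o M N M⊔N≤m) (ℕₚ.m⊔n≤o⇒m≤o M N M⊔N≤n))
             (q m n (ℕₚ.m⊔n≤o⇒n≤o M N M⊔N≤m) (ℕₚ.m⊔n≤o⇒n≤o M N M⊔N≤n)) ⟩
      ½ ℚ.* ε ℚ.+ ½ ℚ.* ε
        ≡⟨ halves ε ⟩
      ε ∎

neg : ℝ → ℝ
neg x = mkℝ (λ n → ℚ.- seq x n) λ ε 0<ε →
  let N , p = cauchy x ε 0<ε
  in N , λ m n N≤m N≤n →
    subst (ℚ._< ε)
      (sym (trans (cong ∣_∣ (diff-neg (seq x m) (seq x n)))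
                  (ℚₚ.∣-p∣≡∣p∣ (seq x m ℚ.- seq x n))))
      (p m n N≤m N≤n)

_-_ : ℝ → ℝ → ℝ
x - y = x + neg y

------------------------------------------------------------------------
-- Topology of ℝⁿ

Point : ℕ → Set
Point n = Fin n → ℝ

-- Open ball of radius ε around z in the maximum norm.
Ball : ∀ {n} → Point n → ℚ → Pred (Point n) 0ℓ
Ball z ε w = ∀ i → (fromℚ (ℚ.- ε) < w i - z i) × (w i - z i < fromℚ ε)

Open : ∀ {n} → Pred (Point n) 0ℓ → Set
Open U = ∀ z → z ∈ U → ∃[ ε ] (0ℚ ℚ.< ε × Ball z ε ⊆ U)

-- C is connected: it is not separated by two open sets.
Connected : ∀ {n} → Pred (Point n) 0ℓ → Set₁
Connected {n} C = ∀ (U V : Pred (Point n) 0ℓ) → Open U → Open V →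
  C ⊆ U ∪ V → C ∩ U ∩ V ⊆ ∅ →
  Satisfiable (C ∩ U) → Satisfiable (C ∩ V) → ⊥

-- z and w lie in the same connected component of X.
SameComponent : ∀ {n} → Pred (Point n) 0ℓ → Point n → Point n → Set₁
SameComponent {n} X z w =
  Σ[ C ∈ Pred (Point n) 0ℓ ] Connected C × C ⊆ X × z ∈ C × w ∈ C

------------------------------------------------------------------------
-- The extended Shi arrangement and its regions

-- The index of the hyperplane x_i - x_j = l.
record ShiHyperplane (n k : ℕ) : Set where
  field
    i j   : Fin n
    l     : ℤ
    i<j   : i Fin.< j
    lower : ℤ.- (+ k) ℤ.+ + 1 ℤ.≤ l
    upper : l ℤ.≤ + k

Complement : ∀ n k → Pred (Point n) 0ℓ
Complement n k x = (H : ShiHyperplane n k) → let open ShiHyperplane H in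
  (x i - x j) # fromℤ l

-- A region is represented by any of its points; two representatives are
-- equal when they lie in the same connected component of the complement.
Region : ℕ → ℕ → Set
Region n k = ∃ (Complement n k)

_≈ᴿ_ : ∀ {n k} → Region n k → Region n k → Set₁
_≈ᴿ_ {n} {k} (x , _) (y , _) = SameComponent (Complement n k) x y

Regions : ℕ → ℕ → Setoid 0ℓ (lsuc 0ℓ)
Regions n k = record
  { Carrier       = Region n k
  ; _≈_           = _≈ᴿ_
  ; isEquivalence = record
    { refl  = λ { {x , cx} → (x ≡_)
                , (λ { U V _ _ _ disjoint (_ , refl , u) (_ , refl , v) →
                       disjoint (refl , u , v) })
                , (λ { refl → cx }) , refl , refl }
    ; sym   = λ { (C , conn , C⊆X , x∈C , y∈C) → C , conn , C⊆X , y∈C , x∈C }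
    ; trans = λ { (C , connC , C⊆X , x∈C , y∈C) (D , connD , D⊆X , y∈D , z∈D) →
        C ∪ D , connected-∪ connC connD y∈C y∈D
              , [ C⊆X , D⊆X ]′ , inj₁ x∈C , inj₂ z∈D }
    }
  }
  where
  connected-∪ : {C D : Pred (Point n) 0ℓ} → Connected C → Connected D →
                ∀ {y} → y ∈ C → y ∈ D → Connected (C ∪ D)
  connected-∪ {C} {D} connC connD {y} y∈C y∈D U V oU oV cover disjoint
              (u , u∈C∪D , u∈U) (v , v∈C∪D , v∈V) =
    [ (λ y∈U → [ (λ v∈C → inC (y , y∈C , y∈U) (v , v∈C , v∈V))
               , (λ v∈D → inD (y , y∈D , y∈U) (v , v∈D , v∈V)) ]′ v∈C∪D)
    , (λ y∈V → [ (λ u∈C → inC (u , u∈C , u∈U) (y , y∈C , y∈V))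
               , (λ u∈D → inD (u , u∈D , u∈U) (y , y∈D , y∈V)) ]′ u∈C∪D)
    ]′ (cover (inj₁ y∈C))
    where
    inC : Satisfiable (C ∩ U) → Satisfiable (C ∩ V) → ⊥
    inC = connC U V oU oV (λ p → cover (inj₁ p))
                (λ { (p , uv) → disjoint (inj₁ p , uv) })
    inD : Satisfiable (D ∩ U) → Satisfiable (D ∩ V) → ⊥
    inD = connD U V oU oV (λ p → cover (inj₂ p))
                (λ { (p , uv) → disjoint (inj₂ p , uv) })

_HoldsOn_ : ∀ {n k} → Pred (Point n) 0ℓ → Region n k → Set₁
_HoldsOn_ {n} {k} P (x , _) = ∀ z → SameComponent (Complement n k) x z → P z

------------------------------------------------------------------------
-- Parking functions

-- The permutation π sorts a into its increasing rearrangement.  Indices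
-- start at 0, so that i - 1 becomes toℕ i.
IsParking : ∀ {n} → ℕ → (Fin n → ℕ) → Set
IsParking {n} k a =
  (∀ i → 1 ℕ.≤ a i) ×
  Σ[ π ∈ Permutation′ n ]
    let b = λ i → a (π ⟨$⟩ʳ i) in
    (∀ i j → i Fin.≤ j → b i ℕ.≤ b j) ×
    (∀ i → b i ℕ.≤ 1 ℕ.+ k ℕ.* toℕ i)

record ParkingFunction (n k : ℕ) : Set where
  field
    sequence  : Fin n → ℕ
    isParking : IsParking k sequence

open ParkingFunction public

ParkingFunctions : ℕ → ℕ → Setoid 0ℓ 0ℓ
ParkingFunctions n k = record
  { Carrier       = ParkingFunction n k
  ; _≈_           = λ f g → sequence f ≗ sequence g
  ; isEquivalence = record
    { refl  = λ _ → refl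
    ; sym   = λ p i → sym (p i)
    ; trans = λ p q i → trans (p i) (q i)
    }
  }

------------------------------------------------------------------------
-- The diagram of a region

-- The pair (i , m) stands for the expression x_i + m.
Expr : ℕ → ℕ → Set
Expr n k = Fin n × Fin k

value : ∀ {n k} → Point n → Expr n k → ℝ
value x (i , m) = x i + fromℤ (+ toℕ m)

-- y lists all expressions, each exactly once, in decreasing order on R.
IsOrdering : ∀ {n k} → Region n k → Fin (k ℕ.* n) ↔ Expr n k → Set₁
IsOrdering R y = ∀ p q → p Fin.< q →
  (λ x → value x (Inverse.to y q) < value x (Inverse.to y p)) HoldsOn R

module Diagram {n k : ℕ} (R : Region n k) (y : Fin (k ℕ.* n) ↔ Expr n k) where

  position : Expr n k → ℕ
  position e = suc (toℕ (Inverse.from y e))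

  data Arc : Expr n k → Expr n k → Set₁ where
    shift : ∀ i {m m′} → toℕ m ≡ suc (toℕ m′) → Arc (i , m) (i , m′)
    jump  : ∀ {i j m m′} → toℕ m ≡ 0 → suc (toℕ m′) ≡ k → i Fin.< j →
            (λ x → fromℤ (+ k) < x i - x j) HoldsOn R →
            Arc (i , m) (j , m′)

  -- The arc from e to f is removed: it contains a different arc.
  Removed : Expr n k → Expr n k → Set₁
  Removed e f = ∃₂ λ e′ f′ → Arc e′ f′ × (e′ , f′) ≢ (e , f) ×
    position e ℕ.≤ position e′ × position f′ ℕ.≤ position f

  RemainingArc : Expr n k → Expr n k → Set₁
  RemainingArc e f = Arc e f × ¬ Removed e f

  -- The chain containing the copies of i.
  Chain : Fin n → Pred (Expr n k) (lsuc 0ℓ)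
  Chain i e = ∃[ m ] EqClosure RemainingArc (i , m) e

  IsLeftmostPosition : Pred (Expr n k) (lsuc 0ℓ) → ℕ → Set₁
  IsLeftmostPosition C p =
    (∃[ e ] (e ∈ C × position e ≡ p)) × (∀ e → e ∈ C → p ℕ.≤ position e)

-- The graph of the map σ.
IsSigma : ∀ {n k} → Region n k → (Fin n → ℕ) → Set₁
IsSigma {n} {k} R a =
  Σ[ y ∈ (Fin (k ℕ.* n) ↔ Expr n k) ] IsOrdering R y ×
    (∀ i → let open Diagram R y in IsLeftmostPosition (Chain i) (a i))

{-# OPTIONS --safe #-}

-- Every region contains a rational point, since the finitely many signs of
-- x_i - x_j - l survive approximation, and points with equal signs lie in the
-- same region because convex sets are connected (by bisection).  At a rational
-- point the arcs that remain are all the shifts and some jumps i ⇝ j with i < j,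
-- no two of them sharing a source or a target.  The chains are thus increasing
-- paths, each labelled by the position of its start: the chains are the blocks
-- of equal labels, and the jumps link neighbours in a block.
--
-- Injectivity.  The remaining arcs are nonnesting, so they end in the order in
-- which they start.  Hence the labels determine the expressions at the positions
-- from left to right; and for i < j, x_i - x_j > k holds if and only if a
-- remaining arc lies between x_i and x_j + k - 1.
--
-- Surjectivity.  Given a parking function, fill the positions from left to right:
-- position p receives the first expression of block p if there is one, and else
-- the end of the arc that has been open for longest, which exists by the parking
-- condition.  The heights of the expressions can then be chosen one by one: a
-- shift prescribes the new height, and otherwise the finitely many strict bounds
-- on it are compatible, so that density of ℚ suffices.

module Submission where

open import Defs
open import Data.Empty using (⊥; ⊥-elim)
open import Data.Fin as Fin using (Fin; toℕ; zero; suc)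
import Data.Fin.Properties as Finₚ
open import Data.Fin.Induction using (<-wellFounded)
open import Data.Fin.Permutation using (Permutation′; _⟨$⟩ʳ_; _⟨$⟩ˡ_; permutation)
open import Data.Fin.Subset using (Subset)
import Data.Fin.Subset as Subset
import Data.Fin.Subset.Properties as Subsetₚ
open import Data.Integer as ℤ using (ℤ; +_; -[1+_])
import Data.Integer.Properties as ℤₚ
open import Data.Nat as ℕ using (ℕ; zero; suc; NonZero; z≤n; s≤s)
import Data.Nat.DivMod as DivMod
import Data.Nat.Properties as ℕₚ
open import Data.Product using (Σ-syntax; ∃; ∃-syntax; ∃₂; _×_; _,_; proj₁; proj₂)
open import Data.Rational as ℚ using (ℚ; 0ℚ; 1ℚ; ½; ∣_∣)
import Data.Rational.Properties as ℚₚ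
import Data.Rational.Unnormalised as ℚᵘ
import Data.Rational.Unnormalised.Properties as ℚᵘₚ
open import Data.Rational.Solver using (module +-*-Solver)
import Data.Vec.Base as Vec
import Data.Vec.Properties as Vecₚ
open import Data.Sum using (_⊎_; inj₁; inj₂; [_,_]′)
open import Function using (_∘_; id; case_of_)
open import Function.Bundles using (_↔_; module Inverse; Bijection; _⇔_; mk⇔; mk↔ₛ′; module Equivalence)
open import Function.Construct.Composition using (_↔-∘_)
open import Level using (0ℓ)
open import Induction.WellFounded using (Acc; acc)
open import Relation.Binary.Construct.Closure.Equivalence as Eq using (EqClosure)
open import Relation.Binary.Construct.Closure.ReflexiveTransitive using (Star; _◅_; _◅◅_) renaming (ε to nil)
open import Relation.Binary.Construct.Closure.Symmetric using (fwd; bwd)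
open import Relation.Binary.Definitions using (tri<; tri≈; tri>)
open import Relation.Binary.Bundles using (Setoid)
open import Relation.Binary.PropositionalEquality hiding (setoid; J)
open import Relation.Nullary using (¬_; Dec; yes; no; does; ¬?; _×-dec_; _⊎-dec_; _→-dec_)
open import Relation.Nullary.Decidable using (map′; dec-true; decidable-stable)
open import Relation.Unary using (Pred; _∈_; _⊆_; _∪_)

-- Rational arithmetic

-- The order of the reals is undecidable and `HoldsOn` quantifies over a whole component. At a
-- rational point, arcs and their removal become decidable questions about the heights q i + m, and
-- results carry over because `IsSigma` is invariant under `≈ᴿ` and has at most one value on each
-- region.
--
-- One number governs the diagram: a shift drops by exactly 1 and a jump by more than 1. Hence a
-- shift contains no other arc, which is why all shifts remain, and x_i - x_j > k becomes a
-- comparison of two heights, one of them raised by 1. The realization turns this round: order and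
-- arcs are given, the drop between two expressions has to be at least 1 exactly if an arc lies
-- between them, and nonnesting makes these demands compatible.
--
-- The labels record only where chains start; the rest is determined because arcs are served first
-- in, first out. The parking inequality keeps this queue from running empty: whenever p < kn
-- positions are filled, the labels of value at most p + 1 have more than p copies, so one of these
-- is still missing.

<⇒0<- : ∀ {p q} → p ℚ.< q → 0ℚ ℚ.< q ℚ.- p
<⇒0<- {p} {q} p<q =
  subst (ℚ._< q ℚ.- p) (ℚₚ.+-inverseʳ p) (ℚₚ.+-monoˡ-< (ℚ.- p) p<q)

≤⇒0≤- : ∀ {p q} → p ℚ.≤ q → 0ℚ ℚ.≤ q ℚ.- p
≤⇒0≤- {p} {q} p≤q =
  subst (ℚ._≤ q ℚ.- p) (ℚₚ.+-inverseʳ p) (ℚₚ.+-monoˡ-≤ (ℚ.- p) p≤q)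

p+[q-p] : ∀ p q → p ℚ.+ (q ℚ.- p) ≡ q
p+[q-p] = solve 2 (λ p q → p :+ (q :- p) := q) refl
  where open +-*-Solver

0<-⇒< : ∀ {p q} → 0ℚ ℚ.< q ℚ.- p → p ℚ.< q
0<-⇒< {p} {q} 0<d =
  subst₂ ℚ._<_ (ℚₚ.+-identityʳ p) (p+[q-p] p q) (ℚₚ.+-monoʳ-< p 0<d)

0≤-⇒≤ : ∀ {p q} → 0ℚ ℚ.≤ q ℚ.- p → p ℚ.≤ q
0≤-⇒≤ {p} {q} 0≤d =
  subst₂ ℚ._≤_ (ℚₚ.+-identityʳ p) (p+[q-p] p q) (ℚₚ.+-monoʳ-≤ p 0≤d)

<-shift : ∀ {p q r s} → p ℚ.< q → s ℚ.- r ≡ q ℚ.- p → r ℚ.< s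
<-shift p<q eq = 0<-⇒< (subst (0ℚ ℚ.<_) (sym eq) (<⇒0<- p<q))

≤-shift : ∀ {p q r s} → p ℚ.≤ q → s ℚ.- r ≡ q ℚ.- p → r ℚ.≤ s
≤-shift p≤q eq = 0≤-⇒≤ (subst (0ℚ ℚ.≤_) (sym eq) (≤⇒0≤- p≤q))

infixl 6 _⊕_

_⊕_ : ∀ {p q} → 0ℚ ℚ.≤ p → 0ℚ ℚ.≤ q → 0ℚ ℚ.≤ p ℚ.+ q
_⊕_ = ℚₚ.+-mono-≤

-- Linear inequalities are proved by exhibiting the difference of the two sides as a sum of
-- nonnegative terms, combined with `_⊕_`; the identity q - p = d is left to the ring solver.
≤-lin : ∀ {p q d} → 0ℚ ℚ.≤ d → q ℚ.- p ≡ d → p ℚ.≤ q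
≤-lin 0≤d eq = 0≤-⇒≤ (subst (0ℚ ℚ.≤_) (sym eq) 0≤d)

+pos≤⇒≤ : ∀ {ε} p {q} → 0ℚ ℚ.< ε → p ℚ.+ ε ℚ.≤ q → p ℚ.≤ q
+pos≤⇒≤ {ε} p 0<ε p+ε≤q = ℚₚ.≤-trans
  (subst (ℚ._≤ p ℚ.+ ε) (ℚₚ.+-identityʳ p) (ℚₚ.+-monoʳ-≤ p (ℚₚ.<⇒≤ 0<ε))) p+ε≤q

p<p+1 : ∀ p → p ℚ.< p ℚ.+ 1ℚ
p<p+1 p = <-shift (ℚₚ.positive⁻¹ 1ℚ) (solve 1 (λ p → (p :+ con 1ℚ) :- p := con 1ℚ :- con 0ℚ) refl p)
  where open +-*-Solver

p-1<p : ∀ p → p ℚ.- 1ℚ ℚ.< p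
p-1<p p = <-shift (ℚₚ.positive⁻¹ 1ℚ) (solve 1 (λ p → p :- (p :- con 1ℚ) := con 1ℚ :- con 0ℚ) refl p)
  where open +-*-Solver

≤∧≢⇒< : ∀ {p q} → p ℚ.≤ q → p ≢ q → p ℚ.< q
≤∧≢⇒< {p} {q} p≤q p≢q with ℚₚ.<-cmp p q
... | tri< lt _ _ = lt
... | tri≈ _ eq _ = ⊥-elim (p≢q eq)
... | tri> _ _ gt = ⊥-elim (ℚₚ.<-irrefl refl (ℚₚ.<-≤-trans gt p≤q))

/1-+ : ∀ a b → (a ℤ.+ b) ℚ./ 1 ≡ a ℚ./ 1 ℚ.+ b ℚ./ 1
/1-+ a b = ℚₚ.toℚᵘ-injective (begin
  ℚ.toℚᵘ ((a ℤ.+ b) ℚ./ 1)                    ≈⟨ ℚₚ.toℚᵘ-fromℚᵘ (ℚᵘ.mkℚᵘ (a ℤ.+ b) 0) ⟩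
  ℚᵘ.mkℚᵘ (a ℤ.+ b) 0                         ≈⟨ ℚᵘ.*≡* (cong (ℤ._* + 1) (sym (cong₂ ℤ._+_ (ℤₚ.*-identityʳ a) (ℤₚ.*-identityʳ b)))) ⟩
  ℚᵘ.mkℚᵘ a 0 ℚᵘ.+ ℚᵘ.mkℚᵘ b 0                ≈⟨ ℚᵘₚ.+-cong (ℚₚ.toℚᵘ-fromℚᵘ (ℚᵘ.mkℚᵘ a 0)) (ℚₚ.toℚᵘ-fromℚᵘ (ℚᵘ.mkℚᵘ b 0)) ⟨
  ℚ.toℚᵘ (a ℚ./ 1) ℚᵘ.+ ℚ.toℚᵘ (b ℚ./ 1)      ≈⟨ ℚₚ.toℚᵘ-homo-+ (a ℚ./ 1) (b ℚ./ 1) ⟨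
  ℚ.toℚᵘ (a ℚ./ 1 ℚ.+ b ℚ./ 1)                ∎)
  where open ℚᵘₚ.≃-Reasoning

/1-neg : ∀ a → (ℤ.- a) ℚ./ 1 ≡ ℚ.- (a ℚ./ 1)
/1-neg a = ℚₚ.toℚᵘ-injective (begin
  ℚ.toℚᵘ ((ℤ.- a) ℚ./ 1)   ≈⟨ ℚₚ.toℚᵘ-fromℚᵘ (ℚᵘ.mkℚᵘ (ℤ.- a) 0) ⟩
  ℚᵘ.- ℚᵘ.mkℚᵘ a 0         ≈⟨ ℚᵘₚ.-‿cong (ℚₚ.toℚᵘ-fromℚᵘ (ℚᵘ.mkℚᵘ a 0)) ⟨
  ℚᵘ.- ℚ.toℚᵘ (a ℚ./ 1)    ≈⟨ ℚₚ.toℚᵘ-homo‿- (a ℚ./ 1) ⟨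
  ℚ.toℚᵘ (ℚ.- (a ℚ./ 1))   ∎)
  where open ℚᵘₚ.≃-Reasoning

/1-injective : ∀ {a b} → a ℚ./ 1 ≡ b ℚ./ 1 → a ≡ b
/1-injective {a} {b} eq with ℚₚ./-injective-≃ (ℚᵘ.mkℚᵘ a 0) (ℚᵘ.mkℚᵘ b 0) eq
... | ℚᵘ.*≡* p = trans (sym (ℤₚ.*-identityʳ a)) (trans p (ℤₚ.*-identityʳ b))

/1-suc : ∀ m → (+ suc m) ℚ./ 1 ≡ (+ m) ℚ./ 1 ℚ.+ 1ℚ
/1-suc m = trans (cong (ℚ._/ 1) (ℤₚ.+-comm (+ 1) (+ m))) (/1-+ (+ m) (+ 1))

blend-≤ : ∀ {t a b c} → 0ℚ ℚ.≤ t → t ℚ.≤ 1ℚ → a ℚ.≤ c → b ℚ.≤ c → a ℚ.+ t ℚ.* (b ℚ.- a) ℚ.≤ c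
blend-≤ {t} {a} {b} {c} 0≤t t≤1 a≤c b≤c =
  0≤-⇒≤ (subst (0ℚ ℚ.≤_) (sym eq) (ℚₚ.+-mono-≤ (prod (≤⇒0≤- t≤1) (≤⇒0≤- a≤c)) (prod 0≤t (≤⇒0≤- b≤c))))
  where
  prod : ∀ {x y} → 0ℚ ℚ.≤ x → 0ℚ ℚ.≤ y → 0ℚ ℚ.≤ x ℚ.* y
  prod {x} {y} 0≤x 0≤y = subst (ℚ._≤ x ℚ.* y) (ℚₚ.*-zeroʳ x) (ℚₚ.*-monoˡ-≤-nonNeg x {{ℚ.nonNegative 0≤x}} 0≤y)
  eq : c ℚ.- (a ℚ.+ t ℚ.* (b ℚ.- a)) ≡ (1ℚ ℚ.- t) ℚ.* (c ℚ.- a) ℚ.+ t ℚ.* (c ℚ.- b)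
  eq = solve 4 (λ t a b c → c :- (a :+ t :* (b :- a)) := (con 1ℚ :- t) :* (c :- a) :+ t :* (c :- b)) refl t a b c
    where open +-*-Solver

neg-involutive : ∀ p → ℚ.- (ℚ.- p) ≡ p
neg-involutive = solve 1 (λ p → :- (:- p) := p) refl where open +-*-Solver

p≤∣p∣ : ∀ p → p ℚ.≤ ∣ p ∣
p≤∣p∣ p with ℚₚ.≤-total 0ℚ p
... | inj₁ 0≤p = ℚₚ.≤-reflexive (sym (ℚₚ.0≤p⇒∣p∣≡p 0≤p))
... | inj₂ p≤0 = ℚₚ.≤-trans p≤0 (ℚₚ.0≤∣p∣ p)

-∣p∣≤p : ∀ p → ℚ.- ∣ p ∣ ℚ.≤ p
-∣p∣≤p p = subst (ℚ.- ∣ p ∣ ℚ.≤_) (neg-involutive p)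
  (ℚₚ.neg-antimono-≤ (subst (ℚ.- p ℚ.≤_) (ℚₚ.∣-p∣≡∣p∣ p) (p≤∣p∣ (ℚ.- p))))

∣∣-≤ : ∀ {p c} → p ℚ.≤ c → ℚ.- p ℚ.≤ c → ∣ p ∣ ℚ.≤ c
∣∣-≤ {p} p≤c -p≤c with ℚₚ.∣p∣≡p∨∣p∣≡-p p
... | inj₁ eq = subst (ℚ._≤ _) (sym eq) p≤c
... | inj₂ eq = subst (ℚ._≤ _) (sym eq) -p≤c

∣*∣-mono-≤ : ∀ {p q a b} → ∣ p ∣ ℚ.≤ a → ∣ q ∣ ℚ.≤ b → ∣ p ℚ.* q ∣ ℚ.≤ a ℚ.* b
∣*∣-mono-≤ {p} {q} {a} {b} p≤a q≤b = begin
  ∣ p ℚ.* q ∣        ≡⟨ ℚₚ.∣p*q∣≡∣p∣*∣q∣ p q ⟩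
  ∣ p ∣ ℚ.* ∣ q ∣    ≤⟨ ℚₚ.*-monoˡ-≤-nonNeg ∣ p ∣ {{ℚₚ.∣-∣-nonNeg p}} q≤b ⟩
  ∣ p ∣ ℚ.* b        ≤⟨ ℚₚ.*-monoʳ-≤-nonNeg b {{ℚ.nonNegative (ℚₚ.≤-trans (ℚₚ.0≤∣p∣ q) q≤b)}} p≤a ⟩
  a ℚ.* b            ∎
  where open ℚₚ.≤-Reasoning

halfPow : ℕ → ℚ
halfPow zero    = 1ℚ
halfPow (suc m) = ½ ℚ.* halfPow m

½+½ : ∀ p → ½ ℚ.* p ℚ.+ ½ ℚ.* p ≡ p
½+½ p = trans (sym (ℚₚ.*-distribʳ-+ p ½ ½)) (ℚₚ.*-identityˡ p)

0<½* : ∀ {p} → 0ℚ ℚ.< p → 0ℚ ℚ.< ½ ℚ.* p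
0<½* = ℚₚ.*-monoʳ-<-pos ½

0<halfPow : ∀ m → 0ℚ ℚ.< halfPow m
0<halfPow zero    = ℚₚ.positive⁻¹ 1ℚ
0<halfPow (suc m) = 0<½* (0<halfPow m)

halfPow-suc-≤ : ∀ m → halfPow (suc m) ℚ.≤ halfPow m
halfPow-suc-≤ m = ℚₚ.<⇒≤ (subst₂ ℚ._<_ (ℚₚ.+-identityʳ _) (½+½ (halfPow m))
  (ℚₚ.+-monoʳ-< (½ ℚ.* halfPow m) (0<halfPow (suc m))))

halfPow-anti : ∀ {m n} → m ℕ.≤ n → halfPow n ℚ.≤ halfPow m
halfPow-anti {m} {n} m≤n with ℕₚ.m≤n⇒m<n∨m≡n m≤n
... | inj₂ refl = ℚₚ.≤-refl
halfPow-anti {m} {suc n} m≤n | inj₁ (s≤s m≤n′) =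
  ℚₚ.≤-trans (halfPow-suc-≤ n) (halfPow-anti m≤n′)

-- This is m + 1 ≤ 2^m divided by 2^m. The induction step rests on m + 2 ≤ 2 (m + 1).
halfPow*suc≤1 : ∀ m → halfPow m ℚ.* ((+ suc m) ℚ./ 1) ℚ.≤ 1ℚ
halfPow*suc≤1 zero    = ℚₚ.≤-refl
halfPow*suc≤1 (suc m) = begin
  ½ ℚ.* h ℚ.* ((+ suc (suc m)) ℚ./ 1)              ≡⟨ cong (½ ℚ.* h ℚ.*_) (trans (/1-suc (suc m)) (cong (ℚ._+ 1ℚ) (/1-suc m))) ⟩
  ½ ℚ.* h ℚ.* (s ℚ.+ 1ℚ ℚ.+ 1ℚ)                    ≤⟨ ℚₚ.*-monoˡ-≤-nonNeg (½ ℚ.* h) {{ℚ.nonNegative (ℚₚ.<⇒≤ (0<halfPow (suc m)))}} step ⟩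
  ½ ℚ.* h ℚ.* ((s ℚ.+ 1ℚ) ℚ.+ (s ℚ.+ 1ℚ))          ≡⟨ solve 2 (λ h s → con ½ :* h :* (s :+ s) := h :* s) refl h (s ℚ.+ 1ℚ) ⟩
  h ℚ.* (s ℚ.+ 1ℚ)                                 ≡⟨ cong (h ℚ.*_) (/1-suc m) ⟨
  h ℚ.* ((+ suc m) ℚ./ 1)                          ≤⟨ halfPow*suc≤1 m ⟩
  1ℚ                                               ∎
  where
  open ℚₚ.≤-Reasoning
  open +-*-Solver
  h s : ℚ
  h = halfPow m
  s = (+ m) ℚ./ 1
  0≤s : 0ℚ ℚ.≤ s
  0≤s = ℚₚ.nonNegative⁻¹ s {{ℚₚ.normalize-nonNeg m 1}}
  step : s ℚ.+ 1ℚ ℚ.+ 1ℚ ℚ.≤ (s ℚ.+ 1ℚ) ℚ.+ (s ℚ.+ 1ℚ)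
  step = ≤-shift 0≤s (solve 1 (λ s → ((s :+ con 1ℚ) :+ (s :+ con 1ℚ)) :- (s :+ con 1ℚ :+ con 1ℚ) := s :- con 0ℚ) refl s)

-- For ε = p / q with p ≥ 1 the exponent q works, as 2^q ≥ q + 1 > 1 / ε.
halfPow-archimedean : ∀ ε → 0ℚ ℚ.< ε → ∃[ m ] halfPow m ℚ.< ε
halfPow-archimedean ε 0<ε = d , ℚₚ.≰⇒> λ ε≤h → ℚₚ.<-irrefl refl (begin-strict
  1ℚ                            ≤⟨ 1≤ε*d ⟩
  ε ℚ.* ((+ d) ℚ./ 1)           ≤⟨ ℚₚ.*-monoʳ-≤-nonNeg ((+ d) ℚ./ 1) {{ℚₚ.normalize-nonNeg d 1}} ε≤h ⟩
  h ℚ.* ((+ d) ℚ./ 1)           <⟨ ℚₚ.*-monoʳ-<-pos h {{ℚ.positive (0<halfPow d)}} (p<p+1 ((+ d) ℚ./ 1)) ⟩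
  h ℚ.* ((+ d) ℚ./ 1 ℚ.+ 1ℚ)    ≡⟨ cong (h ℚ.*_) (/1-suc d) ⟨
  h ℚ.* ((+ suc d) ℚ./ 1)       ≤⟨ halfPow*suc≤1 d ⟩
  1ℚ                            ∎)
  where
  open ℚₚ.≤-Reasoning
  d : ℕ
  d = ℚ.↧ₙ ε
  h : ℚ
  h = halfPow d
  1≤ε*d : 1ℚ ℚ.≤ ε ℚ.* ((+ d) ℚ./ 1)
  1≤ε*d = ℚₚ.toℚᵘ-cancel-≤ (ℚᵘₚ.≤-respʳ-≃
    (ℚᵘₚ.≃-sym (ℚᵘₚ.≃-trans (ℚₚ.toℚᵘ-homo-* ε ((+ d) ℚ./ 1))
      (ℚᵘₚ.*-congˡ {ℚ.toℚᵘ ε} (ℚₚ.toℚᵘ-fromℚᵘ (ℚᵘ.mkℚᵘ (+ d) 0)))))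
    (aux ε 0<ε))
    where
    aux : ∀ ε → 0ℚ ℚ.< ε → ℚᵘ.1ℚᵘ ℚᵘ.≤ ℚ.toℚᵘ ε ℚᵘ.* ℚᵘ.mkℚᵘ (+ ℚ.↧ₙ ε) 0
    aux (ℚ.mkℚ (+ suc n) d-1 _) _ = ℚᵘ.*≤* (ℤ.+≤+ (subst₂ ℕ._≤_
      (sym (trans (ℕₚ.*-identityˡ _) (ℕₚ.*-identityʳ (suc d-1))))
      (sym (trans (ℕₚ.*-identityʳ _) refl))
      (ℕₚ.m≤m+n (suc d-1) (n ℕ.* suc d-1))))
    aux (ℚ.mkℚ (+ zero) _ _) (ℚ.*<* (ℤ.+<+ ()))
    aux (ℚ.mkℚ -[1+ _ ] _ _) (ℚ.*<* ())

-- Half-spaces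

maxFin : ∀ {n} (f : Fin n → ℕ) → ∃[ M ] (∀ i → f i ℕ.≤ M)
maxFin {zero}  f = 0 , λ ()
maxFin {suc n} f with M , f≤M ← maxFin (f ∘ suc) =
  f zero ℕ.⊔ M , λ { zero    → ℕₚ.m≤m⊔n (f zero) M
                   ; (suc i) → ℕₚ.≤-trans (f≤M i) (ℕₚ.m≤n⊔m (f zero) M) }

0<⊓ : ∀ {p q} → 0ℚ ℚ.< p → 0ℚ ℚ.< q → 0ℚ ℚ.< p ℚ.⊓ q
0<⊓ {p} {q} 0<p 0<q with ℚₚ.≤-total p q
... | inj₁ p≤q = subst (0ℚ ℚ.<_) (sym (ℚₚ.p≤q⇒p⊓q≡p p≤q)) 0<p
... | inj₂ q≤p = subst (0ℚ ℚ.<_) (sym (ℚₚ.p≥q⇒p⊓q≡q q≤p)) 0<q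

ℝ<-asym : ∀ {x y} → x < y → y < x → ⊥
ℝ<-asym {x} {y} (ε , M , 0<ε , x<y) (δ , N , 0<δ , y<x) = ℚₚ.<-irrefl refl (begin-strict
  a                  ≡⟨ ℚₚ.+-identityʳ a ⟨
  a ℚ.+ 0ℚ           <⟨ ℚₚ.+-monoʳ-< a 0<ε ⟩
  a ℚ.+ ε            ≤⟨ x<y (M ℕ.⊔ N) (ℕₚ.m≤m⊔n M N) ⟩
  b                  ≡⟨ ℚₚ.+-identityʳ b ⟨
  b ℚ.+ 0ℚ           <⟨ ℚₚ.+-monoʳ-< b 0<δ ⟩
  b ℚ.+ δ            ≤⟨ y<x (M ℕ.⊔ N) (ℕₚ.m≤n⊔m M N) ⟩
  a                  ∎)
  where
  open ℚₚ.≤-Reasoning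
  a b : ℚ
  a = seq x (M ℕ.⊔ N)
  b = seq y (M ℕ.⊔ N)

-- The order depends only on the termwise differences, so `ε` and `N` serve again. Rearranging a
-- real inequality thus becomes a ring identity between rationals.
ℝ<-shift : ∀ {x y x′ y′} → x < y →
           (∀ n → seq y′ n ℚ.- seq x′ n ≡ seq y n ℚ.- seq x n) → x′ < y′
ℝ<-shift {x} {y} {x′} {y′} (ε , N , 0<ε , x<y) eq = ε , N , 0<ε , λ n N≤n →
  ≤-shift (x<y n N≤n) (trans (lemma (seq x′ n) (seq y′ n))
    (trans (cong (ℚ._- ε) (eq n)) (sym (lemma (seq x n) (seq y n)))))
  where
  lemma : ∀ a b → b ℚ.- (a ℚ.+ ε) ≡ (b ℚ.- a) ℚ.- ε
  lemma a b = solve 3 (λ a b ε → b :- (a :+ ε) := (b :- a) :- ε) refl a b ε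
    where open +-*-Solver

fromℚ-mono-< : ∀ {x y} {p q} → (∀ n → seq x n ≡ p) → (∀ n → seq y n ≡ q) → p ℚ.< q → x < y
fromℚ-mono-< {p = p} {q} x≡p y≡q p<q = q ℚ.- p , 0 , <⇒0<- p<q , λ n _ →
  subst₂ (λ a b → a ℚ.+ (q ℚ.- p) ℚ.≤ b) (sym (x≡p n)) (sym (y≡q n))
    (ℚₚ.≤-reflexive (p+[q-p] p q))

fromℚ-cancel-< : ∀ {x y} {p q} → (∀ n → seq x n ≡ p) → (∀ n → seq y n ≡ q) → x < y → p ℚ.< q
fromℚ-cancel-< {p = p} x≡p y≡q (ε , N , 0<ε , x<y) = ℚₚ.<-≤-trans
  (subst (ℚ._< p ℚ.+ ε) (ℚₚ.+-identityʳ p) (ℚₚ.+-monoʳ-< p 0<ε))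
  (subst₂ (λ a b → a ℚ.+ ε ℚ.≤ b) (x≡p N) (y≡q N) (x<y N ℕₚ.≤-refl))

halfspace-< : ∀ {n} (i j : Fin n) r → Open (λ w → w i - w j < r)
halfspace-< i j r z (ε , N , 0<ε , z<r) = δ , 0<½* (0<½* 0<ε) , λ {w} → inside w
  where
  δ : ℚ
  -- Of the gap ε = 4 δ, each of the two coordinates of `w` may use up δ; one δ is the new gap and
  -- one is spare.
  δ = ½ ℚ.* (½ ℚ.* ε)
  inside : ∀ w → Ball z δ w → w i - w j < r
  inside w ball with _ , Nᵢ , 0<εᵢ , pᵢ ← proj₂ (ball i) | _ , Nⱼ , 0<εⱼ , pⱼ ← proj₁ (ball j) =
    δ , N ℕ.⊔ (Nᵢ ℕ.⊔ Nⱼ) , 0<½* (0<½* 0<ε) , λ m m≥ →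
    let m≥ᵢⱼ = ℕₚ.m⊔n≤o⇒n≤o N (Nᵢ ℕ.⊔ Nⱼ) m≥
        wᵢ = +pos≤⇒≤ (seq (w i - z i) m) 0<εᵢ (pᵢ m (ℕₚ.m⊔n≤o⇒m≤o Nᵢ Nⱼ m≥ᵢⱼ))
        wⱼ = +pos≤⇒≤ (ℚ.- δ) 0<εⱼ (pⱼ m (ℕₚ.m⊔n≤o⇒n≤o Nᵢ Nⱼ m≥ᵢⱼ))
        zz = z<r m (ℕₚ.m⊔n≤o⇒m≤o N (Nᵢ ℕ.⊔ Nⱼ) m≥)
    in ≤-lin (≤⇒0≤- wᵢ ⊕ ≤⇒0≤- wⱼ ⊕ ≤⇒0≤- zz ⊕ ℚₚ.<⇒≤ (0<½* (0<½* 0<ε)))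
         (solve 6 (λ a b c d r ε → let δ = con ½ :* (con ½ :* ε) in
            r :- ((c :- d) :+ δ) :=
            ((δ :- (c :- a)) :+ ((d :- b) :- (:- δ)) :+ (r :- ((a :- b) :+ ε)) :+ δ))
          refl (seq (z i) m) (seq (z j) m) (seq (w i) m) (seq (w j) m) (seq r m) ε)
    where open +-*-Solver

<-flip : ∀ r x y → r < x - y → y - x < neg r
<-flip r x y r<x-y = ℝ<-shift {r} {x - y} {y - x} {neg r} r<x-y λ n →
  solve 3 (λ r x y → :- r :- (y :- x) := (x :- y) :- r) refl (seq r n) (seq x n) (seq y n)
  where open +-*-Solver

<-unflip : ∀ r x y → y - x < neg r → r < x - y
<-unflip r x y y-x<-r = ℝ<-shift {y - x} {neg r} {r} {x - y} y-x<-r λ n →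
  solve 3 (λ r x y → (x :- y) :- r := :- r :- (y :- x)) refl (seq r n) (seq x n) (seq y n)
  where open +-*-Solver

halfspace-> : ∀ {n} (i j : Fin n) r → Open (λ w → r < w i - w j)
halfspace-> i j r z r<z =
  let ε , 0<ε , ball = halfspace-< j i (neg r) z (<-flip r (z i) (z j) r<z)
  in ε , 0<ε , λ {w} w∈ball → <-unflip r (w i) (w j) (ball {w} w∈ball)

module _ {n k : ℕ} where
  open ShiHyperplane

  Below Above : ShiHyperplane n k → Point n → Set
  Below H x = x (i H) - x (j H) < fromℤ (l H)
  Above H x = fromℤ (l H) < x (i H) - x (j H)

  module _ (H : ShiHyperplane n k) {x z : Point n}
           (sc : SameComponent (Complement n k) x z) where
    private
      C = proj₁ sc
      conn = proj₁ (proj₂ sc)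
      C⊆X = proj₁ (proj₂ (proj₂ sc))
      x∈C = proj₁ (proj₂ (proj₂ (proj₂ sc)))
      z∈C = proj₂ (proj₂ (proj₂ (proj₂ sc)))

      separated : (Below H x × Above H z) ⊎ (Above H x × Below H z) → ⊥
      separated s = [ (λ { (b , a) → cut (x , x∈C , b) (z , z∈C , a) })
                    , (λ { (a , b) → cut (z , z∈C , b) (x , x∈C , a) }) ]′ s
        where
        cut = conn (Below H) (Above H)
          (halfspace-< (i H) (j H) (fromℤ (l H))) (halfspace-> (i H) (j H) (fromℤ (l H)))
          (λ w∈C → C⊆X w∈C H)
          (λ { {w} (_ , b , a) → ℝ<-asym {w (i H) - w (j H)} {fromℤ (l H)} b a })

    -- The open half-spaces of `H` are disjoint and cover the complement, so a connected subset of
    -- the complement cannot meet both.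
    Below-component : Below H x → Below H z
    Below-component b = [ id , (λ a → ⊥-elim (separated (inj₁ (b , a)))) ]′ (C⊆X z∈C H)

    Above-component : Above H x → Above H z
    Above-component a = [ (λ b → ⊥-elim (separated (inj₂ (a , b)))) , id ]′ (C⊆X z∈C H)

  -- The points with the signs of `x`. Implications in one direction suffice, because for `x` in the
  -- complement one of the two premises holds at each hyperplane.
  Agree : Point n → Pred (Point n) 0ℓ
  Agree x w = ∀ H → (Below H x → Below H w) × (Above H x → Above H w)

  Agree⇒Complement : ∀ {x} → x ∈ Complement n k → Agree x ⊆ Complement n k
  Agree⇒Complement cx agree H = [ inj₁ ∘ proj₁ (agree H) , inj₂ ∘ proj₂ (agree H) ]′ (cx H)

-- Connectedness of convex sets

-- A real number in [0, 1] whose terms all lie in [0, 1]. The limit of a bisection may be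
-- irrational, and bounds on every term let convexity be checked term by term.
record UnitSeq : Set where
  field
    at       : ℕ → ℚ
    isCauchy : IsCauchy at
    0≤at     : ∀ m → 0ℚ ℚ.≤ at m
    at≤1     : ∀ m → at m ℚ.≤ 1ℚ

open UnitSeq

constant : ∀ t → 0ℚ ℚ.≤ t → t ℚ.≤ 1ℚ → UnitSeq
constant t 0≤t t≤1 = record
  { at       = seq (fromℚ t)
  ; isCauchy = cauchy (fromℚ t)
  ; 0≤at     = λ _ → 0≤t
  ; at≤1     = λ _ → t≤1
  }

bounded : ∀ x → ∃[ B ] ∃[ N ] (0ℚ ℚ.< B × (∀ m → N ℕ.≤ m → ∣ seq x m ∣ ℚ.≤ B))
bounded x with N , close ← cauchy x 1ℚ (ℚₚ.positive⁻¹ 1ℚ) =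
  ∣ seq x N ∣ ℚ.+ 1ℚ , N , ℚₚ.≤-<-trans (ℚₚ.0≤∣p∣ (seq x N)) (p<p+1 ∣ seq x N ∣) , λ m N≤m → begin
    ∣ seq x m ∣                                      ≡⟨ cong ∣_∣ (p+[q-p] (seq x N) (seq x m)) ⟨
    ∣ seq x N ℚ.+ (seq x m ℚ.- seq x N) ∣            ≤⟨ ℚₚ.∣p+q∣≤∣p∣+∣q∣ (seq x N) _ ⟩
    ∣ seq x N ∣ ℚ.+ ∣ seq x m ℚ.- seq x N ∣          ≤⟨ ℚₚ.+-monoʳ-≤ ∣ seq x N ∣ (ℚₚ.<⇒≤ (close m N N≤m ℕₚ.≤-refl)) ⟩
    ∣ seq x N ∣ ℚ.+ 1ℚ                               ∎
  where open ℚₚ.≤-Reasoning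

÷-pos : ∀ p q → 0ℚ ℚ.< p → 0ℚ ℚ.< q → ∃[ r ] (0ℚ ℚ.< r × r ℚ.* q ≡ p)
÷-pos p q 0<p 0<q = p ℚ.* q⁻¹ , 0<r , trans (ℚₚ.*-assoc p q⁻¹ q)
    (trans (cong (p ℚ.*_) (ℚₚ.*-inverseˡ q)) (ℚₚ.*-identityʳ p))
  where
  instance
    q-pos : ℚ.Positive q
    q-pos = ℚ.positive 0<q
    q-nonZero : ℚ.NonZero q
    q-nonZero = ℚₚ.pos⇒nonZero q
  q⁻¹ : ℚ
  q⁻¹ = ℚ.1/ q
  0<r : 0ℚ ℚ.< p ℚ.* q⁻¹
  0<r = ℚₚ.positive⁻¹ _ {{ℚₚ.pos*pos⇒pos p {{ℚ.positive 0<p}} q⁻¹ {{ℚₚ.1/pos⇒pos q}}}}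

-- A product of reals with the first factor in [0, 1]. For the Cauchy property, t p - s q = (t - s)
-- p + s (p - q), where `δ` satisfies δ B = ε / 2 for an eventual bound `B` of `d`.
scale : UnitSeq → ℝ → ℝ
scale T d = mkℝ (λ m → at T m ℚ.* seq d m) λ ε 0<ε →
  let B , N₀ , 0<B , d≤B = bounded d
      δ , 0<δ , δB≡      = ÷-pos (½ ℚ.* ε) B (0<½* 0<ε) 0<B
      N₁ , T-close       = isCauchy T δ 0<δ
      N₂ , d-close       = cauchy d (½ ℚ.* ε) (0<½* 0<ε)
      N                  = N₀ ℕ.⊔ (N₁ ℕ.⊔ N₂)
      N₀≤                = λ {m} → ℕₚ.m⊔n≤o⇒m≤o {m} N₀ (N₁ ℕ.⊔ N₂)
      N₁≤                = λ {m} p → ℕₚ.m⊔n≤o⇒m≤o {m} N₁ N₂ (ℕₚ.m⊔n≤o⇒n≤o N₀ (N₁ ℕ.⊔ N₂) p)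
      N₂≤                = λ {m} p → ℕₚ.m⊔n≤o⇒n≤o {m} N₁ N₂ (ℕₚ.m⊔n≤o⇒n≤o N₀ (N₁ ℕ.⊔ N₂) p)
  in N , λ m n N≤m N≤n →
    let t = at T m ; s = at T n ; p = seq d m ; q = seq d n
        open ℚₚ.≤-Reasoning in begin-strict
      ∣ t ℚ.* p ℚ.- s ℚ.* q ∣
        ≡⟨ cong ∣_∣ (solve 4 (λ t s p q → t :* p :- s :* q := (t :- s) :* p :+ s :* (p :- q)) refl t s p q) ⟩
      ∣ (t ℚ.- s) ℚ.* p ℚ.+ s ℚ.* (p ℚ.- q) ∣
        ≤⟨ ℚₚ.∣p+q∣≤∣p∣+∣q∣ ((t ℚ.- s) ℚ.* p) (s ℚ.* (p ℚ.- q)) ⟩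
      ∣ (t ℚ.- s) ℚ.* p ∣ ℚ.+ ∣ s ℚ.* (p ℚ.- q) ∣
        <⟨ ℚₚ.+-mono-≤-<
             (ℚₚ.≤-trans (∣*∣-mono-≤ {t ℚ.- s} {p} (ℚₚ.<⇒≤ (T-close m n (N₁≤ N≤m) (N₁≤ N≤n))) (d≤B m (N₀≤ N≤m)))
                         (ℚₚ.≤-reflexive δB≡))
             (ℚₚ.≤-<-trans (∣*∣-mono-≤ {s} {p ℚ.- q} (∣∣≤1 n) ℚₚ.≤-refl)
               (subst (ℚ._< ½ ℚ.* ε) (sym (ℚₚ.*-identityˡ _)) (d-close m n (N₂≤ N≤m) (N₂≤ N≤n)))) ⟩
      ½ ℚ.* ε ℚ.+ ½ ℚ.* ε
        ≡⟨ ½+½ ε ⟩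
      ε ∎
  where
  open +-*-Solver
  ∣∣≤1 : ∀ n → ∣ at T n ∣ ℚ.≤ 1ℚ
  ∣∣≤1 n = subst (ℚ._≤ 1ℚ) (sym (ℚₚ.0≤p⇒∣p∣≡p (0≤at T n))) (at≤1 T n)

segment : ∀ {n} → Point n → Point n → UnitSeq → Point n
segment u v T i = u i + scale T (v i - u i)

private
  affine : ∀ t a b c d → (a ℚ.+ t ℚ.* (b ℚ.- a)) ℚ.- (c ℚ.+ t ℚ.* (d ℚ.- c)) ≡
                         (a ℚ.- c) ℚ.+ t ℚ.* ((b ℚ.- d) ℚ.- (a ℚ.- c))
  affine = solve 5 (λ t a b c d → (a :+ t :* (b :- a)) :- (c :+ t :* (d :- c)) :=
                                  (a :- c) :+ t :* ((b :- d) :- (a :- c))) refl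
    where open +-*-Solver

-- By `affine`, the difference of two coordinates is, from stage M ⊔ N on, a convex combination of
-- two rationals that stay below the term of `r` by min(ε, δ); this minimum is the new gap.
segment-< : ∀ {n} (u v : Point n) T i j r → u i - u j < r → v i - v j < r →
            segment u v T i - segment u v T j < r
segment-< u v T i j r (ε , M , 0<ε , u<r) (δ , N , 0<δ , v<r) =
  ε ℚ.⊓ δ , M ℕ.⊔ N , 0<⊓ 0<ε 0<δ , λ m m≥ →
    let a = seq (u i - u j) m ; b = seq (v i - v j) m ; t = at T m ; c = seq r m
        below : ∀ p γ → ε ℚ.⊓ δ ℚ.≤ γ → p ℚ.+ γ ℚ.≤ c → p ℚ.≤ c ℚ.- (ε ℚ.⊓ δ)
        below p γ μ≤γ p+γ≤c = ≤-lin (≤⇒0≤- μ≤γ ⊕ ≤⇒0≤- p+γ≤c)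
          (solve 4 (λ p γ μ c → (c :- μ) :- p := (γ :- μ) :+ (c :- (p :+ γ))) refl p γ (ε ℚ.⊓ δ) c)
    in ≤-lin (≤⇒0≤- (blend-≤ {a = a} {b} (0≤at T m) (at≤1 T m)
               (below a ε (ℚₚ.p⊓q≤p ε δ) (u<r m (ℕₚ.m⊔n≤o⇒m≤o M N m≥)))
               (below b δ (ℚₚ.p⊓q≤q ε δ) (v<r m (ℕₚ.m⊔n≤o⇒n≤o M N m≥)))))
         (trans (cong (λ s → c ℚ.- (s ℚ.+ ε ℚ.⊓ δ)) (affine t (seq (u i) m) (seq (v i) m) (seq (u j) m) (seq (v j) m)))
           (solve 3 (λ s μ c → c :- (s :+ μ) := (c :- μ) :- s) refl (a ℚ.+ t ℚ.* (b ℚ.- a)) (ε ℚ.⊓ δ) c))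
  where open +-*-Solver

segment-> : ∀ {n} (u v : Point n) T i j r → r < u i - u j → r < v i - v j →
            r < segment u v T i - segment u v T j
segment-> u v T i j r r<u r<v = <-unflip r (segment u v T i) (segment u v T j)
  (segment-< u v T j i (neg r) (<-flip r (u i) (u j) r<u) (<-flip r (v i) (v j) r<v))

maxℚ : ∀ {n} (f : Fin n → ℚ) → ∃[ B ] (0ℚ ℚ.< B × (∀ i → f i ℚ.≤ B))
maxℚ {zero}  f = 1ℚ , ℚₚ.positive⁻¹ 1ℚ , λ ()
maxℚ {suc n} f with B , 0<B , f≤B ← maxℚ (f ∘ suc) =
  f zero ℚ.⊔ B , ℚₚ.<-≤-trans 0<B (ℚₚ.p≤q⊔p (f zero) B) ,
  λ { zero    → ℚₚ.p≤p⊔q (f zero) B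
    ; (suc i) → ℚₚ.≤-trans (f≤B i) (ℚₚ.p≤q⊔p (f zero) B) }

bounded-uniformly : ∀ {n} (d : Fin n → ℝ) →
  ∃[ B ] ∃[ N ] (0ℚ ℚ.< B × (∀ i m → N ℕ.≤ m → ∣ seq (d i) m ∣ ℚ.≤ B))
bounded-uniformly d
  with B , 0<B , ≤B ← maxℚ (λ i → proj₁ (bounded (d i)))
     | N , ≤N ← maxFin (λ i → proj₁ (proj₂ (bounded (d i)))) =
  B , N , 0<B , λ i m N≤m →
    ℚₚ.≤-trans (proj₂ (proj₂ (proj₂ (bounded (d i)))) m (ℕₚ.≤-trans (≤N i) N≤m)) (≤B i)

UnitPred : Set₁
UnitPred = ∀ t → 0ℚ ℚ.≤ t → t ℚ.≤ 1ℚ → Set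

0≤1 : 0ℚ ℚ.≤ 1ℚ
0≤1 = ℚₚ.<⇒≤ (ℚₚ.positive⁻¹ 1ℚ)

Near : UnitSeq → ℚ → ℚ → Set
Near L ε t = ∃[ M ] (∀ m → M ℕ.≤ m → ∣ t ℚ.- at L m ∣ ℚ.≤ ε)

LimitPoint : UnitPred → UnitSeq → ℚ → Set
LimitPoint P L ε = ∃[ t ] Σ[ 0≤t ∈ 0ℚ ℚ.≤ t ] Σ[ t≤1 ∈ t ℚ.≤ 1ℚ ] (P t 0≤t t≤1 × Near L ε t)

-- The hypothesis `P⊎Q` acts as a decision at rational parameters and selects the half to keep.
-- Neither predicate is claimed at the limit, which is only approached through points of both.
module Bisection (P Q : UnitPred) (P⊎Q : ∀ t 0≤t t≤1 → P t 0≤t t≤1 ⊎ Q t 0≤t t≤1)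
  (P0 : P 0ℚ ℚₚ.≤-refl 0≤1) (Q1 : Q 1ℚ 0≤1 ℚₚ.≤-refl)
  where

  Bisected : Set
  Bisected = Σ[ L ∈ UnitSeq ] (∀ ε → 0ℚ ℚ.< ε → LimitPoint P L ε × LimitPoint Q L ε)

  record Interval : Set where
    field
      left right : ℚ
      0≤left     : 0ℚ ℚ.≤ left
      left≤1     : left ℚ.≤ 1ℚ
      0≤right    : 0ℚ ℚ.≤ right
      right≤1    : right ℚ.≤ 1ℚ
      leftP      : P left 0≤left left≤1
      rightQ     : Q right 0≤right right≤1

  open Interval

  HasWidth : ℕ → Interval → Set
  HasWidth m I = right I ≡ left I ℚ.+ halfPow m

  Stage : ℕ → Set
  Stage m = Σ[ I ∈ Interval ] HasWidth m I

  left≤right : ∀ m ((I , _) : Stage m) → left I ℚ.≤ right I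
  left≤right m (I , gap) = ≤-lin (ℚₚ.<⇒≤ (0<halfPow m)) (trans (cong (ℚ._- left I) gap)
    (solve 2 (λ l h → (l :+ h) :- l := h) refl (left I) (halfPow m)))
    where open +-*-Solver


  start : Stage 0
  start = record
    { left    = 0ℚ
    ; right   = 1ℚ
    ; 0≤left  = ℚₚ.≤-refl
    ; left≤1  = 0≤1
    ; 0≤right = 0≤1
    ; right≤1 = ℚₚ.≤-refl
    ; leftP   = P0
    ; rightQ  = Q1
    } , refl

  Refines : Interval → Interval → Set
  Refines I J = left I ℚ.≤ left J × right J ℚ.≤ right I

  refine : ∀ m ((I , _) : Stage m) → Σ[ (J , _) ∈ Stage (suc m) ] Refines I J
  refine m (s , gap) = [ right-half , left-half ]′ (P⊎Q middle 0≤middle middle≤1)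
    where
    h middle : ℚ
    h      = halfPow (suc m)
    middle = left s ℚ.+ h
    right≡ : right s ≡ middle ℚ.+ h
    right≡ = trans gap (trans (cong (left s ℚ.+_) (sym (½+½ (halfPow m)))) (sym (ℚₚ.+-assoc (left s) h h)))
    0≤h : 0ℚ ℚ.≤ h
    0≤h = ℚₚ.<⇒≤ (0<halfPow (suc m))
    left≤middle : left s ℚ.≤ middle
    left≤middle = subst (ℚ._≤ middle) (ℚₚ.+-identityʳ (left s)) (ℚₚ.+-monoʳ-≤ (left s) 0≤h)
    middle≤right : middle ℚ.≤ right s
    middle≤right = subst₂ ℚ._≤_ (ℚₚ.+-identityʳ middle) (sym right≡) (ℚₚ.+-monoʳ-≤ middle 0≤h)
    0≤middle : 0ℚ ℚ.≤ middle
    0≤middle = ℚₚ.≤-trans (0≤left s) left≤middle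
    middle≤1 : middle ℚ.≤ 1ℚ
    middle≤1 = ℚₚ.≤-trans middle≤right (right≤1 s)
    right-half : P middle 0≤middle middle≤1 → Σ[ (J , _) ∈ Stage (suc m) ] Refines s J
    right-half Pmid = (record
      { left = middle ; right = right s
      ; 0≤left = 0≤middle ; left≤1 = middle≤1 ; 0≤right = 0≤right s ; right≤1 = right≤1 s
      ; leftP = Pmid ; rightQ = rightQ s } , right≡) , left≤middle , ℚₚ.≤-refl
    left-half : Q middle 0≤middle middle≤1 → Σ[ (J , _) ∈ Stage (suc m) ] Refines s J
    left-half Qmid = (record
      { left = left s ; right = middle
      ; 0≤left = 0≤left s ; left≤1 = left≤1 s ; 0≤right = 0≤middle ; right≤1 = middle≤1
      ; leftP = leftP s ; rightQ = Qmid } , refl) , ℚₚ.≤-refl , middle≤right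

  stage : ∀ m → Stage m
  stage zero    = start
  stage (suc m) = proj₁ (refine m (stage m))

  stage-refines : ∀ {m m′} → m ℕ.≤ m′ → Refines (proj₁ (stage m)) (proj₁ (stage m′))
  stage-refines {m} {m′} m≤m′ with ℕₚ.m≤n⇒m<n∨m≡n m≤m′
  ... | inj₂ refl = ℚₚ.≤-refl , ℚₚ.≤-refl
  stage-refines {m} {suc m′} _ | inj₁ (s≤s m≤m′) =
    let l , r = stage-refines m≤m′ ; l′ , r′ = proj₂ (refine m′ (stage m′))
    in ℚₚ.≤-trans l l′ , ℚₚ.≤-trans r′ r

  interval : ℕ → Interval
  interval m = proj₁ (stage m)

  private
    T : ℕ → ℚ
    T m = left (interval m)

    InStage : ℕ → ℚ → Set
    InStage m t = left (interval m) ℚ.≤ t × t ℚ.≤ right (interval m)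

    T∈stage : ∀ {m m′} → m ℕ.≤ m′ → InStage m (T m′)
    T∈stage {m} {m′} m≤m′ = let l , r = stage-refines m≤m′ in
      l , ℚₚ.≤-trans (left≤right m′ (stage m′)) r

    stage-width : ∀ m s t → InStage m s → InStage m t → ∣ s ℚ.- t ∣ ℚ.≤ halfPow m
    stage-width m s t (l≤s , s≤r) (l≤t , t≤r) =
      ∣∣-≤ (≤-lin (≤⇒0≤- (ℚₚ.≤-trans s≤r (ℚₚ.≤-reflexive (proj₂ (stage m)))) ⊕ ≤⇒0≤- l≤t)
             (solve 4 (λ s t l h → h :- (s :- t) := ((l :+ h) :- s) :+ (t :- l)) refl s t l h))
           (≤-lin (≤⇒0≤- (ℚₚ.≤-trans t≤r (ℚₚ.≤-reflexive (proj₂ (stage m)))) ⊕ ≤⇒0≤- l≤s)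
             (solve 4 (λ s t l h → h :- (:- (s :- t)) := ((l :+ h) :- t) :+ (s :- l)) refl s t l h))
      where
      open +-*-Solver
      l h : ℚ
      l = left (interval m)
      h = halfPow m

  limit : UnitSeq
  limit = record
    { at       = T
    ; isCauchy = λ ε 0<ε → let M , h<ε = halfPow-archimedean ε 0<ε in
        M , λ m m′ M≤m M≤m′ → ℚₚ.≤-<-trans (stage-width M (T m) (T m′) (T∈stage M≤m) (T∈stage M≤m′)) h<ε
    ; 0≤at     = λ m → 0≤left (interval m)
    ; at≤1     = λ m → left≤1 (interval m)
    }

  bisection : Bisected
  bisection = limit , λ ε 0<ε → let M , h<ε = halfPow-archimedean ε 0<ε ; I = interval M in
    (left I , 0≤left I , left≤1 I , leftP I , M , λ m M≤m →
      ℚₚ.≤-trans (stage-width M (left I) (T m) (ℚₚ.≤-refl , left≤right M (stage M)) (T∈stage M≤m)) (ℚₚ.<⇒≤ h<ε)) ,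
    (right I , 0≤right I , right≤1 I , rightQ I , M , λ m M≤m →
      ℚₚ.≤-trans (stage-width M (right I) (T m) (left≤right M (stage M) , ℚₚ.≤-refl) (T∈stage M≤m)) (ℚₚ.<⇒≤ h<ε))

near-0 : ∀ x ε → 0ℚ ℚ.< ε → (∀ m → seq x m ≡ 0ℚ) → (fromℚ (ℚ.- ε) < x) × (x < fromℚ ε)
near-0 x ε 0<ε x≡0 = fromℚ-mono-< {fromℚ (ℚ.- ε)} {x} (λ _ → refl) x≡0 (ℚₚ.neg-antimono-< 0<ε)
                   , fromℚ-mono-< {x} {fromℚ ε} x≡0 (λ _ → refl) 0<ε

near-ε : ∀ x ε → 0ℚ ℚ.< ε → ∀ N → (∀ m → N ℕ.≤ m → ∣ seq x m ∣ ℚ.≤ ½ ℚ.* ε) →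
         (fromℚ (ℚ.- ε) < x) × (x < fromℚ ε)
near-ε x ε 0<ε N bound =
  (½ ℚ.* ε , N , 0<½* 0<ε , λ m N≤m →
    ℚₚ.≤-trans (ℚₚ.≤-trans (ℚₚ.≤-reflexive (eq₁ ε)) (ℚₚ.neg-antimono-≤ (bound m N≤m))) (-∣p∣≤p (seq x m))) ,
  (½ ℚ.* ε , N , 0<½* 0<ε , λ m N≤m →
    subst (seq x m ℚ.+ ½ ℚ.* ε ℚ.≤_) (½+½ ε)
      (ℚₚ.+-monoˡ-≤ (½ ℚ.* ε) (ℚₚ.≤-trans (p≤∣p∣ (seq x m)) (bound m N≤m))))
  where
  open +-*-Solver
  eq₁ : ∀ ε → ℚ.- ε ℚ.+ ½ ℚ.* ε ≡ ℚ.- (½ ℚ.* ε)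
  eq₁ = solve 1 (λ ε → :- ε :+ con ½ :* ε := :- (con ½ :* ε)) refl

module _ {n} (u v : Point n) where

  private
    point : ∀ t → 0ℚ ℚ.≤ t → t ℚ.≤ 1ℚ → Point n
    point t 0≤t t≤1 = segment u v (constant t 0≤t t≤1)

  segment-start∈ball : ∀ ε → 0ℚ ℚ.< ε → point 0ℚ ℚₚ.≤-refl 0≤1 ∈ Ball u ε
  segment-start∈ball ε 0<ε i = near-0 (point 0ℚ ℚₚ.≤-refl 0≤1 i - u i) ε 0<ε λ m →
    solve 2 (λ a b → (a :+ con 0ℚ :* (b :- a)) :- a := con 0ℚ) refl (seq (u i) m) (seq (v i) m)
    where open +-*-Solver

  segment-end∈ball : ∀ ε → 0ℚ ℚ.< ε → point 1ℚ 0≤1 ℚₚ.≤-refl ∈ Ball v ε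
  segment-end∈ball ε 0<ε i = near-0 (point 1ℚ 0≤1 ℚₚ.≤-refl i - v i) ε 0<ε λ m →
    solve 2 (λ a b → (a :+ con 1ℚ :* (b :- a)) :- b := con 0ℚ) refl (seq (u i) m) (seq (v i) m)
    where open +-*-Solver

  -- The points at `t` and at `L` differ by (t - L) (v i - u i) in coordinate i. A bound `B` valid
  -- for all coordinates at once gives one δ = ε / (2 B).
  segment-continuous : ∀ L ε → 0ℚ ℚ.< ε → ∃[ δ ] (0ℚ ℚ.< δ × (∀ t 0≤t t≤1 →
    Near L δ t → point t 0≤t t≤1 ∈ Ball (segment u v L) ε))
  segment-continuous L ε 0<ε =
    let B , N , 0<B , ≤B = bounded-uniformly (λ i → v i - u i)
        δ , 0<δ , δB≡ = ÷-pos (½ ℚ.* ε) B (0<½* 0<ε) 0<B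
    in δ , 0<δ , λ t 0≤t t≤1 (M , close) i →
      let w = point t 0≤t t≤1 i - segment u v L i
          d = seq (v i - u i)
          w≡ : ∀ m → seq w m ≡ (t ℚ.- at L m) ℚ.* d m
          w≡ m = solve 4 (λ a d t s → (a :+ t :* d) :- (a :+ s :* d) := (t :- s) :* d) refl (seq (u i) m) (d m) t (at L m)
      in near-ε w ε 0<ε (M ℕ.⊔ N) λ m m≥ → begin
           ∣ seq w m ∣                       ≡⟨ cong ∣_∣ (w≡ m) ⟩
           ∣ (t ℚ.- at L m) ℚ.* d m ∣        ≤⟨ ∣*∣-mono-≤ {t ℚ.- at L m} {d m} (close m (ℕₚ.m⊔n≤o⇒m≤o M N m≥)) (≤B i m (ℕₚ.m⊔n≤o⇒n≤o M N m≥)) ⟩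
           δ ℚ.* B                           ≡⟨ δB≡ ⟩
           ½ ℚ.* ε                           ∎
    where
    open +-*-Solver
    open ℚₚ.≤-Reasoning

-- The limit of a bisection of the segment from u to v lies in U or in V, and
-- the open set containing it contains points of the bisection from both.
segment-not-separated : ∀ {n} (u v : Point n) (U V : Pred (Point n) 0ℓ) → Open U → Open V →
  (∀ T → segment u v T ∈ U ∪ V) → (∀ T → segment u v T ∈ U → segment u v T ∈ V → ⊥) →
  u ∈ U → v ∈ V → ⊥
segment-not-separated u v U V openU openV cover disjoint u∈U v∈V =
  absurd (proj₁ bisection) (proj₂ bisection)
  where
  at-U at-V : UnitPred
  at-U t 0≤t t≤1 = segment u v (constant t 0≤t t≤1) ∈ U
  at-V t 0≤t t≤1 = segment u v (constant t 0≤t t≤1) ∈ V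
  at-0 : at-U 0ℚ ℚₚ.≤-refl 0≤1
  at-0 = let ε , 0<ε , ball = openU u u∈U in
    ball {segment u v (constant 0ℚ ℚₚ.≤-refl 0≤1)} (segment-start∈ball u v ε 0<ε)
  at-1 : at-V 1ℚ 0≤1 ℚₚ.≤-refl
  at-1 = let ε , 0<ε , ball = openV v v∈V in
    ball {segment u v (constant 1ℚ 0≤1 ℚₚ.≤-refl)} (segment-end∈ball u v ε 0<ε)
  open Bisection at-U at-V (λ t 0≤t t≤1 → cover (constant t 0≤t t≤1)) at-0 at-1
  absurd : ∀ L → (∀ ε → 0ℚ ℚ.< ε → LimitPoint at-U L ε × LimitPoint at-V L ε) → ⊥
  absurd L limits = [ in-U , in-V ]′ (cover L)
    where
    in-U : segment u v L ∈ U → ⊥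
    in-U L∈U =
      let ε , 0<ε , ball = openU (segment u v L) L∈U
          δ , 0<δ , near = segment-continuous u v L ε 0<ε
          t , 0≤t , t≤1 , t∈V , t-near = proj₂ (limits δ 0<δ)
          T = constant t 0≤t t≤1
      in disjoint T (ball {segment u v T} (near t 0≤t t≤1 t-near)) t∈V
    in-V : segment u v L ∈ V → ⊥
    in-V L∈V =
      let ε , 0<ε , ball = openV (segment u v L) L∈V
          δ , 0<δ , near = segment-continuous u v L ε 0<ε
          t , 0≤t , t≤1 , t∈U , t-near = proj₁ (limits δ 0<δ)
          T = constant t 0≤t t≤1
      in disjoint T t∈U (ball {segment u v T} (near t 0≤t t≤1 t-near))

module _ {n k : ℕ} where
  open ShiHyperplane

  Agree-connected : ∀ {x : Point n} → x ∈ Complement n k → Connected (Agree {n} {k} x)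
  Agree-connected {x} cx U V openU openV cover disjoint (u , u∈C , u∈U) (v , v∈C , v∈V) =
    segment-not-separated u v U V openU openV (λ T → cover (convex T))
      (λ T ∈U ∈V → disjoint (convex T , ∈U , ∈V)) u∈U v∈V
    where
    convex : ∀ T → segment u v T ∈ Agree {n} {k} x
    convex T H =
      (λ b → segment-< u v T (i H) (j H) (fromℤ (l H)) (proj₁ (u∈C H) b) (proj₁ (v∈C H) b)) ,
      (λ a → segment-> u v T (i H) (j H) (fromℤ (l H)) (proj₂ (u∈C H) a) (proj₂ (v∈C H) a))

  Agree⇒SameComponent : ∀ {x y : Point n} → x ∈ Complement n k → y ∈ Agree {n} {k} x →
                        SameComponent (Complement n k) x y
  Agree⇒SameComponent {x} cx y∈ =
    Agree x , Agree-connected {x} cx , (λ {w} → Agree⇒Complement {x = x} cx {w}) , (λ _ → id , id) , y∈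

-- Approximation by rational points

ι : ℕ → ℚ
ι m = (+ m) ℚ./ 1

uniformly : ∀ {n} {P : Fin n → ℕ → Set} → (∀ {i M N} → M ℕ.≤ N → P i M → P i N) →
            (∀ i → ∃ (P i)) → ∃[ N ] (∀ i → P i N)
uniformly mono p with N , ≤N ← maxFin (λ i → proj₁ (p i)) =
  N , λ i → mono (≤N i) (proj₂ (p i))

module _ {K : ℕ} where
  private
    k : ℕ
    k = suc K

  -- x_i + m < x_j + m′ means x_i - x_j < m′ - m, so this is the level of the hyperplane that
  -- compares the two expressions.
  diff : Fin k → Fin k → ℤ
  diff m m′ = + toℕ m′ ℤ.- + toℕ m

  diff/1 : ∀ m m′ → diff m m′ ℚ./ 1 ≡ ι (toℕ m′) ℚ.- ι (toℕ m)
  diff/1 m m′ = trans (/1-+ (+ toℕ m′) (ℤ.- (+ toℕ m))) (cong (ι (toℕ m′) ℚ.+_) (/1-neg (+ toℕ m)))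

  lowest : ℤ.- (+ k) ℤ.+ + 1 ≡ ℤ.- (+ K)
  lowest = trans (cong (ℤ._+ + 1) (ℤₚ.neg-suc K)) lemma
    where
    lemma : ℤ.-1ℤ ℤ.+ ℤ.- (+ K) ℤ.+ + 1 ≡ ℤ.- (+ K)
    lemma = trans (cong (ℤ._+ + 1) (ℤₚ.+-comm ℤ.-1ℤ (ℤ.- (+ K))))
              (trans (ℤₚ.+-assoc (ℤ.- (+ K)) ℤ.-1ℤ (+ 1)) (ℤₚ.+-identityʳ (ℤ.- (+ K))))

  -- The levels from -k + 1 to k - 1 compare expressions; one of `m` and `m′` can then be taken to
  -- be 0. Only the level k, which decides the jumps, is left over.
  near-or-far : ∀ l → ℤ.- (+ k) ℤ.+ + 1 ℤ.≤ l → l ℤ.≤ + k →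
                (∃₂ λ m m′ → l ≡ diff m m′) ⊎ l ≡ + k
  near-or-far (+ a) _ (ℤ.+≤+ a≤k) with ℕₚ.m≤n⇒m<n∨m≡n a≤k
  ... | inj₁ a<k  = inj₁ (zero , Fin.fromℕ< a<k ,
          sym (trans (ℤₚ.+-identityʳ _) (cong +_ (Finₚ.toℕ-fromℕ< a<k))))
  ... | inj₂ refl = inj₂ refl
  near-or-far -[1+ a ] lower _ = inj₁ (Fin.fromℕ< (s≤s a<K) , zero ,
      sym (trans (ℤₚ.+-identityˡ _) (cong (λ b → ℤ.- (+ b)) (Finₚ.toℕ-fromℕ< (s≤s a<K)))))
    where
    a<K : a ℕ.< K
    a<K = ℤₚ.drop‿+≤+ (ℤₚ.neg-cancel-≤ {+ K} {+ suc a} (subst (ℤ._≤ -[1+ a ]) lowest lower))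

module _ {n K : ℕ} where
  private
    k : ℕ
    k = suc K

  near : ∀ (i j : Fin n) → i Fin.< j → Fin k → Fin k → ShiHyperplane n k
  near i j i<j m m′ = record
    { i = i ; j = j ; l = diff m m′ ; i<j = i<j
    ; lower = subst (ℤ._≤ diff m m′) (sym lowest)
        (ℤₚ.≤-trans (ℤₚ.neg-mono-≤ (ℤ.+≤+ (Finₚ.toℕ≤pred[n] m))) (ℤₚ.i≤j+i (ℤ.- (+ toℕ m)) (+ toℕ m′)))
    ; upper = ℤₚ.≤-trans (ℤₚ.i-j≤i (+ toℕ m′) (+ toℕ m)) (ℤ.+≤+ (ℕₚ.<⇒≤ (Finₚ.toℕ<n m′)))
    }

  far : ∀ (i j : Fin n) → i Fin.< j → ShiHyperplane n k
  far i j i<j = record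
    { i = i ; j = j ; l = + k ; i<j = i<j
    ; lower = subst (ℤ._≤ + k) (sym lowest) (ℤₚ.≤-trans (ℤₚ.neg-mono-≤ (ℤ.+≤+ (z≤n {K}))) (ℤ.+≤+ z≤n))
    ; upper = ℤₚ.≤-refl
    }

  module Approximation (x : Point n) (cx : x ∈ Complement n k) where

    -- The strict inequality of reals with its stage `N` exposed, so that one stage can serve all
    -- hyperplanes. Term `N` then already has the right sign.
    StableSign : ∀ (i j : Fin n) → ℤ → ℕ → Set
    StableSign i j l N =
      (∃[ ε ] (0ℚ ℚ.< ε × (∀ m → N ℕ.≤ m → seq (x i - x j) m ℚ.+ ε ℚ.≤ l ℚ./ 1))) ⊎
      (∃[ ε ] (0ℚ ℚ.< ε × (∀ m → N ℕ.≤ m → l ℚ./ 1 ℚ.+ ε ℚ.≤ seq (x i - x j) m)))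

    stable-mono : ∀ {i j l M N} → M ℕ.≤ N → StableSign i j l M → StableSign i j l N
    stable-mono M≤N (inj₁ (ε , 0<ε , p)) = inj₁ (ε , 0<ε , λ m N≤m → p m (ℕₚ.≤-trans M≤N N≤m))
    stable-mono M≤N (inj₂ (ε , 0<ε , p)) = inj₂ (ε , 0<ε , λ m N≤m → p m (ℕₚ.≤-trans M≤N N≤m))

    stable : ∀ H → let open ShiHyperplane H in ∃ (StableSign i j l)
    stable H with cx H
    ... | inj₁ (ε , N , 0<ε , p) = N , inj₁ (ε , 0<ε , p)
    ... | inj₂ (ε , N , 0<ε , p) = N , inj₂ (ε , 0<ε , p)

    -- Levels are indexed by pairs `m`, `m′` rather than by integers: the quantifiers range over
    -- finite types, where `uniformly` finds a common stage.
    StableBelow : Fin n → Fin n → ℕ → Set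
    StableBelow i j N = i Fin.< j → (∀ (m m′ : Fin k) → StableSign i j (diff m m′) N) × StableSign i j (+ k) N

    stable-pair : ∀ i j → ∃ (StableBelow i j)
    stable-pair i j with i Finₚ.<? j
    ... | no  i≮j = 0 , λ i<j → ⊥-elim (i≮j i<j)
    ... | yes i<j =
      let M , near-stable = uniformly (λ {m} M≤N p m′ → stable-mono {l = diff m m′} M≤N (p m′))
            (λ m → uniformly {P = λ m′ → StableSign i j (diff m m′)} (λ {m′} → stable-mono {l = diff m m′}) (λ m′ → stable (near i j i<j m m′)))
          N , far-stable  = stable (far i j i<j)
      in M ℕ.⊔ N , λ _ →
        (λ m m′ → stable-mono {l = diff m m′} (ℕₚ.m≤m⊔n M N) (near-stable m m′)) ,
        stable-mono {l = + k} (ℕₚ.m≤n⊔m M N) far-stable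

    stableBelow-mono : ∀ {i j M N} → M ℕ.≤ N → StableBelow i j M → StableBelow i j N
    stableBelow-mono M≤N p i<j =
      (λ m m′ → stable-mono {l = diff m m′} M≤N (proj₁ (p i<j) m m′)) , stable-mono {l = + k} M≤N (proj₂ (p i<j))

    all-stable : ∃[ N ] (∀ i j → StableBelow i j N)
    all-stable = uniformly {P = λ i N → ∀ j → StableBelow i j N}
      (λ M≤N p j → stableBelow-mono {j = j} M≤N (p j))
      (λ i → uniformly {P = StableBelow i} (λ {j} → stableBelow-mono {j = j}) (stable-pair i))

    approximation : Fin n → ℚ
    approximation i = seq (x i) (proj₁ all-stable)

    stable⇒agree : ∀ i j l N → StableSign i j l N →
      (x i - x j < fromℤ l → seq (x i - x j) N ℚ.< l ℚ./ 1) ×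
      (fromℤ l < x i - x j → l ℚ./ 1 ℚ.< seq (x i - x j) N)
    stable⇒agree i j l N (inj₁ (ε , 0<ε , p)) =
      (λ _ → ℚₚ.<-≤-trans (subst (ℚ._< d ℚ.+ ε) (ℚₚ.+-identityʳ d) (ℚₚ.+-monoʳ-< d 0<ε)) (p N ℕₚ.≤-refl)) ,
      (λ a → ⊥-elim (ℝ<-asym {x i - x j} {fromℤ l} (ε , N , 0<ε , p) a))
      where
      d : ℚ
      d = seq (x i - x j) N
    stable⇒agree i j l N (inj₂ (ε , 0<ε , p)) =
      (λ b → ⊥-elim (ℝ<-asym {x i - x j} {fromℤ l} b (ε , N , 0<ε , p))) ,
      (λ _ → ℚₚ.<-≤-trans (subst (ℚ._< d ℚ.+ ε) (ℚₚ.+-identityʳ d) (ℚₚ.+-monoʳ-< d 0<ε)) (p N ℕₚ.≤-refl))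
      where
      d : ℚ
      d = l ℚ./ 1

    approximation∈Agree : (fromℚ ∘ approximation) ∈ Agree {n} {k} x
    approximation∈Agree H =
      (λ b → fromℚ-mono-< {fromℚ (approximation i) - fromℚ (approximation j)} {fromℤ l} (λ _ → refl) (λ _ → refl) (proj₁ agree b)) ,
      (λ a → fromℚ-mono-< {fromℤ l} {fromℚ (approximation i) - fromℚ (approximation j)} (λ _ → refl) (λ _ → refl) (proj₂ agree a))
      where
      open ShiHyperplane H
      N : ℕ
      N = proj₁ all-stable
      sign : StableSign i j l N
      sign with near-or-far l lower upper
      ... | inj₁ (m , m′ , eq) = subst (λ l → StableSign i j l N) (sym eq) (proj₁ (proj₂ all-stable i j i<j) m m′)
      ... | inj₂ eq            = subst (λ l → StableSign i j l N) (sym eq) (proj₂ (proj₂ all-stable i j i<j))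
      agree = stable⇒agree i j l N sign

-- Sorting

to-injective : ∀ {a b} {A : Set a} {B : Set b} (f : A ↔ B) {x y} →
               Inverse.to f x ≡ Inverse.to f y → x ≡ y
to-injective f {x} {y} eq = trans (sym (Inverse.strictlyInverseʳ f x))
  (trans (cong (Inverse.from f) eq) (Inverse.strictlyInverseʳ f y))

from-injective : ∀ {a b} {A : Set a} {B : Set b} (f : A ↔ B) {x y} →
                 Inverse.from f x ≡ Inverse.from f y → x ≡ y
from-injective f {x} {y} eq = trans (sym (Inverse.strictlyInverseˡ f x))
  (trans (cong (Inverse.to f) eq) (Inverse.strictlyInverseˡ f y))

-- Omitting a missed value `p` would turn `f` into an injection into a set with one element fewer.
injective⇒surjective : ∀ {N} (f : Fin N → Fin N) → (∀ {i j} → f i ≡ f j → i ≡ j) → ∀ p → ∃[ i ] f i ≡ p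
injective⇒surjective {suc N} f inj p with Finₚ.any? (λ i → f i Finₚ.≟ p)
... | yes found = found
... | no  none  = ⊥-elim (ℕₚ.1+n≰n (Finₚ.injective⇒≤
  (λ {i} {j} eq → inj (Finₚ.punchOut-injective (missed i) (missed j) eq))))
  where
  missed : ∀ i → p ≢ f i
  missed i eq = none (i , sym eq)

-- The rank counts the elements below `i`. It is strictly monotone because down-sets grow strictly:
-- for i ≺ j, `i` belongs to the down-set of `j` but not to its own.
module Ranking {N} (_≺_ : Fin N → Fin N → Set) (_≺?_ : ∀ i j → Dec (i ≺ j))
  (≺-irrefl : ∀ {i} → ¬ (i ≺ i)) (≺-trans : ∀ {i j l} → i ≺ j → j ≺ l → i ≺ l)
  (≺-connex : ∀ {i j} → i ≢ j → i ≺ j ⊎ j ≺ i)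
  where

  private
    below : Fin N → Subset N
    below i = Vec.tabulate (λ j → does (j ≺? i))

    below⁺ : ∀ {i j} → j ≺ i → j Subset.∈ below i
    below⁺ {i} {j} j≺i = Vecₚ.lookup⇒[]= j (below i)
      (trans (Vecₚ.lookup∘tabulate (λ j → does (j ≺? i)) j) (dec-true (j ≺? i) j≺i))

    below⁻ : ∀ {i j} → j Subset.∈ below i → j ≺ i
    below⁻ {i} {j} j∈ with j ≺? i | trans (sym (Vecₚ.lookup∘tabulate (λ j → does (j ≺? i)) j)) (Vecₚ.[]=⇒lookup j∈)
    ... | yes j≺i | _  = j≺i
    ... | no  _   | ()

  rank<N : ∀ i → Subset.∣ below i ∣ ℕ.< N
  rank<N i = subst (Subset.∣ below i ∣ ℕ.<_) (Subsetₚ.∣⊤∣≡n N)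
    (Subsetₚ.p⊂q⇒∣p∣<∣q∣ ((λ _ → Subsetₚ.∈⊤) , i , Subsetₚ.∈⊤ , λ i∈ → ≺-irrefl (below⁻ i∈)))

  rank : Fin N → Fin N
  rank i = Fin.fromℕ< (rank<N i)

  rank-mono : ∀ {i j} → i ≺ j → rank i Fin.< rank j
  rank-mono {i} {j} i≺j = subst₂ ℕ._<_ (sym (Finₚ.toℕ-fromℕ< (rank<N i))) (sym (Finₚ.toℕ-fromℕ< (rank<N j)))
    (Subsetₚ.p⊂q⇒∣p∣<∣q∣ ((λ l∈ → below⁺ (≺-trans (below⁻ l∈) i≺j)) ,
      i , below⁺ i≺j , λ i∈ → ≺-irrefl (below⁻ i∈)))

  rank-injective : ∀ {i j} → rank i ≡ rank j → i ≡ j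
  rank-injective {i} {j} eq with i Finₚ.≟ j
  ... | yes i≡j = i≡j
  ... | no  i≢j = ⊥-elim ([ (λ i≺j → Finₚ.<-irrefl eq (rank-mono i≺j))
                          , (λ j≺i → Finₚ.<-irrefl (sym eq) (rank-mono j≺i)) ]′ (≺-connex i≢j))

  sorting : Permutation′ N
  sorting = permutation unrank rank
    (λ i → rank-injective (rank∘unrank (rank i))) rank∘unrank
    where
    unrank : Fin N → Fin N
    unrank p = proj₁ (injective⇒surjective rank rank-injective p)
    rank∘unrank : ∀ p → rank (unrank p) ≡ p
    rank∘unrank p = proj₂ (injective⇒surjective rank rank-injective p)

  sorting-mono : ∀ {p q} → p Fin.< q → (sorting ⟨$⟩ʳ p) ≺ (sorting ⟨$⟩ʳ q)
  sorting-mono {p} {q} p<q =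
    [ id , (λ r → ⊥-elim (ℕₚ.<-asym p<q (subst₂ Fin._<_ (unrank q) (unrank p) (rank-mono r)))) ]′
      (≺-connex λ eq → Finₚ.<-irrefl (trans (sym (unrank p)) (trans (cong rank eq) (unrank q))) p<q)
    where
    unrank : ∀ p → rank (sorting ⟨$⟩ʳ p) ≡ p
    unrank p = proj₂ (injective⇒surjective rank rank-injective p)

module _ {n k : ℕ} where

  _≟ᴱ_ : (e f : Expr n k) → Dec (e ≡ f)
  (i , m) ≟ᴱ (j , m′) = map′ (λ { (refl , refl) → refl }) (λ { refl → refl , refl })
    (i Finₚ.≟ j ×-dec m Finₚ.≟ m′)

  any? : {P : Expr n k → Set} → (∀ e → Dec (P e)) → Dec (∃ P)
  any? P? = map′ (λ { (i , m , p) → (i , m) , p }) (λ { ((i , m) , p) → i , m , p })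
    (Finₚ.any? λ i → Finₚ.any? λ m → P? (i , m))

  all? : {P : Expr n k → Set} → (∀ e → Dec (P e)) → Dec (∀ e → P e)
  all? P? = map′ (λ p e → p (proj₁ e) (proj₂ e)) (λ p i m → p (i , m))
    (Finₚ.all? λ i → Finₚ.all? λ m → P? (i , m))

  indexing : Fin (k ℕ.* n) ↔ Expr n k
  indexing = mk↔ₛ′ (λ p → let m , i = Fin.remQuot {k} n p in i , m) (λ { (i , m) → Fin.combine m i })
    (λ { (i , m) → cong (λ { (m , i) → i , m }) (Finₚ.remQuot-combine m i) })
    (λ p → Finₚ.combine-remQuot {k} n p)

  module Ordering (v : Expr n k → ℚ) (v-injective : ∀ {e f} → v e ≡ v f → e ≡ f) where
    private
      expr : Fin (k ℕ.* n) → Expr n k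
      expr = Inverse.to indexing

      connex : ∀ {p q} → p ≢ q → v (expr q) ℚ.< v (expr p) ⊎ v (expr p) ℚ.< v (expr q)
      connex {p} {q} p≢q with ℚₚ.<-cmp (v (expr q)) (v (expr p))
      ... | tri< lt _ _ = inj₁ lt
      ... | tri> _ _ gt = inj₂ gt
      ... | tri≈ _ eq _ = ⊥-elim (p≢q (sym (to-injective indexing (v-injective eq))))

      open Ranking (λ p q → v (expr q) ℚ.< v (expr p)) (λ p q → v (expr q) ℚₚ.<? v (expr p))
        (ℚₚ.<-irrefl refl) (λ x y → ℚₚ.<-trans y x) connex

    opaque
      ordering : Fin (k ℕ.* n) ↔ Expr n k
      ordering = indexing ↔-∘ sorting

      ordering-decreasing : ∀ {p q} → p Fin.< q → v (Inverse.to ordering q) ℚ.< v (Inverse.to ordering p)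
      ordering-decreasing = sorting-mono

-- Blocks of labels

-- i and j are neighbours in their block { c | a c ≡ a i }.
Link : ∀ {n} → (Fin n → ℕ) → Fin n → Fin n → Set
Link a i j = i Fin.< j × a i ≡ a j × (∀ c → i Fin.< c → c Fin.< j → a c ≢ a i)

link? : ∀ {n} (a : Fin n → ℕ) i j → Dec (Link a i j)
link? a i j = i Finₚ.<? j ×-dec a i ℕ.≟ a j ×-dec
  Finₚ.all? λ c → i Finₚ.<? c →-dec c Finₚ.<? j →-dec ¬? (a c ℕ.≟ a i)

First : ∀ {n} → (Fin n → ℕ) → Fin n → Set
First a j = ∀ c → c Fin.< j → a c ≢ a j

first-or-link : ∀ {n} (a : Fin n → ℕ) j → First a j ⊎ ∃[ i ] Link a i j
first-or-link a j = scan (toℕ j) ℕₚ.≤-refl λ c j≤c c<j → ⊥-elim (ℕₚ.<⇒≱ c<j j≤c)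
  where
  -- A search downwards from `j` with the invariant that no label in [t, j) shares the value of `j`;
  -- the first hit is therefore the neighbour.
  scan : ∀ t → t ℕ.≤ toℕ j → (∀ c → t ℕ.≤ toℕ c → c Fin.< j → a c ≢ a j) → First a j ⊎ ∃[ i ] Link a i j
  scan zero    _   none = inj₁ λ c → none c z≤n
  scan (suc t) t<j none = case a i ℕ.≟ a j of λ
    { (yes same) → inj₂ (i , subst (ℕ._< toℕ j) (sym i≡t) t<j , same , λ c i<c c<j c≡i →
        none c (subst (λ s → suc s ℕ.≤ toℕ c) i≡t i<c) c<j (trans c≡i same))
    ; (no other) → scan t (ℕₚ.<⇒≤ t<j) λ c t≤c c<j c≡j → case ℕₚ.m≤n⇒m<n∨m≡n t≤c of λ
        { (inj₁ t<c) → none c t<c c<j c≡j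
        ; (inj₂ t≡c) → other (trans (cong a (Finₚ.toℕ-injective (trans i≡t t≡c))) c≡j) } }
    where
    t<n : t ℕ.< _
    t<n = ℕₚ.<-trans t<j (Finₚ.toℕ<n j)
    i : Fin _
    i = Fin.fromℕ< t<n
    i≡t : toℕ i ≡ t
    i≡t = Finₚ.toℕ-fromℕ< t<n

link-pred-unique : ∀ {n} {a : Fin n → ℕ} {i i′ j} → Link a i j → Link a i′ j → i ≡ i′
link-pred-unique {i = i} {i′} (i<j , same , between) (i′<j , same′ , between′) with Finₚ.<-cmp i i′
... | tri≈ _ eq _ = eq
... | tri< lt _ _ = ⊥-elim (between i′ lt i′<j (trans same′ (sym same)))
... | tri> _ _ gt = ⊥-elim (between′ i gt i<j (trans same (sym same′)))

link-succ-unique : ∀ {n} {a : Fin n → ℕ} {i j j′} → Link a i j → Link a i j′ → j ≡ j′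
link-succ-unique {j = j} {j′} (i<j , same , between) (i<j′ , same′ , between′) with Finₚ.<-cmp j j′
... | tri≈ _ eq _ = eq
... | tri< lt _ _ = ⊥-elim (between′ j i<j lt (sym same))
... | tri> _ _ gt = ⊥-elim (between j′ i<j′ gt (sym same′))

first? : ∀ {n} (a : Fin n → ℕ) j → Dec (First a j)
first? a j = Finₚ.all? λ c → c Finₚ.<? j →-dec ¬? (a c ℕ.≟ a j)

first-unique : ∀ {n} {a : Fin n → ℕ} {i j} → First a i → First a j → a i ≡ a j → i ≡ j
first-unique {i = i} {j} first first′ same with Finₚ.<-cmp i j
... | tri≈ _ eq _ = eq
... | tri< lt _ _ = ⊥-elim (first′ i lt same)
... | tri> _ _ gt = ⊥-elim (first j gt (sym same))

-- A relation on labels whose classes are increasing paths, as are the jumps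
-- in the chains of a diagram.
module Paths {n} (_⇝_ : Fin n → Fin n → Set) (_⇝?_ : ∀ i j → Dec (i ⇝ j))
  (⇝⇒< : ∀ {i j} → i ⇝ j → i Fin.< j)
  (succ-unique : ∀ {i j j′} → i ⇝ j → i ⇝ j′ → j ≡ j′)
  (pred-unique : ∀ {i i′ j} → i ⇝ j → i′ ⇝ j → i ≡ i′)
  (start : Fin n → ℕ) (start-injective : ∀ {i j} → start i ≡ start j → i ≡ j)
  where

  -- A property of `a` rather than an equation with `labelling`, so that a given parking function
  -- can be tested against a diagram.
  IsLabelling : (Fin n → ℕ) → Set
  IsLabelling a = (∀ i j → i ⇝ j → a i ≡ a j) × (∀ j → (∀ i → ¬ (i ⇝ j)) → a j ≡ start j)

  IsRoot : Fin n → Fin n → Set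
  IsRoot r j = Star _⇝_ r j × (∀ i → ¬ (i ⇝ r))

  root-of : ∀ j → ∃[ r ] IsRoot r j
  root-of j = go j (<-wellFounded j)
    where
    go : ∀ j → Acc Fin._<_ j → ∃[ r ] IsRoot r j
    go j (acc rec) with Finₚ.any? (_⇝? j)
    ... | no  none      = j , nil , λ i i⇝j → none (i , i⇝j)
    ... | yes (i , i⇝j) = let r , path , initial = go i (rec (⇝⇒< i⇝j)) in
      r , path ◅◅ (i⇝j ◅ nil) , initial

  comparable : ∀ {r i j} → Star _⇝_ r i → Star _⇝_ r j → Star _⇝_ i j ⊎ Star _⇝_ j i
  comparable nil q = inj₁ q
  comparable p nil = inj₂ p
  comparable (x ◅ p) (y ◅ q) with refl ← succ-unique x y = comparable p q

  path⇒≤ : ∀ {i j} → Star _⇝_ i j → i Fin.≤ j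
  path⇒≤ nil       = ℕₚ.≤-refl
  path⇒≤ (x ◅ p) = ℕₚ.≤-trans (ℕₚ.<⇒≤ (⇝⇒< x)) (path⇒≤ p)

  root-unique : ∀ {r r′ j} → IsRoot r j → IsRoot r′ j → r ≡ r′
  root-unique {r} {r′} {j} (p , initial) (p′ , initial′) = go j (<-wellFounded j) p p′
    where
    unsnoc : ∀ {i j} → Star _⇝_ i j → i ≡ j ⊎ ∃[ c ] (Star _⇝_ i c × c ⇝ j)
    unsnoc nil = inj₁ refl
    unsnoc (x ◅ p) with unsnoc p
    ... | inj₁ refl        = inj₂ (_ , nil , x)
    ... | inj₂ (c , q , y) = inj₂ (c , x ◅ q , y)
    go : ∀ j → Acc Fin._<_ j → Star _⇝_ r j → Star _⇝_ r′ j → r ≡ r′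
    go j (acc rec) p p′ with unsnoc p | unsnoc p′
    ... | inj₁ refl | inj₁ refl = refl
    ... | inj₁ refl | inj₂ (c , _ , y) = ⊥-elim (initial c y)
    ... | inj₂ (c , _ , y) | inj₁ refl = ⊥-elim (initial′ c y)
    ... | inj₂ (c , q , y) | inj₂ (c′ , q′ , y′) with refl ← pred-unique y y′ = go c (rec (⇝⇒< y)) q q′

  opaque
    labelling : Fin n → ℕ
    labelling j = start (proj₁ (root-of j))

    labelling-start : ∀ j → ∃[ r ] labelling j ≡ start r
    labelling-start j = proj₁ (root-of j) , refl

    labelling-isLabelling : IsLabelling labelling
    labelling-isLabelling =
      (λ i j i⇝j → let r , p , initial = root-of i in
        cong start (root-unique (p ◅◅ (i⇝j ◅ nil) , initial) (proj₂ (root-of j)))) ,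
      (λ j none → cong start (root-unique (proj₂ (root-of j)) (nil , none)))

  module Labelled {a : Fin n → ℕ} (labels : IsLabelling a) where
    private
      a-⇝ = proj₁ labels
      a-start = proj₂ labels

    a-path : ∀ {i j} → Star _⇝_ i j → a i ≡ a j
    a-path nil       = refl
    a-path (x ◅ p) = trans (a-⇝ _ _ x) (a-path p)

    -- Labels are constant along paths and injective on roots. Equal labels therefore mean a common
    -- root, and paths from one vertex cannot branch.
    same⇒comparable : ∀ {i j} → a i ≡ a j → Star _⇝_ i j ⊎ Star _⇝_ j i
    same⇒comparable {i} {j} same =
      let r , p , initial = root-of i ; r′ , p′ , initial′ = root-of j
      in comparable p (subst (λ r → Star _⇝_ r j)
           (sym (start-injective (same-start p initial p′ initial′))) p′)
      where
      open ≡-Reasoning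
      same-start : ∀ {r r′} → Star _⇝_ r i → (∀ i → ¬ (i ⇝ r)) →
                   Star _⇝_ r′ j → (∀ i → ¬ (i ⇝ r′)) → start r ≡ start r′
      same-start {r} {r′} p initial p′ initial′ = begin
        start r    ≡⟨ a-start r initial ⟨
        a r        ≡⟨ a-path p ⟩
        a i        ≡⟨ same ⟩
        a j        ≡⟨ a-path p′ ⟨
        a r′       ≡⟨ a-start r′ initial′ ⟩
        start r′   ∎

    -- A first step i ⇝ c with `c` before `j` would put `c` into the block between two neighbours.
    -- With `⇝⇒link`, the relation can be read off from the labels alone.
    link⇒⇝ : ∀ {i j} → Link a i j → i ⇝ j
    link⇒⇝ {i} {j} (i<j , same , between) with same⇒comparable same
    ... | inj₂ p = ⊥-elim (ℕₚ.<⇒≱ i<j (path⇒≤ p))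
    ... | inj₁ nil = ⊥-elim (ℕₚ.<-irrefl refl i<j)
    ... | inj₁ (_◅_ {j = c} x p) with ℕₚ.m≤n⇒m<n∨m≡n (path⇒≤ p)
    ...   | inj₁ c<j = ⊥-elim (between c (⇝⇒< x) c<j (sym (a-⇝ i c x)))
    ...   | inj₂ c≡j = subst (i ⇝_) (Finₚ.toℕ-injective c≡j) x

    ⇝⇒link : ∀ {i j} → i ⇝ j → Link a i j
    ⇝⇒link {i} {j} x = ⇝⇒< x , a-⇝ i j x , λ c i<c c<j same → case same⇒comparable same of λ
      { (inj₁ p)       → ℕₚ.<⇒≱ i<c (path⇒≤ p)
      ; (inj₂ nil)       → ℕₚ.<-irrefl refl i<c
      ; (inj₂ (y ◅ p)) → ℕₚ.<⇒≱ c<j (path⇒≤ (subst (λ d → Star _⇝_ d c) (succ-unique y x) p)) }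

-- Nonnesting diagrams

top : ∀ {K} → Fin (suc K)
top {K} = Fin.fromℕ K

module _ {n K : ℕ} where
  private
    k : ℕ
    k = suc K

  Shift : Expr n k → Expr n k → Set
  Shift e f = proj₁ e ≡ proj₁ f × toℕ (proj₂ e) ≡ suc (toℕ (proj₂ f))

  Jump : (Fin n → Fin n → Set) → Expr n k → Expr n k → Set
  Jump L e f = proj₂ e ≡ zero × proj₂ f ≡ top × L (proj₁ e) (proj₁ f)

  Edge : (Fin n → Fin n → Set) → Expr n k → Expr n k → Set
  Edge L e f = Shift e f ⊎ Jump L e f

  shift? : ∀ e f → Dec (Shift e f)
  shift? e f = proj₁ e Finₚ.≟ proj₁ f ×-dec toℕ (proj₂ e) ℕ.≟ suc (toℕ (proj₂ f))

  edge? : ∀ {L} → (∀ i j → Dec (L i j)) → ∀ e f → Dec (Edge L e f)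
  edge? L? e f = shift? e f ⊎-dec
    (proj₂ e Finₚ.≟ zero ×-dec proj₂ f Finₚ.≟ top ×-dec L? (proj₁ e) (proj₁ f))

  edge-map : ∀ {L L′ : Fin n → Fin n → Set} → (∀ {i j} → L i j → L′ i j) → ∀ {e f} → Edge L e f → Edge L′ e f
  edge-map L⇒L′ (inj₁ s)            = inj₁ s
  edge-map L⇒L′ (inj₂ (m , m′ , l)) = inj₂ (m , m′ , L⇒L′ l)

  ¬-shift-into-top : ∀ {e i} → ¬ Shift e (i , top)
  ¬-shift-into-top {_ , m} (_ , eq) = ℕₚ.<⇒≢ (Finₚ.toℕ<n m) (trans eq (cong suc (Finₚ.toℕ-fromℕ K)))

  shift-source : ∀ i m → (∃[ m′ ] Shift (i , m′) (i , m)) ⊎ m ≡ top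
  shift-source i m with ℕₚ.m≤n⇒m<n∨m≡n (Finₚ.toℕ≤pred[n] m)
  ... | inj₁ m<K = inj₁ (Fin.fromℕ< (s≤s m<K) , refl , Finₚ.toℕ-fromℕ< (s≤s m<K))
  ... | inj₂ m≡K = inj₂ (Finₚ.toℕ-injective (trans m≡K (sym (Finₚ.toℕ-fromℕ K))))

  -- Runs from m = K down to 0, the direction of the shifts: x_i + m lies to the left of x_i + m -
  -- 1.
  copies-induction : ∀ {i} (Q : Fin k → Set) → (∀ {m m′} → toℕ m ≡ suc (toℕ m′) → Q m → Q m′) → Q top → ∀ m → Q m
  copies-induction {i} Q step Q-top m = go (K ℕ.∸ toℕ m) m refl
    where
    go : ∀ c m → K ℕ.∸ toℕ m ≡ c → Q m
    go c m eq with shift-source i m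
    go c       m eq | inj₂ refl         = Q-top
    go zero    m eq | inj₁ (m′ , _ , s) = ⊥-elim (ℕₚ.<⇒≱ (subst (ℕ._≤ K) s (Finₚ.toℕ≤pred[n] m′)) (ℕₚ.m∸n≡0⇒m≤n eq))
    go (suc c) m eq | inj₁ (m′ , _ , s) = step s (go c m′ (trans (cong (K ℕ.∸_) s)
      (trans (sym (ℕₚ.pred[m∸n]≡m∸[1+n] K (toℕ m))) (cong ℕ.pred eq))))

  -- Jumps end at a top copy and shifts never do, so two edges with one target are of the same kind.
  edge-source-unique : ∀ {L : Fin n → Fin n → Set} → (∀ {i i′ j} → L i j → L i′ j → i ≡ i′) →
                       ∀ {e e′ f} → Edge L e f → Edge L e′ f → e ≡ e′
  edge-source-unique _ (inj₁ (refl , p)) (inj₁ (refl , p′)) =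
    cong (_ ,_) (Finₚ.toℕ-injective (trans p (sym p′)))
  edge-source-unique _ (inj₁ s) (inj₂ (_ , refl , _)) = ⊥-elim (¬-shift-into-top s)
  edge-source-unique _ (inj₂ (_ , refl , _)) (inj₁ s) = ⊥-elim (¬-shift-into-top s)
  edge-source-unique L-unique (inj₂ (refl , refl , l)) (inj₂ (refl , _ , l′)) = cong (_, zero) (L-unique l l′)

  first-or-edge : ∀ (a : Fin n → ℕ) (f : Expr n k) → (First a (proj₁ f) × f ≡ (proj₁ f , top)) ⊎ ∃[ e ] Edge (Link a) e f
  first-or-edge a (j , m) with shift-source j m
  ... | inj₁ (m′ , s) = inj₂ ((j , m′) , inj₁ s)
  ... | inj₂ refl with first-or-link a j
  ...   | inj₁ first    = inj₁ (first , refl)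
  ...   | inj₂ (i , ij) = inj₂ ((i , zero) , inj₂ (refl , refl , ij))

  pos : Fin (k ℕ.* n) ↔ Expr n k → Expr n k → ℕ
  pos y e = toℕ (Inverse.from y e)

  pos-injective : ∀ y {e f} → pos y e ≡ pos y f → e ≡ f
  pos-injective y eq = from-injective y (Finₚ.toℕ-injective eq)

  pos-surjective : ∀ y p → p ℕ.< k ℕ.* n → ∃[ e ] pos y e ≡ p
  pos-surjective y p p<N = Inverse.to y (Fin.fromℕ< p<N) ,
    trans (cong toℕ (Inverse.strictlyInverseʳ y (Fin.fromℕ< p<N))) (Finₚ.toℕ-fromℕ< p<N)

  pos<N : ∀ y e → pos y e ℕ.< k ℕ.* n
  pos<N y e = Finₚ.toℕ<n (Inverse.from y e)

  -- Because the inequalities are weak, applying them in both directions makes edges with a common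
  -- source or a common target coincide.
  record Nonnesting (L : Fin n → Fin n → Set) (y : Fin (k ℕ.* n) ↔ Expr n k) : Set where
    field
      rightward : ∀ {e f} → Edge L e f → pos y e ℕ.< pos y f
      targets-≤ : ∀ {e f e′ f′} → Edge L e f → Edge L e′ f′ → pos y e ℕ.≤ pos y e′ → pos y f ℕ.≤ pos y f′
      sources-≤ : ∀ {e f e′ f′} → Edge L e f → Edge L e′ f′ → pos y f ℕ.≤ pos y f′ → pos y e ℕ.≤ pos y e′

  -- The edges of a nonnesting diagram end in the order in which they start, so
  -- that, read from left to right, their order determines the diagram.
  module Uniqueness {L : Fin n → Fin n → Set} {y y′ : Fin (k ℕ.* n) ↔ Expr n k}
    (N : Nonnesting L y) (N′ : Nonnesting L y′)
    (initial : ∀ f → (∃[ e ] Edge L e f) ⊎ pos y f ≡ pos y′ f)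
    where
    private
      module N = Nonnesting N
      module N′ = Nonnesting N′

      AgreeBefore : ℕ → Set
      AgreeBefore p = ∀ e → pos y e ℕ.< p → pos y′ e ≡ pos y e

      before′ : ∀ {p} → AgreeBefore p → ∀ e → pos y′ e ℕ.< p → pos y e ≡ pos y′ e
      before′ {p} agree e e<p =
        let h , h≡ = pos-surjective y (pos y′ e) (pos<N y′ e)
            h≡e    = pos-injective y′ (trans (agree h (subst (ℕ._< p) (sym h≡) e<p)) h≡)
        in trans (cong (pos y) (sym h≡e)) h≡

      step : ∀ p → AgreeBefore p → ∀ f → pos y f ≡ p → pos y′ f ≡ p
      step p agree f f≡p with initial f | ℕₚ.<-cmp (pos y′ f) p
      ... | inj₂ same      | _           = trans (sym same) f≡p
      ... | inj₁ _         | tri≈ _ eq _ = eq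
      ... | inj₁ _         | tri< lt _ _ = ⊥-elim (ℕₚ.<⇒≢ lt (trans (sym (before′ agree f lt)) f≡p))
      ... | inj₁ (e , e→f) | tri> _ _ gt =
        let g , g≡p = pos-surjective y′ p (subst (ℕ._< k ℕ.* n) f≡p (pos<N y f)) in competitor g g≡p
        where
        e<p : pos y e ℕ.< p
        e<p = subst (pos y e ℕ.<_) f≡p (N.rightward e→f)
        -- In the last case `f` has position `p` in `y` but a later one in `y′`, and `g` the other
        -- way round. Their sources lie before `p`, where the orderings agree; whichever source
        -- comes first, one of the orderings ends the two edges in the wrong order.
        competitor : ∀ g → pos y′ g ≡ p → pos y′ f ≡ p
        competitor g g≡p with ℕₚ.<-cmp (pos y g) p | initial g
        ... | tri< lt _ _ | _         = ⊥-elim (ℕₚ.<⇒≢ lt (trans (sym (agree g lt)) g≡p))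
        ... | tri≈ _ eq _ | _         = subst (λ g → pos y′ g ≡ p) (pos-injective y (trans eq (sym f≡p))) g≡p
        ... | tri> _ _ g>p | inj₂ same = ⊥-elim (ℕₚ.<⇒≢ g>p (sym (trans same g≡p)))
        ... | tri> _ _ g>p | inj₁ (d , d→g) = ⊥-elim (case ℕₚ.≤-total (pos y d) (pos y e) of λ
          { (inj₁ d≤e) → ℕₚ.<⇒≱ g>p (subst (pos y g ℕ.≤_) f≡p (N.targets-≤ d→g e→f d≤e))
          ; (inj₂ e≤d) → ℕₚ.<⇒≱ gt (subst (pos y′ f ℕ.≤_) g≡p
              (N′.targets-≤ e→f d→g (subst₂ ℕ._≤_ (sym (agree e e<p)) d≡ e≤d))) })
          where
          d≡ : pos y d ≡ pos y′ d
          d≡ = before′ agree d (subst (pos y′ d ℕ.<_) g≡p (N′.rightward d→g))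

      agreeBefore : ∀ p → AgreeBefore p
      agreeBefore (suc p) e (s≤s e≤p) with ℕₚ.m≤n⇒m<n∨m≡n e≤p
      ... | inj₁ e<p = agreeBefore p e e<p
      ... | inj₂ e≡p = trans (step p (agreeBefore p) e e≡p) (sym e≡p)

    same-position : ∀ e → pos y e ≡ pos y′ e
    same-position e = sym (agreeBefore (suc (pos y e)) e ℕₚ.≤-refl)

  -- The arcs remaining in a diagram with arcs Edge L.
  Minimal : (Fin n → Fin n → Set) → Fin (k ℕ.* n) ↔ Expr n k → Expr n k → Expr n k → Set
  Minimal L y e f = Edge L e f ×
    (∀ e′ f′ → Edge L e′ f′ → pos y e ℕ.≤ pos y e′ → pos y f′ ℕ.≤ pos y f → e′ ≡ e × f′ ≡ f)

  minimal? : ∀ {L} → (∀ i j → Dec (L i j)) → ∀ y e f → Dec (Minimal L y e f)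
  minimal? L? y e f = edge? L? e f ×-dec (all? λ e′ → all? λ f′ →
    edge? L? e′ f′ →-dec pos y e ℕ.≤? pos y e′ →-dec pos y f′ ℕ.≤? pos y f →-dec e′ ≟ᴱ e ×-dec f′ ≟ᴱ f)

  Inside : Fin (k ℕ.* n) ↔ Expr n k → (e f e′ f′ : Expr n k) → Set
  Inside y e f e′ f′ = pos y e ℕ.≤ pos y e′ × pos y f′ ℕ.≤ pos y f

  module _ {L : Fin n → Fin n → Set} (L? : ∀ i j → Dec (L i j)) (y : Fin (k ℕ.* n) ↔ Expr n k)
           (rightward : ∀ {e f} → Edge L e f → pos y e ℕ.< pos y f) where

    -- Descent on the length: an edge that is not minimal contains a different edge, which is
    -- shorter since positions determine expressions.
    contains-minimal : ∀ e f → Edge L e f → ∃₂ λ e′ f′ → Minimal L y e′ f′ × Inside y e f e′ f′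
    contains-minimal e f = go (pos y f) e f (ℕₚ.m∸n≤m (pos y f) (pos y e))
      where
      go : ∀ c e f → pos y f ℕ.∸ pos y e ℕ.≤ c → Edge L e f → ∃₂ λ e′ f′ → Minimal L y e′ f′ × Inside y e f e′ f′
      go zero    e f w e→f = ⊥-elim (ℕₚ.m>n⇒m∸n≢0 (rightward e→f) (ℕₚ.n≤0⇒n≡0 w))
      go (suc c) e f w e→f with any? (λ e′ → any? λ f′ → edge? L? e′ f′ ×-dec pos y e ℕ.≤? pos y e′ ×-dec
                                  pos y f′ ℕ.≤? pos y f ×-dec ¬? (e′ ≟ᴱ e ×-dec f′ ≟ᴱ f))
      ... | no none = e , f , (e→f , λ e′ f′ e′→f′ p q → decidable-stable (e′ ≟ᴱ e ×-dec f′ ≟ᴱ f)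
              (λ differ → none (e′ , f′ , e′→f′ , p , q , differ))) , ℕₚ.≤-refl , ℕₚ.≤-refl
      ... | yes (e′ , f′ , e′→f′ , e≤e′ , f′≤f , differ) =
        let e″ , f″ , min , p , q = go c e′ f′ (ℕₚ.≤-pred (ℕₚ.≤-trans shorter w)) e′→f′
        in e″ , f″ , min , ℕₚ.≤-trans e≤e′ p , ℕₚ.≤-trans q f′≤f
        where
        shorter : pos y f′ ℕ.∸ pos y e′ ℕ.< pos y f ℕ.∸ pos y e
        shorter with ℕₚ.m≤n⇒m<n∨m≡n e≤e′ | ℕₚ.m≤n⇒m<n∨m≡n f′≤f
        ... | inj₁ e<e′ | _         = ℕₚ.<-≤-trans (ℕₚ.∸-monoʳ-< e<e′ (ℕₚ.<⇒≤ (rightward e′→f′))) (ℕₚ.∸-monoˡ-≤ (pos y e) f′≤f)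
        ... | inj₂ e≡e′ | inj₁ f′<f = subst (λ t → pos y f′ ℕ.∸ t ℕ.< pos y f ℕ.∸ pos y e) e≡e′
                (ℕₚ.∸-monoˡ-< f′<f (subst (ℕ._≤ pos y f′) (sym e≡e′) (ℕₚ.<⇒≤ (rightward e′→f′))))
        ... | inj₂ e≡e′ | inj₂ f′≡f = ⊥-elim (differ (pos-injective y (sym e≡e′) , pos-injective y f′≡f))

    minimal-targets-≤ : ∀ {e f e′ f′} → Minimal L y e f → Minimal L y e′ f′ → pos y e ℕ.≤ pos y e′ → pos y f ℕ.≤ pos y f′
    minimal-targets-≤ {e} {f} {e′} {f′} (_ , min) (e′→f′ , _) e≤e′ = ℕₚ.≮⇒≥ λ f′<f →
      ℕₚ.<⇒≢ f′<f (cong (pos y) (proj₂ (min e′ f′ e′→f′ e≤e′ (ℕₚ.<⇒≤ f′<f))))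

    minimal-sources-≤ : ∀ {e f e′ f′} → Minimal L y e f → Minimal L y e′ f′ → pos y f ℕ.≤ pos y f′ → pos y e ℕ.≤ pos y e′
    minimal-sources-≤ {e} {f} {e′} {f′} (e→f , _) (_ , min′) f≤f′ = ℕₚ.≮⇒≥ λ e′<e →
      ℕₚ.<⇒≢ e′<e (cong (pos y) (sym (proj₁ (min′ e f e→f (ℕₚ.<⇒≤ e′<e) f≤f′))))

-- Heights at a rational point

height : ∀ {n k} → (Fin n → ℚ) → Expr n k → ℚ
height q (i , m) = q i ℚ.+ ι (toℕ m)

height-shift : ∀ {n K} (q : Fin n → ℚ) {e f : Expr n (suc K)} → Shift e f → height q e ≡ height q f ℚ.+ 1ℚ
height-shift q {i , m} {_ , m′} (refl , eq) = trans (cong (λ s → q i ℚ.+ ι s) eq)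
  (trans (cong (q i ℚ.+_) (/1-suc (toℕ m′))) (sym (ℚₚ.+-assoc (q i) (ι (toℕ m′)) 1ℚ)))

module _ {n K : ℕ} where
  private
    k : ℕ
    k = suc K

  height-near : ∀ (p : Fin n → ℚ) i j (m m′ : Fin k) →
    height p (j , m′) ℚ.- height p (i , m) ≡ diff m m′ ℚ./ 1 ℚ.- (p i ℚ.- p j)
  height-near p i j m m′ = trans
    (solve 4 (λ a b s t → (b :+ t) :- (a :+ s) := (t :- s) :- (a :- b)) refl (p i) (p j) (ι (toℕ m)) (ι (toℕ m′)))
    (cong (ℚ._- (p i ℚ.- p j)) (sym (diff/1 m m′)))
    where open +-*-Solver

  height-near′ : ∀ (p : Fin n → ℚ) i j (m m′ : Fin k) →
    height p (i , m) ℚ.- height p (j , m′) ≡ (p i ℚ.- p j) ℚ.- diff m m′ ℚ./ 1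
  height-near′ p i j m m′ = trans
    (solve 4 (λ a b s t → (a :+ s) :- (b :+ t) := (a :- b) :- (t :- s)) refl (p i) (p j) (ι (toℕ m)) (ι (toℕ m′)))
    (cong (ℚ._-_ (p i ℚ.- p j)) (sym (diff/1 m m′)))
    where open +-*-Solver

  ι-top : ι (toℕ (top {K})) ℚ.+ 1ℚ ≡ ι k
  ι-top = trans (cong (λ s → ι s ℚ.+ 1ℚ) (Finₚ.toℕ-fromℕ K)) (sym (/1-suc K))

  height-far : ∀ (p : Fin n → ℚ) i j →
    (height p (j , top {K}) ℚ.+ 1ℚ) ℚ.- height {k = k} p (i , zero) ≡ ι k ℚ.- (p i ℚ.- p j)
  height-far p i j = trans
    (solve 3 (λ a b t → ((b :+ t) :+ con 1ℚ) :- (a :+ con 0ℚ) := (t :+ con 1ℚ) :- (a :- b))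
      refl (p i) (p j) (ι (toℕ (top {K}))))
    (cong (ℚ._- (p i ℚ.- p j)) ι-top)
    where open +-*-Solver

  height-far′ : ∀ (p : Fin n → ℚ) i j →
    height {k = k} p (i , zero) ℚ.- (height p (j , top {K}) ℚ.+ 1ℚ) ≡ (p i ℚ.- p j) ℚ.- ι k
  height-far′ p i j = trans
    (solve 3 (λ a b t → (a :+ con 0ℚ) :- ((b :+ t) :+ con 1ℚ) := (a :- b) :- (t :+ con 1ℚ))
      refl (p i) (p j) (ι (toℕ (top {K}))))
    (cong (ℚ._-_ (p i ℚ.- p j)) ι-top)
    where open +-*-Solver

  sample : Point n → ℕ → Fin n → ℚ
  sample z t i = seq (z i) t

  module _ (z : Point n) {i j : Fin n} (i<j : i Fin.< j) where

    near-below : ∀ m m′ → Below (near i j i<j m m′) z ⇔ (value {k = k} z (i , m) < value {k = k} z (j , m′))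
    near-below m m′ = mk⇔
      (λ b → ℝ<-shift {z i - z j} {fromℤ (diff m m′)} {value {k = k} z (i , m)} {value {k = k} z (j , m′)} b λ t →
        height-near (sample z t) i j m m′)
      (λ b → ℝ<-shift {value {k = k} z (i , m)} {value {k = k} z (j , m′)} {z i - z j} {fromℤ (diff m m′)} b λ t →
        sym (height-near (sample z t) i j m m′))

    near-above : ∀ m m′ → Above (near i j i<j m m′) z ⇔ (value {k = k} z (j , m′) < value {k = k} z (i , m))
    near-above m m′ = mk⇔
      (λ b → ℝ<-shift {fromℤ (diff m m′)} {z i - z j} {value {k = k} z (j , m′)} {value {k = k} z (i , m)} b λ t →
        height-near′ (sample z t) i j m m′)
      (λ b → ℝ<-shift {value {k = k} z (j , m′)} {value {k = k} z (i , m)} {fromℤ (diff m m′)} {z i - z j} b λ t →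
        sym (height-near′ (sample z t) i j m m′))

  module _ (q : Fin n → ℚ) where

    value-height : ∀ e f → (value {k = k} (fromℚ ∘ q) e < value {k = k} (fromℚ ∘ q) f) ⇔ (height q e ℚ.< height q f)
    value-height e f = mk⇔
      (fromℚ-cancel-< {value {k = k} (fromℚ ∘ q) e} {value {k = k} (fromℚ ∘ q) f} (λ _ → refl) (λ _ → refl))
      (fromℚ-mono-< {value {k = k} (fromℚ ∘ q) e} {value {k = k} (fromℚ ∘ q) f} (λ _ → refl) (λ _ → refl))

    module _ {i j : Fin n} (i<j : i Fin.< j) where

      far-below : Below (far {n} {K} i j i<j) (fromℚ ∘ q) ⇔ (height {k = k} q (i , zero) ℚ.< height q (j , top {K}) ℚ.+ 1ℚ)
      far-below = mk⇔
        (λ b → <-shift (fromℚ-cancel-< {fromℚ (q i) - fromℚ (q j)} {fromℤ (+ k)} (λ _ → refl) (λ _ → refl) b)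
          (height-far q i j))
        (λ b → fromℚ-mono-< {fromℚ (q i) - fromℚ (q j)} {fromℤ (+ k)} (λ _ → refl) (λ _ → refl)
          (<-shift b (sym (height-far q i j))))

      far-above : Above (far {n} {K} i j i<j) (fromℚ ∘ q) ⇔ (height q (j , top {K}) ℚ.+ 1ℚ ℚ.< height {k = k} q (i , zero))
      far-above = mk⇔
        (λ b → <-shift (fromℚ-cancel-< {fromℤ (+ k)} {fromℚ (q i) - fromℚ (q j)} (λ _ → refl) (λ _ → refl) b)
          (height-far′ q i j))
        (λ b → fromℚ-mono-< {fromℤ (+ k)} {fromℚ (q i) - fromℚ (q j)} (λ _ → refl) (λ _ → refl)
          (<-shift b (sym (height-far′ q i j))))

    -- The conditions for q to lie on no hyperplane, in terms of heights.
    Generic : Set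
    Generic = ∀ {i j : Fin n} → i Fin.< j →
      (∀ (m m′ : Fin k) → height q (i , m) ≢ height q (j , m′)) ×
      height {k = k} q (i , zero) ≢ height q (j , top {K}) ℚ.+ 1ℚ

    private
      ≢⇒# : ∀ {a b} → a ≢ b → a ℚ.< b ⊎ b ℚ.< a
      ≢⇒# {a} {b} a≢b with ℚₚ.<-cmp a b
      ... | tri< lt _ _ = inj₁ lt
      ... | tri> _ _ gt = inj₂ gt
      ... | tri≈ _ eq _ = ⊥-elim (a≢b eq)

      value-⇐ : ∀ e f → height q e ℚ.< height q f → value {k = k} (fromℚ ∘ q) e < value {k = k} (fromℚ ∘ q) f
      value-⇐ e f = Equivalence.from (value-height e f)

    generic⇒complement : Generic → (fromℚ ∘ q) ∈ Complement n k
    generic⇒complement generic H with near-or-far l lower upper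
      where open ShiHyperplane H
    ... | inj₁ (m , m′ , eq) = subst (λ l → (fromℚ (q i) - fromℚ (q j)) # fromℤ l) (sym eq)
      ([ (λ lt → inj₁ (Equivalence.from (near-below (fromℚ ∘ q) i<j m m′) (value-⇐ (i , m) (j , m′) lt)))
       , (λ gt → inj₂ (Equivalence.from (near-above (fromℚ ∘ q) i<j m m′) (value-⇐ (j , m′) (i , m) gt))) ]′
       (≢⇒# (proj₁ (generic i<j) m m′)))
      where open ShiHyperplane H
    ... | inj₂ eq = subst (λ l → (fromℚ (q i) - fromℚ (q j)) # fromℤ l) (sym eq)
      ([ (λ lt → inj₁ (Equivalence.from (far-below i<j) lt))
       , (λ gt → inj₂ (Equivalence.from (far-above i<j) gt)) ]′ (≢⇒# (proj₂ (generic i<j))))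
      where open ShiHyperplane H

    complement⇒generic : (fromℚ ∘ q) ∈ Complement n k → Generic
    complement⇒generic cq {i} {j} i<j =
      (λ m m′ eq → [ (λ b → ℚₚ.<-irrefl eq (Equivalence.to (value-height (i , m) (j , m′))
                       (Equivalence.to (near-below (fromℚ ∘ q) i<j m m′) b)))
                   , (λ a → ℚₚ.<-irrefl (sym eq) (Equivalence.to (value-height (j , m′) (i , m))
                       (Equivalence.to (near-above (fromℚ ∘ q) i<j m m′) a))) ]′
                   (cq (near i j i<j m m′))) ,
      (λ eq → [ (λ b → ℚₚ.<-irrefl eq (Equivalence.to (far-below i<j) b))
              , (λ a → ℚₚ.<-irrefl (sym eq) (Equivalence.to (far-above i<j) a)) ]′ (cq (far {n} {K} i j i<j)))

  height-injective : ∀ (q : Fin n → ℚ) → Generic q → ∀ {e f : Expr n k} → height q e ≡ height q f → e ≡ f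
  height-injective q generic {i , m} {j , m′} eq with Finₚ.<-cmp i j
  ... | tri< lt _ _   = ⊥-elim (proj₁ (generic lt) m m′ eq)
  ... | tri> _ _ gt   = ⊥-elim (proj₁ (generic gt) m′ m (sym eq))
  ... | tri≈ _ refl _ = cong (i ,_) (Finₚ.toℕ-injective (ℤₚ.+-injective (/1-injective (+-cancelˡ (q i) _ _ eq))))
    where
    +-cancelˡ : ∀ a b c → a ℚ.+ b ≡ a ℚ.+ c → b ≡ c
    +-cancelˡ a b c eq = trans (sym (lemma a b)) (trans (cong (ℚ._- a) eq) (lemma a c))
      where
      lemma : ∀ a b → (a ℚ.+ b) ℚ.- a ≡ b
      lemma = solve 2 (λ a b → (a :+ b) :- a := b) refl
        where open +-*-Solver

  module _ (q : Fin n → ℚ) (cq : (fromℚ ∘ q) ∈ Complement n k) where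

    rationalRegion : Region n k
    rationalRegion = fromℚ ∘ q , cq

    -- For different labels this is a side of the hyperplane that compares the two expressions,
    -- constant on the region; for equal labels the difference of the two values does not depend on
    -- the point.
    value-holds : ∀ {e f : Expr n k} → height q e ℚ.< height q f → (λ z → value z e < value z f) HoldsOn rationalRegion
    value-holds {i , m} {j , m′} lt z sc with Finₚ.<-cmp i j
    ... | tri< i<j _ _  = Equivalence.to (near-below z i<j m m′)
            (Below-component (near i j i<j m m′) {fromℚ ∘ q} {z} sc
              (Equivalence.from (near-below (fromℚ ∘ q) i<j m m′) (Equivalence.from (value-height q (i , m) (j , m′)) lt)))
    ... | tri> _ _ j<i  = Equivalence.to (near-above z j<i m′ m)
            (Above-component (near j i j<i m′ m) {fromℚ ∘ q} {z} sc
              (Equivalence.from (near-above (fromℚ ∘ q) j<i m′ m) (Equivalence.from (value-height q (i , m) (j , m′)) lt)))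
    ... | tri≈ _ refl _ = ℝ<-shift {value {k = k} (fromℚ ∘ q) (i , m)} {value {k = k} (fromℚ ∘ q) (i , m′)}
            {value {k = k} z (i , m)} {value {k = k} z (i , m′)}
            (Equivalence.from (value-height q (i , m) (i , m′)) lt) λ t →
              solve 4 (λ a b s t → (a :+ t) :- (a :+ s) := (b :+ t) :- (b :+ s)) refl (seq (z i) t) (q i) (ι (toℕ m)) (ι (toℕ m′))
      where open +-*-Solver

  heights⇒SameComponent : ∀ (q q′ : Fin n → ℚ) → (fromℚ ∘ q) ∈ Complement n k → (fromℚ ∘ q′) ∈ Complement n k →
    (∀ e f → height {k = k} q e ℚ.< height q f → height {k = k} q′ e ℚ.< height q′ f) →
    (∀ {i j} → i Fin.< j → height q (j , top {K}) ℚ.+ 1ℚ ℚ.< height {k = k} q (i , zero) →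
                           height q′ (j , top {K}) ℚ.+ 1ℚ ℚ.< height {k = k} q′ (i , zero)) →
    (∀ {i j} → i Fin.< j → height {k = k} q (i , zero) ℚ.< height q (j , top {K}) ℚ.+ 1ℚ →
                           height {k = k} q′ (i , zero) ℚ.< height q′ (j , top {K}) ℚ.+ 1ℚ) →
    SameComponent (Complement n k) (fromℚ ∘ q) (fromℚ ∘ q′)
  heights⇒SameComponent q q′ cq cq′ order far> far< = Agree⇒SameComponent {x = fromℚ ∘ q} {fromℚ ∘ q′} cq agree
    where
    open ShiHyperplane
    Agreement : Fin n → Fin n → ℤ → Set
    Agreement i j l = ((fromℚ (q i) - fromℚ (q j) < fromℤ l) → (fromℚ (q′ i) - fromℚ (q′ j) < fromℤ l)) ×
                      ((fromℤ l < fromℚ (q i) - fromℚ (q j)) → (fromℤ l < fromℚ (q′ i) - fromℚ (q′ j)))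
    values : ∀ e f → value {k = k} (fromℚ ∘ q) e < value {k = k} (fromℚ ∘ q) f →
                     value {k = k} (fromℚ ∘ q′) e < value {k = k} (fromℚ ∘ q′) f
    values e f = Equivalence.from (value-height q′ e f) ∘ order e f ∘ Equivalence.to (value-height q e f)
    agree : (fromℚ ∘ q′) ∈ Agree {n} {k} (fromℚ ∘ q)
    agree H with near-or-far (l H) (lower H) (upper H)
    ... | inj₁ (m , m′ , eq) = subst (Agreement (i H) (j H)) (sym eq)
      ( (λ b → Equivalence.from (near-below (fromℚ ∘ q′) (i<j H) m m′)
          (values (i H , m) (j H , m′) (Equivalence.to (near-below (fromℚ ∘ q) (i<j H) m m′) b)))
      , (λ b → Equivalence.from (near-above (fromℚ ∘ q′) (i<j H) m m′)
          (values (j H , m′) (i H , m) (Equivalence.to (near-above (fromℚ ∘ q) (i<j H) m m′) b))))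
    ... | inj₂ eq = subst (Agreement (i H) (j H)) (sym eq)
      ( (λ b → Equivalence.from (far-below q′ (i<j H)) (far< (i<j H) (Equivalence.to (far-below q (i<j H)) b)))
      , (λ b → Equivalence.from (far-above q′ (i<j H)) (far> (i<j H) (Equivalence.to (far-above q (i<j H)) b))))

-- The diagram of a rational point

record Decreasing {n K : ℕ} (v : Expr n (suc K) → ℚ) (y : Fin (suc K ℕ.* n) ↔ Expr n (suc K)) : Set where
  constructor decreasing
  field
    pos<⇒v> : ∀ {e f} → pos y e ℕ.< pos y f → v f ℚ.< v e

module _ {n K : ℕ} where
  private
    k : ℕ
    k = suc K

  -- This is x_i - x_j > k in terms of the ends of the jump, as x_j + k is 1 above x_j + k - 1.
  FarApart : (Expr n k → ℚ) → Fin n → Fin n → Set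
  FarApart v i j = i Fin.< j × v (j , top) ℚ.+ 1ℚ ℚ.< v (i , zero)

  farApart? : ∀ v i j → Dec (FarApart v i j)
  farApart? v i j = i Finₚ.<? j ×-dec v (j , top) ℚ.+ 1ℚ ℚₚ.<? v (i , zero)

  module Heights (v : Expr n k → ℚ) (v-shift : ∀ {e f} → Shift e f → v e ≡ v f ℚ.+ 1ℚ)
    (y : Fin (k ℕ.* n) ↔ Expr n k) (decr : Decreasing v y) where
    open Decreasing decr

    pos≤⇒v≥ : ∀ {e f} → pos y e ℕ.≤ pos y f → v f ℚ.≤ v e
    pos≤⇒v≥ {e} {f} e≤f with ℕₚ.m≤n⇒m<n∨m≡n e≤f
    ... | inj₁ e<f = ℚₚ.<⇒≤ (pos<⇒v> e<f)
    ... | inj₂ e≡f = ℚₚ.≤-reflexive (cong v (sym (pos-injective y e≡f)))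

    v≤⇒pos≥ : ∀ {e f} → v f ℚ.≤ v e → pos y e ℕ.≤ pos y f
    v≤⇒pos≥ f≤e = ℕₚ.≮⇒≥ λ f<e → ℚₚ.<-irrefl refl (ℚₚ.<-≤-trans (pos<⇒v> f<e) f≤e)

    v<⇒pos> : ∀ {e f} → v f ℚ.< v e → pos y e ℕ.< pos y f
    v<⇒pos> f<e = ℕₚ.≰⇒> λ f≤e → ℚₚ.<-irrefl refl (ℚₚ.<-≤-trans f<e (pos≤⇒v≥ f≤e))

    edge-drop : ∀ {e f} → Edge (FarApart v) e f → v f ℚ.+ 1ℚ ℚ.≤ v e
    edge-drop (inj₁ s)                       = ℚₚ.≤-reflexive (sym (v-shift s))
    edge-drop (inj₂ (refl , refl , _ , far)) = ℚₚ.<⇒≤ far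

    rightward : ∀ {e f} → Edge (FarApart v) e f → pos y e ℕ.< pos y f
    rightward {f = f} e→f = v<⇒pos> (ℚₚ.<-≤-trans (p<p+1 (v f)) (edge-drop e→f))

    MinimalEdge : Expr n k → Expr n k → Set
    MinimalEdge = Minimal (FarApart v) y

    -- Every edge drops by at least 1 and a shift by exactly 1, so a shift has no room for another
    -- edge inside. This keeps all copies of a label in one chain.
    shift⇒minimal : ∀ {e f} → Shift e f → MinimalEdge e f
    shift⇒minimal {e} {f} s = inj₁ s , λ e′ f′ e′→f′ e≤e′ f′≤f →
      pos-injective y (ℕₚ.≤-antisym (v≤⇒pos≥ (begin
        v e           ≡⟨ v-shift s ⟩
        v f ℚ.+ 1ℚ    ≤⟨ ℚₚ.+-monoˡ-≤ 1ℚ (pos≤⇒v≥ f′≤f) ⟩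
        v f′ ℚ.+ 1ℚ   ≤⟨ edge-drop e′→f′ ⟩
        v e′          ∎)) e≤e′) ,
      pos-injective y (ℕₚ.≤-antisym f′≤f (ℕₚ.≮⇒≥ λ f′<f → ℚₚ.<-irrefl refl (begin-strict
        v f ℚ.+ 1ℚ    <⟨ ℚₚ.+-monoˡ-< 1ℚ (pos<⇒v> f′<f) ⟩
        v f′ ℚ.+ 1ℚ   ≤⟨ edge-drop e′→f′ ⟩
        v e′          ≤⟨ pos≤⇒v≥ e≤e′ ⟩
        v e           ≡⟨ v-shift s ⟩
        v f ℚ.+ 1ℚ    ∎)))
      where open ℚₚ.≤-Reasoning

    _⇝_ : Fin n → Fin n → Set
    i ⇝ j = MinimalEdge (i , zero) (j , top)

    minimal⇒edge : ∀ {e f} → MinimalEdge e f → Edge _⇝_ e f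
    minimal⇒edge (inj₁ s , _)                     = inj₁ s
    minimal⇒edge (inj₂ (refl , refl , far) , min) = inj₂ (refl , refl , inj₂ (refl , refl , far) , min)

    edge⇒minimal : ∀ {e f} → Edge _⇝_ e f → MinimalEdge e f
    edge⇒minimal (inj₁ s)                   = shift⇒minimal s
    edge⇒minimal (inj₂ (refl , refl , min)) = min

    ⇝⇒farApart : ∀ {i j} → i ⇝ j → FarApart v i j
    ⇝⇒farApart (inj₁ s , _)             = ⊥-elim (¬-shift-into-top s)
    ⇝⇒farApart (inj₂ (_ , _ , far) , _) = far

    ⇝-nonnesting : Nonnesting _⇝_ y
    ⇝-nonnesting = record
      { rightward = λ e→f → rightward (proj₁ (edge⇒minimal e→f))
      ; targets-≤ = λ e→f e′→f′ → minimal-targets-≤ (farApart? v) y rightward (edge⇒minimal e→f) (edge⇒minimal e′→f′)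
      ; sources-≤ = λ e→f e′→f′ → minimal-sources-≤ (farApart? v) y rightward (edge⇒minimal e→f) (edge⇒minimal e′→f′)
      }

    open Paths _⇝_ (λ i j → minimal? (farApart? v) y (i , zero) (j , top))
      (λ i⇝j → proj₁ (⇝⇒farApart i⇝j))
      (λ p p′ → cong proj₁ (pos-injective y (ℕₚ.≤-antisym
        (minimal-targets-≤ (farApart? v) y rightward p p′ ℕₚ.≤-refl)
        (minimal-targets-≤ (farApart? v) y rightward p′ p ℕₚ.≤-refl))))
      (λ p p′ → cong proj₁ (pos-injective y (ℕₚ.≤-antisym
        (minimal-sources-≤ (farApart? v) y rightward p p′ ℕₚ.≤-refl)
        (minimal-sources-≤ (farApart? v) y rightward p′ p ℕₚ.≤-refl))))
      -- Positions count from 1, and the top copy is the leftmost copy of `j`.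
      (λ j → suc (pos y (j , top)))
      (λ eq → cong proj₁ (pos-injective y (ℕₚ.suc-injective eq))) public

    pos-top-≤ : ∀ j m → pos y (j , top) ℕ.≤ pos y (j , m)
    pos-top-≤ j = copies-induction {i = j} (λ m → pos y (j , top) ℕ.≤ pos y (j , m))
      (λ s le → ℕₚ.≤-trans le (ℕₚ.<⇒≤ (rightward (inj₁ (refl , s))))) ℕₚ.≤-refl

    -- Going back along shifts and jumps only moves left. The bound serves twice: the start of a
    -- chain is its leftmost element, and the labels satisfy the parking condition.
    labelling-≤ : ∀ {a} → IsLabelling a → ∀ j m → a j ℕ.≤ suc (pos y (j , m))
    labelling-≤ {a} (a-⇝ , a-start) j m = go j (<-wellFounded j) m
      where
      go : ∀ j → Acc Fin._<_ j → ∀ m → a j ℕ.≤ suc (pos y (j , m))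
      go j (acc rec) m with Finₚ.any? (λ i → minimal? (farApart? v) y (i , zero) (j , top))
      ... | no none = ℕₚ.≤-trans (ℕₚ.≤-reflexive (a-start j λ i p → none (i , p))) (s≤s (pos-top-≤ j m))
      ... | yes (i , i⇝j) = begin
        a j                        ≡⟨ a-⇝ i j i⇝j ⟨
        a i                        ≤⟨ go i (rec (proj₁ (⇝⇒farApart i⇝j))) zero ⟩
        suc (pos y (i , zero))     ≤⟨ s≤s (ℕₚ.<⇒≤ (rightward (proj₁ i⇝j))) ⟩
        suc (pos y (j , top))      ≤⟨ s≤s (pos-top-≤ j m) ⟩
        suc (pos y (j , m))        ∎
        where open ℕₚ.≤-Reasoning

    labelling-nonnesting : ∀ {a} → IsLabelling a → Nonnesting (Link a) y
    labelling-nonnesting {a} labels = record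
      { rightward = λ e→f → Nonnesting.rightward ⇝-nonnesting (to e→f)
      ; targets-≤ = λ e→f e′→f′ → Nonnesting.targets-≤ ⇝-nonnesting (to e→f) (to e′→f′)
      ; sources-≤ = λ e→f e′→f′ → Nonnesting.sources-≤ ⇝-nonnesting (to e→f) (to e′→f′)
      }
      where
      to : ∀ {e f} → Edge (Link a) e f → Edge _⇝_ e f
      to = edge-map λ {i} {j} → Labelled.link⇒⇝ {a} labels {i} {j}

    first-position : ∀ {a} → IsLabelling a → ∀ {j} → First a j → a j ≡ suc (pos y (j , top))
    first-position (a-⇝ , a-start) {j} first = a-start j λ i i⇝j →
      first i (proj₁ (⇝⇒farApart i⇝j)) (a-⇝ i j i⇝j)

    -- Together with `link-edge⇒far`, this expresses the side of x_i - x_j = k through positions and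
    -- labels alone.
    far⇒link-edge : ∀ {a} → IsLabelling a → ∀ {i j} → FarApart v i j →
                    ∃₂ λ e f → Edge (Link a) e f × Inside y (i , zero) (j , top) e f
    far⇒link-edge {a} labels {i} {j} far′ =
      let e , f , min , inside = contains-minimal (farApart? v) y rightward (i , zero) (j , top) (inj₂ (refl , refl , far′))
      in e , f , edge-map {L = _⇝_} {Link a} (λ {i} {j} → Labelled.⇝⇒link {a} labels {i} {j}) (minimal⇒edge min) , inside

    -- The edge inside drops by at least 1, hence so does the pair around it; a drop of exactly 1
    -- would put the point on x_i - x_j = k, which `v≢` rules out.
    link-edge⇒far : ∀ {a} → IsLabelling a → ∀ {i j} → i Fin.< j → v (i , zero) ≢ v (j , top) ℚ.+ 1ℚ →
                    ∀ {e f} → Edge (Link a) e f → Inside y (i , zero) (j , top) e f → FarApart v i j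
    link-edge⇒far {a} labels i<j v≢ e→f (i≤e , f≤j) = i<j , ≤∧≢⇒<
      (ℚₚ.≤-trans (ℚₚ.+-monoˡ-≤ 1ℚ (pos≤⇒v≥ f≤j))
        (ℚₚ.≤-trans (edge-drop (proj₁ (edge⇒minimal
            (edge-map {L = Link a} {_⇝_} (λ {i} {j} → Labelled.link⇒⇝ {a} labels {i} {j}) e→f))))
          (pos≤⇒v≥ i≤e)))
      (λ eq → v≢ (sym eq))

  module SameLabels (v v′ : Expr n k → ℚ)
    (v-shift : ∀ {e f} → Shift e f → v e ≡ v f ℚ.+ 1ℚ) (v′-shift : ∀ {e f} → Shift e f → v′ e ≡ v′ f ℚ.+ 1ℚ)
    (y y′ : Fin (k ℕ.* n) ↔ Expr n k) (decr : Decreasing v y) (decr′ : Decreasing v′ y′)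
    {a : Fin n → ℕ} (labels : Heights.IsLabelling v v-shift y decr a) (labels′ : Heights.IsLabelling v′ v′-shift y′ decr′ a)
    where
    private
      module H = Heights v v-shift y decr
      module H′ = Heights v′ v′-shift y′ decr′

      initial : ∀ f → (∃[ e ] Edge (Link a) e f) ⊎ pos y f ≡ pos y′ f
      initial f with first-or-edge a f
      ... | inj₁ (first , refl) = inj₂ (ℕₚ.suc-injective
              (trans (sym (H.first-position {a} labels first)) (H′.first-position {a} labels′ first)))
      ... | inj₂ edge           = inj₁ edge

    same-position : ∀ e → pos y e ≡ pos y′ e
    same-position = Uniqueness.same-position (H.labelling-nonnesting {a} labels) (H′.labelling-nonnesting {a} labels′) initial

    order : ∀ e f → v e ℚ.< v f → v′ e ℚ.< v′ f
    order e f lt = Decreasing.pos<⇒v> decr′ (subst₂ ℕ._<_ (same-position f) (same-position e) (H.v<⇒pos> lt))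

    far-transfer : ∀ {i j} → v′ (i , zero) ≢ v′ (j , top) ℚ.+ 1ℚ → FarApart v i j → FarApart v′ i j
    far-transfer {i} {j} v′≢ far′@(i<j , _) =
      let e , f , e→f , i≤e , f≤j = H.far⇒link-edge {a} labels far′
      in H′.link-edge⇒far {a} labels′ i<j v′≢ e→f
           (subst₂ ℕ._≤_ (same-position (i , zero)) (same-position e) i≤e ,
            subst₂ ℕ._≤_ (same-position f) (same-position (j , top)) f≤j)

  module _ (q : Fin n → ℚ) (cq : (fromℚ ∘ q) ∈ Complement n k) where
    private
      R : Region n k
      R = rationalRegion q cq

      sc-refl : SameComponent (Complement n k) (fromℚ ∘ q) (fromℚ ∘ q)
      sc-refl = Agree⇒SameComponent {x = fromℚ ∘ q} {fromℚ ∘ q} cq (λ _ → id , id)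

    decreasing⇒isOrdering : ∀ y → Decreasing (height q) y → IsOrdering R y
    decreasing⇒isOrdering y (decreasing pos<⇒v>) p p′ p<p′ =
      value-holds q cq {Inverse.to y p′} {Inverse.to y p}
        (pos<⇒v> (subst₂ ℕ._<_ (sym (cong toℕ (Inverse.strictlyInverseʳ y p))) (sym (cong toℕ (Inverse.strictlyInverseʳ y p′))) p<p′))

    far⇒farApart : ∀ {i j} → i Fin.< j → (λ x → fromℤ (+ k) < x i - x j) HoldsOn R → FarApart (height q) i j
    far⇒farApart i<j holds = i<j , Equivalence.to (far-above {K = K} q i<j) (holds (fromℚ ∘ q) sc-refl)

    farApart⇒far : ∀ {i j} → FarApart (height q) i j → (λ x → fromℤ (+ k) < x i - x j) HoldsOn R
    farApart⇒far {i} {j} (i<j , far′) z sc =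
      Above-component (far {n} {K} i j i<j) {fromℚ ∘ q} {z} sc (Equivalence.from (far-above {K = K} q i<j) far′)

    module _ (y : Fin (k ℕ.* n) ↔ Expr n k) (decr : Decreasing (height q) y) where
      open Diagram R y
      open Heights (height q) (height-shift q) y decr

      arc⇒edge : ∀ {e f} → Arc e f → Edge (FarApart (height q)) e f
      arc⇒edge (shift i eq)            = inj₁ (refl , eq)
      arc⇒edge (jump m≡0 m′≡ i<j holds) = inj₂
        ( Finₚ.toℕ-injective m≡0
        , Finₚ.toℕ-injective (trans (ℕₚ.suc-injective m′≡) (sym (Finₚ.toℕ-fromℕ K)))
        , far⇒farApart i<j holds )

      edge⇒arc : ∀ {e f} → Edge (FarApart (height q)) e f → Arc e f
      edge⇒arc (inj₁ (refl , eq))         = shift _ eq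
      edge⇒arc (inj₂ (refl , refl , far)) = jump refl (cong suc (Finₚ.toℕ-fromℕ K)) (proj₁ far) (farApart⇒far far)

      -- A remaining arc only refutes that a different arc lies inside. Decidable equality of
      -- expressions turns this into the positive conclusion of `Minimal`.
      remaining⇒minimal : ∀ {e f} → RemainingArc e f → MinimalEdge e f
      remaining⇒minimal {e} {f} (arc , kept) = arc⇒edge arc , λ e′ f′ e′→f′ e≤e′ f′≤f →
        decidable-stable (e′ ≟ᴱ e ×-dec f′ ≟ᴱ f) λ differ →
          kept (e′ , f′ , edge⇒arc e′→f′ , (λ { refl → differ (refl , refl) }) , s≤s e≤e′ , s≤s f′≤f)

      minimal⇒remaining : ∀ {e f} → MinimalEdge e f → RemainingArc e f
      minimal⇒remaining (e→f , min) = edge⇒arc e→f , λ { (e′ , f′ , arc , differ , s≤s e≤e′ , s≤s f′≤f) →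
        let p , q = min e′ f′ (arc⇒edge arc) e≤e′ f′≤f in differ (cong₂ _,_ p q) }

      module _ {a : Fin n → ℕ} (labels : IsLabelling a) where
        private
          a-⇝ = proj₁ labels
          a-start = proj₂ labels

        arc-label : ∀ {e f} → RemainingArc e f → a (proj₁ e) ≡ a (proj₁ f)
        arc-label arc with minimal⇒edge (remaining⇒minimal arc)
        ... | inj₁ (refl , _)         = refl
        ... | inj₂ (refl , refl , ij) = a-⇝ _ _ ij

        chain-label : ∀ {e f} → EqClosure RemainingArc e f → a (proj₁ e) ≡ a (proj₁ f)
        chain-label nil              = refl
        chain-label (fwd arc ◅ arcs) = trans (arc-label arc) (chain-label arcs)
        chain-label (bwd arc ◅ arcs) = trans (sym (arc-label arc)) (chain-label arcs)

        copies-connected : ∀ i m → EqClosure RemainingArc (i , m) (i , zero)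
        copies-connected i m = go (toℕ m) m refl
          where
          go : ∀ c m → toℕ m ≡ c → EqClosure RemainingArc (i , m) (i , zero)
          go c       zero    _  = nil
          go (suc c) (suc m) eq = fwd (minimal⇒remaining (shift⇒minimal s)) ◅
              go c (Fin.inject₁ m) (trans (Finₚ.toℕ-inject₁ m) (ℕₚ.suc-injective eq))
            where
            s : Shift (i , suc m) (i , Fin.inject₁ m)
            s = refl , cong suc (sym (Finₚ.toℕ-inject₁ m))

        chain-start : ∀ j → ∃[ e ] (EqClosure RemainingArc (j , top) e × suc (pos y e) ≡ a j)
        chain-start j = go j (<-wellFounded j)
          where
          go : ∀ j → Acc Fin._<_ j → ∃[ e ] (EqClosure RemainingArc (j , top) e × suc (pos y e) ≡ a j)
          go j (acc rec) with Finₚ.any? (λ i → minimal? (farApart? (height q)) y (i , zero) (j , top))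
          ... | no none = (j , top) , nil , sym (a-start j λ i p → none (i , p))
          ... | yes (i , i⇝j) =
            let e , path , eq = go i (rec (proj₁ (⇝⇒farApart i⇝j)))
            -- From the top copy of `j` back along the jump to x_i, then back along the shifts to
            -- the top copy of `i`.
            in e , bwd (minimal⇒remaining i⇝j) ◅ (Eq.symmetric RemainingArc (copies-connected i top) ◅◅ path)
                 , trans eq (a-⇝ i j i⇝j)

        -- Labels are constant along arcs, so an expression (i , m) in the chain of `j` has a i = a
        -- j, and `labelling-≤` bounds its position from below.
        labelling⇒isSigma : IsSigma R a
        labelling⇒isSigma = y , decreasing⇒isOrdering y decr , λ j →
          (let e , path , eq = chain-start j in e , (top , path) , eq) ,
          λ { (i , m) (m′ , path) → subst (ℕ._≤ suc (pos y (i , m))) (sym (chain-label path)) (labelling-≤ labels i m) }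

-- Uniqueness of σ and the parking condition

strictly-monotone⇒≥ : ∀ {N} (g : Fin N → Fin N) → (∀ {p q} → p Fin.< q → g p Fin.< g q) → ∀ p → p Fin.≤ g p
strictly-monotone⇒≥ {N} g mono p = go (toℕ p) p refl
  where
  go : ∀ c p → toℕ p ≡ c → p Fin.≤ g p
  go zero    p eq = subst (ℕ._≤ toℕ (g p)) (sym eq) z≤n
  go (suc c) p eq = subst (ℕ._≤ toℕ (g p)) (sym eq)
      (ℕₚ.≤-<-trans (subst (ℕ._≤ toℕ (g r)) r≡c (go c r r≡c)) (mono (subst₂ ℕ._<_ (sym r≡c) (sym eq) ℕₚ.≤-refl)))
    where
    c<N : c ℕ.< N
    c<N = ℕₚ.<-trans (subst (c ℕ.<_) (sym eq) ℕₚ.≤-refl) (Finₚ.toℕ<n p)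
    r : Fin N
    r = Fin.fromℕ< c<N
    r≡c : toℕ r ≡ c
    r≡c = Finₚ.toℕ-fromℕ< c<N

module _ {n K : ℕ} where
  private
    k : ℕ
    k = suc K

    module ≈ᴿ = Setoid (Regions n k)

  -- Passing from `y` to `y′` is a strictly monotone self-map of the positions, which cannot move
  -- any of them to the left. Used both ways, this shows that a region has only one ordering.
  order⇒position-≤ : (y y′ : Fin (k ℕ.* n) ↔ Expr n k) →
    (∀ e f → pos y e ℕ.< pos y f → pos y′ e ℕ.< pos y′ f) → ∀ e → pos y e ℕ.≤ pos y′ e
  order⇒position-≤ y y′ order e = subst (λ e′ → pos y e ℕ.≤ pos y′ e′) (Inverse.strictlyInverseˡ y e)
    (strictly-monotone⇒≥ (λ p → Inverse.from y′ (Inverse.to y p))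
      (λ {p} {q} p<q → order (Inverse.to y p) (Inverse.to y q)
        (subst₂ ℕ._<_ (sym (cong toℕ (Inverse.strictlyInverseʳ y p))) (sym (cong toℕ (Inverse.strictlyInverseʳ y q))) p<q))
      (Inverse.from y e))

  holdsOn-resp : ∀ {P : Pred (Point n) 0ℓ} {R R′ : Region n k} → R ≈ᴿ R′ → P HoldsOn R → P HoldsOn R′
  holdsOn-resp {R = R} {R′} R≈R′ holds z sc =
    holds z (≈ᴿ.trans {R} {R′} {z , proj₁ (proj₂ (proj₂ sc)) (proj₂ (proj₂ (proj₂ (proj₂ sc))))} R≈R′ sc)

  isOrdering-values : ∀ (R : Region n k) y → IsOrdering R y → ∀ e f → pos y e ℕ.< pos y f →
                      value (proj₁ R) f < value (proj₁ R) e
  isOrdering-values R y ord e f e<f = subst₂ (λ f e → value (proj₁ R) f < value (proj₁ R) e)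
    (Inverse.strictlyInverseˡ y f) (Inverse.strictlyInverseˡ y e)
    (ord (Inverse.from y e) (Inverse.from y f) e<f (proj₁ R) (≈ᴿ.refl {R}))

  ordering-≤ : ∀ (R : Region n k) y y′ → IsOrdering R y → IsOrdering R y′ → ∀ e → pos y e ℕ.≤ pos y′ e
  ordering-≤ R y y′ ord ord′ = order⇒position-≤ y y′ λ e f e<f → ℕₚ.≰⇒> λ f≤e →
    case ℕₚ.m≤n⇒m<n∨m≡n f≤e of λ
      { (inj₁ f<e) → ℝ<-asym {value (proj₁ R) f} {value (proj₁ R) e}
          (isOrdering-values R y ord e f e<f) (isOrdering-values R y′ ord′ f e f<e)
      ; (inj₂ f≡e) → ℕₚ.<⇒≢ e<f (cong (pos y) (sym (pos-injective y′ f≡e))) }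

  ordering-unique : ∀ (R : Region n k) y y′ → IsOrdering R y → IsOrdering R y′ → ∀ e → pos y e ≡ pos y′ e
  ordering-unique R y y′ ord ord′ e = ℕₚ.≤-antisym (ordering-≤ R y y′ ord ord′ e) (ordering-≤ R y′ y ord′ ord e)

  isOrdering-resp : ∀ {R R′ : Region n k} y → R ≈ᴿ R′ → IsOrdering R y → IsOrdering R′ y
  isOrdering-resp {R} {R′} y R≈R′ ord p q p<q =
    holdsOn-resp {λ x → value x (Inverse.to y q) < value x (Inverse.to y p)} {R} {R′} R≈R′ (ord p q p<q)

  arc-resp : ∀ {R R′ : Region n k} {y y′} → R ≈ᴿ R′ → ∀ {e f} → Diagram.Arc R y e f → Diagram.Arc R′ y′ e f
  arc-resp R≈R′ (Diagram.shift i eq) = Diagram.shift i eq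
  arc-resp {R} {R′} R≈R′ (Diagram.jump p q i<j holds) = Diagram.jump p q i<j (holdsOn-resp {_} {R} {R′} R≈R′ holds)

  -- Whether an arc remains depends on other arcs being absent, so arcs have to be carried from `R′`
  -- back to `R` as well.
  chain-resp : ∀ {R R′ : Region n k} {y y′} → R ≈ᴿ R′ → (∀ e → pos y e ≡ pos y′ e) →
               ∀ {i e} → Diagram.Chain R y i e → Diagram.Chain R′ y′ i e
  chain-resp {R} {R′} {y} {y′} R≈R′ same (m , path) = m , Eq.map remaining path
    where
    remaining : ∀ {e f} → Diagram.RemainingArc R y e f → Diagram.RemainingArc R′ y′ e f
    remaining {e} {f} (arc , kept) = arc-resp {R} {R′} R≈R′ arc , λ { (e′ , f′ , arc′ , differ , p , q) →
      kept (e′ , f′ , arc-resp {R′} {R} (≈ᴿ.sym {R} {R′} R≈R′) arc′ , differ ,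
        subst₂ (λ s t → suc s ℕ.≤ suc t) (sym (same e)) (sym (same e′)) p ,
        subst₂ (λ s t → suc s ℕ.≤ suc t) (sym (same f′)) (sym (same f)) q) }

  isSigma-resp : ∀ {R R′ : Region n k} {a} → R ≈ᴿ R′ → IsSigma R a → IsSigma R′ a
  isSigma-resp {R} {R′} R≈R′ (y , ord , leftmost) = y , isOrdering-resp {R} {R′} y R≈R′ ord , λ i →
    let (e , e∈ , eq) , lower = leftmost i
    in (e , chain-resp {R} {R′} R≈R′ (λ _ → refl) e∈ , eq) ,
       λ f f∈ → lower f (chain-resp {R′} {R} (≈ᴿ.sym {R} {R′} R≈R′) (λ _ → refl) f∈)

  isSigma-unique : ∀ {R : Region n k} {a a′} → IsSigma R a → IsSigma R a′ → a ≗ a′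
  isSigma-unique {R} (y , ord , leftmost) (y′ , ord′ , leftmost′) i =
    let same = ordering-unique R y y′ ord ord′
        (e , e∈ , eq) , lower = leftmost i ; (e′ , e′∈ , eq′) , lower′ = leftmost′ i
    in ℕₚ.≤-antisym
      (ℕₚ.≤-trans (lower e′ (chain-resp {R} {R} (≈ᴿ.refl {R}) (λ e → sym (same e)) e′∈))
        (ℕₚ.≤-reflexive (trans (cong suc (same e′)) eq′)))
      (ℕₚ.≤-trans (lower′ e (chain-resp {R} {R} (≈ᴿ.refl {R}) same e∈))
        (ℕₚ.≤-reflexive (trans (cong suc (sym (same e))) eq)))

  -- If the (j + 1)-st smallest value exceeded 1 + k j, the first k j + 1
  -- positions would be filled with the k copies of only j labels.
  isParking-intro : (y : Fin (k ℕ.* n) ↔ Expr n k) (a : Fin n → ℕ) → (∀ i → 1 ℕ.≤ a i) →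
                    (∀ i m → a i ℕ.≤ suc (pos y (i , m))) → IsParking k a
  isParking-intro y a 1≤a a≤pos = 1≤a , sorting , sorted , bound
    where
    _≺_ : Fin n → Fin n → Set
    -- Equal values are ordered by their labels, as `Ranking` needs a strict total order.
    i ≺ j = a i ℕ.< a j ⊎ (a i ≡ a j × i Fin.< j)
    ≺-irrefl : ∀ {i} → ¬ (i ≺ i)
    ≺-irrefl (inj₁ lt)       = ℕₚ.<-irrefl refl lt
    ≺-irrefl (inj₂ (_ , lt)) = ℕₚ.<-irrefl refl lt
    ≺-trans : ∀ {i j l} → i ≺ j → j ≺ l → i ≺ l
    ≺-trans (inj₁ p)       (inj₁ q)       = inj₁ (ℕₚ.<-trans p q)
    ≺-trans (inj₁ p)       (inj₂ (q , _)) = inj₁ (ℕₚ.<-≤-trans p (ℕₚ.≤-reflexive q))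
    ≺-trans (inj₂ (p , _)) (inj₁ q)       = inj₁ (ℕₚ.≤-<-trans (ℕₚ.≤-reflexive p) q)
    ≺-trans (inj₂ (p , r)) (inj₂ (q , s)) = inj₂ (trans p q , ℕₚ.<-trans r s)
    ≺-connex : ∀ {i j} → i ≢ j → i ≺ j ⊎ j ≺ i
    ≺-connex {i} {j} i≢j with ℕₚ.<-cmp (a i) (a j) | Finₚ.<-cmp i j
    ... | tri< lt _ _ | _           = inj₁ (inj₁ lt)
    ... | tri> _ _ gt | _           = inj₂ (inj₁ gt)
    ... | tri≈ _ eq _ | tri< lt _ _ = inj₁ (inj₂ (eq , lt))
    ... | tri≈ _ eq _ | tri> _ _ gt = inj₂ (inj₂ (sym eq , gt))
    ... | tri≈ _ eq _ | tri≈ _ e _  = ⊥-elim (i≢j e)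
    open Ranking _≺_ (λ i j → a i ℕ.<? a j ⊎-dec (a i ℕ.≟ a j ×-dec i Finₚ.<? j)) ≺-irrefl ≺-trans ≺-connex
    b : Fin n → ℕ
    b i = a (sorting ⟨$⟩ʳ i)
    sorted : ∀ i j → i Fin.≤ j → b i ℕ.≤ b j
    sorted i j i≤j with ℕₚ.m≤n⇒m<n∨m≡n i≤j
    ... | inj₂ eq = ℕₚ.≤-reflexive (cong b (Finₚ.toℕ-injective eq))
    ... | inj₁ lt with sorting-mono lt
    ...   | inj₁ b<     = ℕₚ.<⇒≤ b<
    ...   | inj₂ (eq , _) = ℕₚ.≤-reflexive eq
    bound : ∀ j → b j ℕ.≤ 1 ℕ.+ k ℕ.* toℕ j
    bound j = ℕₚ.≮⇒≥ λ too-large → overfull too-large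
      where
      overfull : 1 ℕ.+ k ℕ.* toℕ j ℕ.< b j → ⊥
      overfull too-large = ℕₚ.1+n≰n (subst (suc (k ℕ.* toℕ j) ℕ.≤_) (ℕₚ.*-comm (toℕ j) k)
                             (Finₚ.injective⇒≤ {f = slot} slot-injective))
        where
        r<N : (r : Fin (suc (k ℕ.* toℕ j))) → toℕ r ℕ.< k ℕ.* n
        r<N r = ℕₚ.<-≤-trans (Finₚ.toℕ<n r) (ℕₚ.≤-trans (s≤s (ℕₚ.m≤n+m (k ℕ.* toℕ j) K))
          (ℕₚ.≤-trans (ℕₚ.≤-reflexive (sym (ℕₚ.*-suc k (toℕ j)))) (ℕₚ.*-monoʳ-≤ k (Finₚ.toℕ<n j))))
        expr : Fin (suc (k ℕ.* toℕ j)) → Expr n k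
        expr r = proj₁ (pos-surjective y (toℕ r) (r<N r))
        expr-pos : ∀ r → pos y (expr r) ≡ toℕ r
        expr-pos r = proj₂ (pos-surjective y (toℕ r) (r<N r))
        index : Fin (suc (k ℕ.* toℕ j)) → Fin n
        index r = sorting ⟨$⟩ˡ proj₁ (expr r)
        b-index : ∀ r → b (index r) ≡ a (proj₁ (expr r))
        b-index r = cong a (Inverse.strictlyInverseˡ sorting (proj₁ (expr r)))
        index<j : ∀ r → toℕ (index r) ℕ.< toℕ j
        index<j r = ℕₚ.≰⇒> λ j≤ → ℕₚ.<⇒≱ too-large (begin
          b j                            ≤⟨ sorted j (index r) j≤ ⟩
          b (index r)                    ≡⟨ b-index r ⟩
          a (proj₁ (expr r))             ≤⟨ a≤pos (proj₁ (expr r)) (proj₂ (expr r)) ⟩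
          suc (pos y (expr r))           ≡⟨ cong suc (expr-pos r) ⟩
          suc (toℕ r)                    ≤⟨ Finₚ.toℕ<n r ⟩
          suc (k ℕ.* toℕ j)              ∎)
          where open ℕₚ.≤-Reasoning
        slot : Fin (suc (k ℕ.* toℕ j)) → Fin (toℕ j ℕ.* k)
        slot r = Fin.combine (Fin.fromℕ< (index<j r)) (proj₂ (expr r))
        slot-injective : ∀ {r s} → slot r ≡ slot s → r ≡ s
        slot-injective {r} {s} eq =
          let p , q = Finₚ.combine-injective (Fin.fromℕ< (index<j r)) (proj₂ (expr r)) (Fin.fromℕ< (index<j s)) (proj₂ (expr s)) eq
              same-index = Finₚ.toℕ-injective (Finₚ.fromℕ<-injective _ _ (index<j r) (index<j s) p)
              same-label = from-injective sorting same-index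
          in Finₚ.toℕ-injective (trans (sym (expr-pos r)) (trans (cong (pos y) (cong₂ _,_ same-label q)) (expr-pos s)))

-- Filling the positions

module _ {n K : ℕ} (a : Fin n → ℕ) where
  private
    k : ℕ
    k = suc K

  edge-target-unique : ∀ {e f f′ : Expr n k} → Edge (Link a) e f → Edge (Link a) e f′ → f ≡ f′
  edge-target-unique (inj₁ (refl , p)) (inj₁ (refl , p′)) =
    cong (_ ,_) (Finₚ.toℕ-injective (ℕₚ.suc-injective (trans (sym p) p′)))
  edge-target-unique (inj₁ (_ , ())) (inj₂ (refl , _ , _))
  edge-target-unique (inj₂ (refl , _ , _)) (inj₁ (_ , ()))
  edge-target-unique (inj₂ (refl , refl , l)) (inj₂ (_ , refl , l′)) = cong (_, top) (link-succ-unique l l′)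

  edge-label : ∀ {e f : Expr n k} → Edge (Link a) e f → a (proj₁ e) ≡ a (proj₁ f)
  edge-label (inj₁ (refl , _))           = refl
  edge-label (inj₂ (_ , _ , _ , eq , _)) = eq

  ¬-edge-into-first : ∀ {e : Expr n k} {j} → First a j → ¬ Edge (Link a) e (j , top)
  ¬-edge-into-first first (inj₁ s)                            = ¬-shift-into-top s
  ¬-edge-into-first first (inj₂ (_ , _ , i<j , same , _)) = first _ i<j same

  -- Every chain of the diagram of `Link a` starts at the top copy of the first label of a block and
  -- follows edges from there.
  edge-induction : (Q : Expr n k → Set) → (∀ j → First a j → Q (j , top)) →
                   (∀ {e f} → Edge (Link a) e f → Q e → Q f) → ∀ e → Q e
  edge-induction Q base step (j , m) = label j (<-wellFounded j) m
    where
    copies : ∀ j → Q (j , top) → ∀ m → Q (j , m)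
    copies j = copies-induction {i = j} (λ m → Q (j , m)) (λ s → step (inj₁ (refl , s)))
    label : ∀ j → Acc Fin._<_ j → ∀ m → Q (j , m)
    label j (acc rec) m with first-or-link a j
    ... | inj₁ first    = copies j (base j first) m
    ... | inj₂ (i , ij) = copies j (step (inj₂ (refl , refl , ij)) (label i (rec (proj₁ ij)) zero)) m

  minimal-by : (f : Expr n k → ℕ) {Q : Expr n k → Set} → (∀ e → Dec (Q e)) → ∃ Q →
               ∃[ d ] (Q d × (∀ d′ → Q d′ → f d ℕ.≤ f d′))
  minimal-by f {Q} Q? (d , Qd) = go (suc (f d)) d Qd ℕₚ.≤-refl
    where
    go : ∀ c d → Q d → f d ℕ.< c → ∃[ d ] (Q d × (∀ d′ → Q d′ → f d ℕ.≤ f d′))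
    go (suc c) d Qd (s≤s d≤c) with any? (λ d′ → Q? d′ ×-dec f d′ ℕ.<? f d)
    ... | yes (d′ , Qd′ , d′<d) = go c d′ Qd′ (ℕₚ.<-≤-trans d′<d d≤c)
    ... | no  none              = d , Qd , λ d′ Qd′ → ℕₚ.≮⇒≥ λ d′<d → none (d′ , Qd′ , d′<d)

  module Filling (parking : IsParking k a) where
    private
      N : ℕ
      N = k ℕ.* n
      _⟶_ : Expr n k → Expr n k → Set
      _⟶_ = Edge (Link a)

    -- The first p positions are filled; expressions with P e ≥ N are not yet placed.
    record State (p : ℕ) : Set where
      field
        P          : Expr n k → ℕ
        unplaced   : ∀ {e} → ¬ (P e ℕ.< p) → N ℕ.≤ P e
        injective  : ∀ {e f} → P e ≡ P f → P e ℕ.< p → e ≡ f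
        surjective : ∀ {r} → r ℕ.< p → ∃[ e ] P e ≡ r
        rightward  : ∀ {e f} → e ⟶ f → P f ℕ.< p → P e ℕ.< P f
        -- Only `f′` is assumed to be placed: an edge may be finished only after all those that
        -- started before it.
        nonnesting : ∀ {e f e′ f′} → e ⟶ f → e′ ⟶ f′ → P f′ ℕ.< p → P e ℕ.< P e′ → P f ℕ.< P f′
        first-pos  : ∀ {j} → First a j → P (j , top) ℕ.< p → suc (P (j , top)) ≡ a j
        first-done : ∀ {j} → First a j → a j ℕ.≤ p → P (j , top) ℕ.< p

    module Step {p} (p<N : p ℕ.< N) (s : State p) where
      open State s

      -- The expression for position p: the first one of block p + 1 if that
      -- block exists, and else the target of the leftmost unfinished edge.
      record Choice : Set where
        field
          e           : Expr n k
          fresh       : ¬ (P e ℕ.< p)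
          source-done : ∀ {d} → d ⟶ e → P d ℕ.< p
          fifo        : ∀ {d d′ e′} → d ⟶ e → d′ ⟶ e′ → P d′ ℕ.< P d → P e′ ℕ.< p
          first-due   : ∀ {j} → First a j → e ≡ (j , top) → a j ≡ suc p
          due-first   : ∀ {j} → First a j → a j ≡ suc p → e ≡ (j , top)

      module Extend (choice : Choice) where
        open Choice choice

        P′ : Expr n k → ℕ
        P′ f with f ≟ᴱ e
        ... | yes _ = p
        ... | no  _ = P f

        P′-new : P′ e ≡ p
        P′-new with e ≟ᴱ e
        ... | yes _   = refl
        ... | no  e≢e = ⊥-elim (e≢e refl)

        P′-old : ∀ {f} → f ≢ e → P′ f ≡ P f
        P′-old {f} f≢e with f ≟ᴱ e
        ... | yes f≡e = ⊥-elim (f≢e f≡e)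
        ... | no  _   = refl

        placed-old : ∀ {f} → P f ℕ.< p → P′ f ≡ P f
        placed-old f<p = P′-old λ { refl → fresh f<p }

        placed : ∀ f → P′ f ℕ.< suc p → f ≡ e ⊎ (P f ℕ.< p × P′ f ≡ P f)
        placed f f<p with f ≟ᴱ e
        ... | yes f≡e = inj₁ f≡e
        ... | no  _ with P f ℕ.<? p
        ...   | yes f<  = inj₂ (f< , refl)
        ...   | no  f≮p = ⊥-elim (ℕₚ.<⇒≱ f<p (ℕₚ.≤-trans p<N (unplaced f≮p)))

        before-new : ∀ {d t} → P′ d ℕ.< t → t ℕ.< p → P d ℕ.< t
        before-new {d} {t} d<t t<p with placed d (ℕₚ.<-trans d<t (ℕₚ.<-trans t<p ℕₚ.≤-refl))
        ... | inj₁ refl     = ⊥-elim (ℕₚ.<-asym t<p (subst (ℕ._< t) P′-new d<t))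
        ... | inj₂ (_ , eq) = subst (ℕ._< t) eq d<t

        rightward′ : ∀ {d f} → d ⟶ f → P′ f ℕ.< suc p → P′ d ℕ.< P′ f
        rightward′ {f = f} d→f f<p with placed f f<p
        ... | inj₁ refl = subst₂ ℕ._<_ (sym (placed-old (source-done d→f))) (sym P′-new) (source-done d→f)
        ... | inj₂ (f< , eq) = subst₂ ℕ._<_ (sym (placed-old (ℕₚ.<-trans d<f f<))) (sym eq) d<f
          where d<f = rightward d→f f<

        nonnesting′ : ∀ {d f d′ f′} → d ⟶ f → d′ ⟶ f′ → P′ f′ ℕ.< suc p → P′ d ℕ.< P′ d′ → P′ f ℕ.< P′ f′
        nonnesting′ {d} {f} {d′} {f′} d→f d′→f′ f′<p d<d′ with placed f′ f′<p
        ... | inj₁ refl = subst₂ ℕ._<_ (sym (placed-old f<p)) (sym P′-new) f<p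
          where
          d′<p = source-done d′→f′
          f<p : P f ℕ.< p
          f<p = fifo d′→f′ d→f (before-new (subst (P′ d ℕ.<_) (placed-old d′<p) d<d′) d′<p)
        ... | inj₂ (f′< , eq) = subst₂ ℕ._<_ (sym (placed-old (ℕₚ.<-trans f<f′ f′<))) (sym eq) f<f′
          where
          d′<p = ℕₚ.<-trans (rightward d′→f′ f′<) f′<
          f<f′ = nonnesting d→f d′→f′ f′< (before-new (subst (P′ d ℕ.<_) (placed-old d′<p) d<d′) d′<p)

        injective′ : ∀ {f g} → P′ f ≡ P′ g → P′ f ℕ.< suc p → f ≡ g
        injective′ {f} {g} eq f<p with placed f f<p | placed g (subst (ℕ._< suc p) eq f<p)
        ... | inj₁ refl     | inj₁ refl     = refl
        ... | inj₁ refl     | inj₂ (g< , q) = ⊥-elim (ℕₚ.<⇒≢ g< (trans (sym q) (trans (sym eq) P′-new)))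
        ... | inj₂ (f< , q) | inj₁ refl     = ⊥-elim (ℕₚ.<⇒≢ f< (trans (sym q) (trans eq P′-new)))
        ... | inj₂ (f< , q) | inj₂ (_ , q′) = injective (trans (sym q) (trans eq q′)) f<

        surjective′ : ∀ {r} → r ℕ.< suc p → ∃[ f ] P′ f ≡ r
        surjective′ (s≤s r≤p) with ℕₚ.m≤n⇒m<n∨m≡n r≤p
        ... | inj₂ refl = e , P′-new
        ... | inj₁ r<p  = let f , eq = surjective r<p in f , trans (placed-old (subst (ℕ._< p) (sym eq) r<p)) eq

        unplaced′ : ∀ {f} → ¬ (P′ f ℕ.< suc p) → N ℕ.≤ P′ f
        unplaced′ {f} f≮p with f ≟ᴱ e
        ... | yes _ = ⊥-elim (f≮p ℕₚ.≤-refl)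
        ... | no  _ = unplaced λ f<p → f≮p (ℕₚ.<-trans f<p ℕₚ.≤-refl)

        first-pos′ : ∀ {j} → First a j → P′ (j , top) ℕ.< suc p → suc (P′ (j , top)) ≡ a j
        first-pos′ {j} first f<p with placed (j , top) f<p
        ... | inj₁ eq       = trans (cong suc (trans (cong P′ eq) P′-new)) (sym (first-due first (sym eq)))
        ... | inj₂ (f< , q) = trans (cong suc q) (first-pos first f<)

        first-done′ : ∀ {j} → First a j → a j ℕ.≤ suc p → P′ (j , top) ℕ.< suc p
        first-done′ {j} first aj≤ with ℕₚ.m≤n⇒m<n∨m≡n aj≤
        ... | inj₁ (s≤s aj≤p) = let f< = first-done first aj≤p in
                ℕₚ.<-trans (subst (ℕ._< p) (sym (placed-old f<)) f<) ℕₚ.≤-refl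
        ... | inj₂ aj≡ = s≤s (ℕₚ.≤-reflexive (trans (cong P′ (sym (due-first first aj≡))) P′-new))

        extended : State (suc p)
        extended = record
          { P = P′ ; unplaced = λ {f} → unplaced′ {f} ; injective = λ {f} {g} → injective′ {f} {g} ; surjective = surjective′
          ; rightward = rightward′ ; nonnesting = nonnesting′ ; first-pos = first-pos′ ; first-done = first-done′ }

      -- Otherwise the more than p copies of the labels i with a i ≤ p + 1
      -- would all be placed.
      stuck : (∀ j → First a j → a j ≢ suc p) → (∀ {d e} → d ⟶ e → P d ℕ.< p → P e ℕ.< p) → ⊥
      stuck none closed = ℕₚ.<⇒≱ p<copies (Finₚ.injective⇒≤ {f = slot} slot-injective)
        where
        π = proj₁ (proj₂ parking)
        sorted = proj₁ (proj₂ (proj₂ parking))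
        bound = proj₂ (proj₂ (proj₂ parking))
        all-placed : ∀ e → a (proj₁ e) ℕ.≤ suc p → P e ℕ.< p
        all-placed = edge-induction (λ e → a (proj₁ e) ℕ.≤ suc p → P e ℕ.< p)
          (λ j first aj≤ → case ℕₚ.m≤n⇒m<n∨m≡n aj≤ of λ
            { (inj₁ (s≤s aj≤p)) → first-done first aj≤p ; (inj₂ aj≡) → ⊥-elim (none j first aj≡) })
          (λ d→e placed ae≤ → closed d→e (placed (subst (ℕ._≤ suc p) (sym (edge-label d→e)) ae≤)))
        J : ℕ
        -- The J + 1 smallest values are at most 1 + k J, hence at most p + 1, and their labels have
        -- (J + 1) k > p copies in all.
        J = p DivMod./ k
        J<n : J ℕ.< n
        J<n = DivMod.m<n*o⇒m/o<n {p} {n} {k} (subst (p ℕ.<_) (ℕₚ.*-comm k n) p<N)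
        p<copies : p ℕ.< suc J ℕ.* k
        p<copies = subst (ℕ._< suc J ℕ.* k) (sym (DivMod.m≡m%n+[m/n]*n p k))
          (ℕₚ.+-monoˡ-< (J ℕ.* k) (DivMod.m%n<n p k))
        index : Fin (suc J) → Fin n
        index s = Fin.fromℕ< (ℕₚ.<-≤-trans (Finₚ.toℕ<n s) J<n)
        index≡ : ∀ s → toℕ (index s) ≡ toℕ s
        index≡ s = Finₚ.toℕ-fromℕ< (ℕₚ.<-≤-trans (Finₚ.toℕ<n s) J<n)
        j : Fin n
        j = Fin.fromℕ< J<n
        a≤ : ∀ s → a (π ⟨$⟩ʳ index s) ℕ.≤ suc p
        a≤ s = begin
          a (π ⟨$⟩ʳ index s)   ≤⟨ sorted (index s) j (subst₂ ℕ._≤_ (sym (index≡ s)) (sym (Finₚ.toℕ-fromℕ< J<n)) (Finₚ.toℕ≤pred[n] s)) ⟩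
          a (π ⟨$⟩ʳ j)         ≤⟨ bound j ⟩
          suc (k ℕ.* toℕ j)    ≡⟨ cong (λ t → suc (k ℕ.* t)) (Finₚ.toℕ-fromℕ< J<n) ⟩
          suc (k ℕ.* J)        ≡⟨ cong suc (ℕₚ.*-comm k J) ⟩
          suc (J ℕ.* k)        ≤⟨ s≤s (DivMod.m/n*n≤m p k) ⟩
          suc p                ∎
          where open ℕₚ.≤-Reasoning
        expr : Fin (suc J ℕ.* k) → Expr n k
        expr r = π ⟨$⟩ʳ index (proj₁ (Fin.remQuot {suc J} k r)) , proj₂ (Fin.remQuot {suc J} k r)
        slot<p : ∀ r → P (expr r) ℕ.< p
        slot<p r = all-placed (expr r) (a≤ (proj₁ (Fin.remQuot {suc J} k r)))
        slot : Fin (suc J ℕ.* k) → Fin p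
        slot r = Fin.fromℕ< (slot<p r)
        slot-injective : ∀ {r s} → slot r ≡ slot s → r ≡ s
        slot-injective {r} {s} eq =
          let same = injective (Finₚ.fromℕ<-injective _ _ (slot<p r) (slot<p s) eq) (slot<p r)
              same-index = to-injective π (cong proj₁ same)
              same-quot  = Finₚ.toℕ-injective (trans (sym (index≡ _)) (trans (cong toℕ same-index) (index≡ _)))
          in trans (sym (Finₚ.combine-remQuot {suc J} k r))
               (trans (cong₂ Fin.combine same-quot (cong proj₂ same)) (Finₚ.combine-remQuot {suc J} k s))

      Unfinished : Expr n k → Set
      Unfinished d = P d ℕ.< p × ∃[ e ] (d ⟶ e × ¬ (P e ℕ.< p))

      unfinished? : ∀ d → Dec (Unfinished d)
      unfinished? d = P d ℕ.<? p ×-dec any? λ e → edge? (link? a) d e ×-dec ¬? (P e ℕ.<? p)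

      start-block : ∀ j → First a j → a j ≡ suc p → Choice
      start-block j first due = record
        { e           = j , top
        ; fresh       = λ placed → ℕₚ.<⇒≢ placed (ℕₚ.suc-injective (trans (first-pos first placed) due))
        ; source-done = λ d→e → ⊥-elim (¬-edge-into-first first d→e)
        ; fifo        = λ d→e _ _ → ⊥-elim (¬-edge-into-first first d→e)
        ; first-due   = λ { _ refl → due }
        ; due-first   = λ first′ due′ → cong (_, top) (first-unique first first′ (trans due (sym due′)))
        }

      finish-edge : (∀ j → First a j → a j ≢ suc p) → ∀ d → Unfinished d → (∀ d′ → Unfinished d′ → P d ℕ.≤ P d′) → Choice
      finish-edge none d (d<p , e , d→e , fresh) least = record
        { e           = e
        ; fresh       = fresh
        ; source-done = λ d′→e → subst (λ d → P d ℕ.< p) (source-unique d→e d′→e) d<p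
        ; fifo        = λ {d₁} {d′} {e′} d₁→e d′→e′ d′<d₁ → decidable-stable (P e′ ℕ.<? p) λ e′≮p →
            let d′<d = subst (λ d → P d′ ℕ.< P d) (source-unique d₁→e d→e) d′<d₁
            in ℕₚ.<⇒≱ d′<d (least d′ (ℕₚ.<-trans d′<d d<p , e′ , d′→e′ , e′≮p))
        ; first-due   = λ { first refl → ⊥-elim (¬-edge-into-first first d→e) }
        ; due-first   = λ first due → ⊥-elim (none _ first due)
        }
        where
        source-unique : ∀ {d d′ e} → d ⟶ e → d′ ⟶ e → d ≡ d′
        source-unique = edge-source-unique {L = Link a} link-pred-unique

      choose : Choice
      choose with Finₚ.any? (λ j → first? a j ×-dec a j ℕ.≟ suc p)
      ... | yes (j , first , due) = start-block j first due
      ... | no  none with any? unfinished?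
      ...   | yes found = let d , unfinished , least = minimal-by P unfinished? found in
                finish-edge (λ j first due → none (j , first , due)) d unfinished least
      ...   | no  all-finished = ⊥-elim (stuck (λ j first due → none (j , first , due)) λ {d} {e} d→e d<p →
                decidable-stable (P e ℕ.<? p) λ e≮p → all-finished (d , d<p , e , d→e , e≮p))

    state : ∀ p → p ℕ.≤ N → State p
    state zero    _   = record
      { P          = λ _ → N
      ; unplaced   = λ _ → ℕₚ.≤-refl
      ; injective  = λ _ ()
      ; surjective = λ ()
      ; rightward  = λ _ ()
      ; nonnesting = λ _ _ ()
      ; first-pos  = λ _ ()
      ; first-done = λ {j} _ aj≤0 → ⊥-elim (ℕₚ.<⇒≱ (proj₁ parking j) aj≤0)
      }
    state (suc p) p<N = Step.Extend.extended p<N s (Step.choose p<N s)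
      where s = state p (ℕₚ.<⇒≤ p<N)

    open State (state N ℕₚ.≤-refl)

    -- The N positions hold distinct expressions and there are only N expressions, so by the
    -- pigeonhole principle each of them is placed.
    P<N : ∀ e → P e ℕ.< N
    P<N e = let r , eq = injective⇒surjective f f-injective (Inverse.from indexing e)
                at-r≡e = from-injective indexing eq
            in subst (ℕ._< N) (trans (sym (P-at r)) (cong P at-r≡e)) (Finₚ.toℕ<n r)
      where
      at-r : Fin N → Expr n k
      at-r r = proj₁ (surjective (Finₚ.toℕ<n r))
      P-at : ∀ r → P (at-r r) ≡ toℕ r
      P-at r = proj₂ (surjective (Finₚ.toℕ<n r))
      f : Fin N → Fin N
      f r = Inverse.from indexing (at-r r)
      f-injective : ∀ {r s} → f r ≡ f s → r ≡ s
      f-injective {r} {s} eq = Finₚ.toℕ-injective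
        (trans (sym (P-at r)) (trans (cong P (from-injective indexing eq)) (P-at s)))

    filling : Fin N ↔ Expr n k
    filling = mk↔ₛ′ (λ r → proj₁ (surjective (Finₚ.toℕ<n r))) (λ e → Fin.fromℕ< (P<N e))
      (λ e → injective (trans (proj₂ (surjective (Finₚ.toℕ<n (Fin.fromℕ< (P<N e))))) (Finₚ.toℕ-fromℕ< (P<N e)))
        (subst (ℕ._< N) (sym (proj₂ (surjective (Finₚ.toℕ<n (Fin.fromℕ< (P<N e)))))) (Finₚ.toℕ<n (Fin.fromℕ< (P<N e)))))
      (λ r → Finₚ.toℕ-injective (trans (Finₚ.toℕ-fromℕ< (P<N _)) (proj₂ (surjective (Finₚ.toℕ<n r)))))

    pos-filling : ∀ e → pos filling e ≡ P e
    pos-filling e = Finₚ.toℕ-fromℕ< (P<N e)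

    filling-first : ∀ {j} → First a j → suc (pos filling (j , top)) ≡ a j
    filling-first {j} first = trans (cong suc (pos-filling (j , top))) (first-pos first (P<N (j , top)))

    filling-nonnesting : Nonnesting (Link a) filling
    filling-nonnesting = record
      { rightward = λ {e} {f} e→f → subst₂ ℕ._<_ (sym (pos-filling e)) (sym (pos-filling f)) (rightward e→f (P<N f))
      ; targets-≤ = λ {e} {f} {e′} {f′} e→f e′→f′ e≤e′ → case ℕₚ.m≤n⇒m<n∨m≡n e≤e′ of λ
          { (inj₁ e<e′) → ℕₚ.<⇒≤ (strict e→f e′→f′ e<e′)
          ; (inj₂ e≡e′) → ℕₚ.≤-reflexive (cong (pos filling)
              (edge-target-unique e→f (subst (_⟶ f′) (sym (pos-injective filling e≡e′)) e′→f′))) }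
      ; sources-≤ = λ e→f e′→f′ f≤f′ → ℕₚ.≮⇒≥ λ e′<e → ℕₚ.<⇒≱ (strict e′→f′ e→f e′<e) f≤f′
      }
      where
      strict : ∀ {e f e′ f′} → e ⟶ f → e′ ⟶ f′ → pos filling e ℕ.< pos filling e′ → pos filling f ℕ.< pos filling f′
      strict {e} {f} {e′} {f′} e→f e′→f′ e<e′ = subst₂ ℕ._<_ (sym (pos-filling f)) (sym (pos-filling f′))
        (nonnesting e→f e′→f′ (P<N f′) (subst₂ ℕ._<_ (pos-filling e) (pos-filling e′) e<e′))

-- Realizing a diagram

below-all : ∀ {N} (u : Fin N → ℚ) → ∃[ c ] (∀ j → c ℚ.< u j)
below-all u with B , _ , ≤B ← maxℚ (ℚ.-_ ∘ u) = ℚ.- B ℚ.- 1ℚ , λ j →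
  ℚₚ.<-≤-trans (p-1<p (ℚ.- B)) (subst (ℚ.- B ℚ.≤_) (neg-involutive (u j)) (ℚₚ.neg-antimono-≤ (≤B j)))

-- Recording where the maximum is attained lets any bound on all candidates pass to it; the starting
-- value `c` covers the case without candidates.
greatest : ∀ {N} {Lo : Fin N → Set} → (∀ i → Dec (Lo i)) → (l : Fin N → ℚ) → ∀ c →
  ∃[ m ] ((m ≡ c ⊎ ∃[ i ] (Lo i × m ≡ l i)) × c ℚ.≤ m × (∀ i → Lo i → l i ℚ.≤ m))
greatest {zero}  Lo? l c = c , inj₁ refl , ℚₚ.≤-refl , λ ()
greatest {suc N} Lo? l c with Lo? zero | greatest (Lo? ∘ suc) (l ∘ suc) c
... | no  ¬lo | m , from , c≤m , l≤m = m , [ inj₁ , (λ { (i , lo , eq) → inj₂ (suc i , lo , eq) }) ]′ from , c≤m ,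
        λ { zero lo → ⊥-elim (¬lo lo) ; (suc i) → l≤m i }
... | yes lo  | m , from , c≤m , l≤m with ℚₚ.≤-total (l zero) m
...   | inj₁ l≤ = m , [ inj₁ , (λ { (i , lo , eq) → inj₂ (suc i , lo , eq) }) ]′ from , c≤m ,
        λ { zero _ → l≤ ; (suc i) → l≤m i }
...   | inj₂ m≤ = l zero , inj₂ (zero , lo , refl) , ℚₚ.≤-trans c≤m m≤ ,
        λ { zero _ → ℚₚ.≤-refl ; (suc i) lo → ℚₚ.≤-trans (l≤m i lo) m≤ }

between : ∀ {N} {Lo Up : Fin N → Set} → (∀ i → Dec (Lo i)) → (∀ i → Dec (Up i)) → (l u : Fin N → ℚ) →
          (∀ i j → Lo i → Up j → l i ℚ.< u j) → ∃[ t ] ((∀ i → Lo i → l i ℚ.< t) × (∀ j → Up j → t ℚ.< u j))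
between {N} {Lo} {Up} Lo? Up? l u l<u =
  -- A starting value below all `u j`, so that a maximum to work with exists even without lower
  -- bounds.
  let c , c<u            = below-all u
      m , from , _ , l≤m = greatest Lo? l c
      m<u                = λ j up → [ (λ eq → subst (ℚ._< u j) (sym eq) (c<u j))
                                    , (λ { (i , lo , eq) → subst (ℚ._< u j) (sym eq) (l<u i j lo up) }) ]′ from
      -- Minus `m′` is the smallest among the upper bounds and m + 1, and so exists even without
      -- upper bounds.
      m′ , from′ , _ , u≤m′ = greatest Up? (ℚ.-_ ∘ u) (ℚ.- (m ℚ.+ 1ℚ))
      m<-m′              = [ (λ eq → subst (m ℚ.<_) (sym (trans (cong ℚ.-_ eq) (neg-involutive _))) (p<p+1 m))
                           , (λ { (j , up , eq) → subst (m ℚ.<_) (sym (trans (cong ℚ.-_ eq) (neg-involutive (u j)))) (m<u j up) }) ]′ from′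
      t , m<t , t<m′     = ℚₚ.<-dense m<-m′
  in t , (λ i lo → ℚₚ.≤-<-trans (l≤m i lo) m<t)
       , (λ j up → ℚₚ.<-≤-trans t<m′ (subst (ℚ.- m′ ℚ.≤_) (neg-involutive (u j)) (ℚₚ.neg-antimono-≤ (u≤m′ j up))))

[p-1]+1 : ∀ p → p ℚ.- 1ℚ ℚ.+ 1ℚ ≡ p
[p-1]+1 = solve 1 (λ p → p :- con 1ℚ :+ con 1ℚ := p) refl where open +-*-Solver

-1-mono-< : ∀ {p r} → p ℚ.< r ℚ.+ 1ℚ → p ℚ.- 1ℚ ℚ.< r
-1-mono-< {p} {r} lt = <-shift lt
  (solve 2 (λ p r → r :- (p :- con 1ℚ) := (r :+ con 1ℚ) :- p) refl p r) where open +-*-Solver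

+1-mono-< : ∀ {p r} → p ℚ.- 1ℚ ℚ.< r → p ℚ.< r ℚ.+ 1ℚ
+1-mono-< {p} {r} lt = <-shift lt
  (solve 2 (λ p r → (r :+ con 1ℚ) :- p := r :- (p :- con 1ℚ)) refl p r) where open +-*-Solver

module Realization {n K : ℕ} (a : Fin n → ℕ) (y : Fin (suc K ℕ.* n) ↔ Expr n (suc K))
                   (nonnesting : Nonnesting (Link a) y) where
  private
    k N : ℕ
    k = suc K
    N = k ℕ.* n
    p⟨_⟩ : Expr n k → ℕ
    p⟨_⟩ = pos y
    _⟶_ : Expr n k → Expr n k → Set
    _⟶_ = Edge (Link a)
  open Nonnesting nonnesting

  -- The prescription for the heights: from an expression to a later one they are to drop by at
  -- least 1 exactly if an edge lies between the two.
  Contains : Expr n k → Expr n k → Set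
  Contains e f = ∃₂ λ e′ f′ → e′ ⟶ f′ × Inside y e f e′ f′

  contains? : ∀ e f → Dec (Contains e f)
  contains? e f = any? λ e′ → any? λ f′ → edge? (link? a) e′ f′ ×-dec
    (p⟨ e ⟩ ℕ.≤? p⟨ e′ ⟩ ×-dec p⟨ f′ ⟩ ℕ.≤? p⟨ f ⟩)

  contains-mono : ∀ {e f e′ f′} → p⟨ e ⟩ ℕ.≤ p⟨ e′ ⟩ → p⟨ f′ ⟩ ℕ.≤ p⟨ f ⟩ → Contains e′ f′ → Contains e f
  contains-mono p q (e₁ , f₁ , e₁→f₁ , r , s) = e₁ , f₁ , e₁→f₁ , ℕₚ.≤-trans p r , ℕₚ.≤-trans s q

  edge-contained : ∀ {e f} → e ⟶ f → Contains e f
  edge-contained {e} {f} e→f = e , f , e→f , ℕₚ.≤-refl , ℕₚ.≤-refl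

  -- Edges drop by more than 1, except that shifts drop by exactly 1.
  Fits : (Expr n k → ℚ) → Expr n k → ℚ → Expr n k → Set
  Fits z f t e = t ℚ.< z e × (Shift e f → z e ≡ t ℚ.+ 1ℚ) ×
    (Contains e f → ¬ Shift e f → t ℚ.+ 1ℚ ℚ.< z e) × (¬ Contains e f → z e ℚ.< t ℚ.+ 1ℚ)

  Good : (Expr n k → ℚ) → Expr n k → Set
  Good z f = ∀ e → p⟨ e ⟩ ℕ.< p⟨ f ⟩ → Fits z f (z f) e

  module Extend (z : Expr n k → ℚ) (f : Expr n k) (good : ∀ g → p⟨ g ⟩ ℕ.< p⟨ f ⟩ → Good z g) where

    z-mono : ∀ {e g} → p⟨ e ⟩ ℕ.≤ p⟨ g ⟩ → p⟨ g ⟩ ℕ.< p⟨ f ⟩ → z g ℚ.≤ z e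
    z-mono {e} {g} e≤g g<f with ℕₚ.m≤n⇒m<n∨m≡n e≤g
    ... | inj₁ e<g = ℚₚ.<⇒≤ (proj₁ (good g g<f e e<g))
    ... | inj₂ e≡g = ℚₚ.≤-reflexive (cong z (sym (pos-injective y e≡g)))

    -- The height of `f` is forced, so each bound compares `z e` with `z d`. Nonnesting makes the
    -- comparisons come out right: an edge lies between `e` and `f` exactly if `e` is at or left of
    -- `d`.
    fits-shift : ∀ d → Shift d f → ∀ e → p⟨ e ⟩ ℕ.< p⟨ f ⟩ → Fits z f (z d ℚ.- 1ℚ) e
    fits-shift d s e e<f =
      above , (λ s′ → trans (cong z (edge-source-unique {L = Link a} link-pred-unique (inj₁ s′) (inj₁ s))) (sym ([p-1]+1 (z d)))) ,
      (λ c ¬s → subst (ℚ._< z e) (sym ([p-1]+1 (z d))) (proj₁ (good d d<f e (before-d c ¬s)))) ,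
      (λ ¬c → subst (z e ℚ.<_) (sym ([p-1]+1 (z d))) (proj₁ (good e e<f d
        (ℕₚ.≰⇒> λ e≤d → ¬c (d , f , inj₁ s , e≤d , ℕₚ.≤-refl)))))
      where
      d<f : p⟨ d ⟩ ℕ.< p⟨ f ⟩
      d<f = rightward (inj₁ s)
      before-d : Contains e f → ¬ Shift e f → p⟨ e ⟩ ℕ.< p⟨ d ⟩
      before-d (e₁ , f₁ , e₁→f₁ , e≤e₁ , f₁≤f) ¬s =
        ℕₚ.≤∧≢⇒< (ℕₚ.≤-trans e≤e₁ (sources-≤ e₁→f₁ (inj₁ s) f₁≤f))
          λ eq → ¬s (subst (λ e → Shift e f) (pos-injective y (sym eq)) s)
      above : z d ℚ.- 1ℚ ℚ.< z e
      above with ℕₚ.≤-<-connex p⟨ e ⟩ p⟨ d ⟩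
      ... | inj₁ e≤d = ℚₚ.<-≤-trans (p-1<p (z d)) (z-mono e≤d d<f)
      -- An edge between `d` and `e` would be nested in the shift, which ends at `f` after `e`.
      ... | inj₂ d<e = -1-mono-< (proj₂ (proj₂ (proj₂ (good e e<f d d<e))) λ { (e₁ , f₁ , e₁→f₁ , d≤e₁ , f₁≤e) →
              ℕₚ.<⇒≱ e<f (ℕₚ.≤-trans (targets-≤ (inj₁ s) e₁→f₁ d≤e₁) f₁≤e) })

    -- The upper bound that `e` sets on the height of `f`: a drop by more than 1 is due if an edge
    -- lies between them, and otherwise any drop will do.
    upper : Expr n k → ℚ
    upper e with contains? e f
    ... | yes _ = z e ℚ.- 1ℚ
    ... | no  _ = z e

    -- An `e` without an edge up to `f` lies to the right of every `e′` with one. If `e′` has none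
    -- either and comes after `e`, no edge lies between `e` and `e′`, so the heights drop by less
    -- than 1 from `e` to `e′`.
    separated : ∀ e e′ → p⟨ e ⟩ ℕ.< p⟨ f ⟩ × ¬ Contains e f → p⟨ e′ ⟩ ℕ.< p⟨ f ⟩ → z e ℚ.- 1ℚ ℚ.< upper e′
    separated e e′ (e<f , ¬c) e′<f with contains? e′ f
    ... | yes c′ = ℚₚ.+-monoˡ-< (ℚ.- 1ℚ) (proj₁ (good e e<f e′ (ℕₚ.≰⇒> λ e≤e′ → ¬c (contains-mono e≤e′ ℕₚ.≤-refl c′))))
    ... | no  _ with ℕₚ.≤-<-connex p⟨ e′ ⟩ p⟨ e ⟩
    ...   | inj₁ e′≤e = ℚₚ.<-≤-trans (p-1<p (z e)) (z-mono e′≤e e<f)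
    ...   | inj₂ e<e′ = -1-mono-< (proj₂ (proj₂ (proj₂ (good e′ e′<f e e<e′))) λ c → ¬c (contains-mono ℕₚ.≤-refl (ℕₚ.<⇒≤ e′<f) c))

    fits-free : (∀ d → ¬ Shift d f) → ∃[ t ] (∀ e → p⟨ e ⟩ ℕ.< p⟨ f ⟩ → Fits z f t e)
    fits-free no-shift =
      let t , lower< , <upper = between
            {Lo = λ i → p⟨ at-pos i ⟩ ℕ.< p⟨ f ⟩ × ¬ Contains (at-pos i) f} {Up = λ i → p⟨ at-pos i ⟩ ℕ.< p⟨ f ⟩}
            (λ i → p⟨ at-pos i ⟩ ℕ.<? p⟨ f ⟩ ×-dec ¬? (contains? (at-pos i) f)) (λ i → p⟨ at-pos i ⟩ ℕ.<? p⟨ f ⟩)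
            (λ i → z (at-pos i) ℚ.- 1ℚ) (λ i → upper (at-pos i)) (λ i j → separated (at-pos i) (at-pos j))
      in t , λ e e<f → fits t
           (λ e e<f ¬c → subst (λ e → p⟨ e ⟩ ℕ.< p⟨ f ⟩ × ¬ Contains e f → z e ℚ.- 1ℚ ℚ.< t) (Inverse.strictlyInverseˡ y e)
              (lower< (Inverse.from y e)) (e<f , ¬c))
           (λ e e<f → subst (λ e → p⟨ e ⟩ ℕ.< p⟨ f ⟩ → t ℚ.< upper e) (Inverse.strictlyInverseˡ y e) (<upper (Inverse.from y e)) e<f)
           e e<f
      where
      at-pos : Fin N → Expr n k
      at-pos = Inverse.to y
      fits : ∀ t → (∀ e → p⟨ e ⟩ ℕ.< p⟨ f ⟩ → ¬ Contains e f → z e ℚ.- 1ℚ ℚ.< t) →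
             (∀ e → p⟨ e ⟩ ℕ.< p⟨ f ⟩ → t ℚ.< upper e) → ∀ e → p⟨ e ⟩ ℕ.< p⟨ f ⟩ → Fits z f t e
      fits t lower< <upper e e<f with contains? e f | <upper e e<f
      ... | yes c | t<  = ℚₚ.<-trans t< (p-1<p (z e)) , (λ s → ⊥-elim (no-shift e s)) ,
              (λ _ _ → subst (t ℚ.+ 1ℚ ℚ.<_) ([p-1]+1 (z e)) (ℚₚ.+-monoˡ-< 1ℚ t<)) , (λ ¬c → ⊥-elim (¬c c))
      ... | no ¬c | t<  = t< , (λ s → ⊥-elim (no-shift e s)) , (λ c → ⊥-elim (¬c c)) , (λ _ → +1-mono-< (lower< e e<f ¬c))

    fitting : ∃[ t ] (∀ e → p⟨ e ⟩ ℕ.< p⟨ f ⟩ → Fits z f t e)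
    fitting with any? (λ d → shift? d f)
    ... | yes (d , s) = z d ℚ.- 1ℚ , fits-shift d s
    ... | no  none    = fits-free λ d s → none (d , s)

    z′ : ℚ → Expr n k → ℚ
    z′ t e with e ≟ᴱ f
    ... | yes _ = t
    ... | no  _ = z e

    z′-new : ∀ t → z′ t f ≡ t
    z′-new t with f ≟ᴱ f
    ... | yes _  = refl
    ... | no f≢f = ⊥-elim (f≢f refl)

    z′-old : ∀ t {e} → p⟨ e ⟩ ℕ.< p⟨ f ⟩ → z′ t e ≡ z e
    z′-old t {e} e<f with e ≟ᴱ f
    ... | yes refl = ⊥-elim (ℕₚ.<-irrefl refl e<f)
    ... | no  _    = refl

    fits-resp : ∀ {g s t z₁ z₂ e} → s ≡ t → z₁ e ≡ z₂ e → Fits z₁ g s e → Fits z₂ g t e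
    fits-resp {z₁ = z₁} {z₂} {e} refl eq (p , q , r , s) =
      subst (_ ℚ.<_) eq p , (λ sh → trans (sym eq) (q sh)) , (λ c ¬sh → subst (_ ℚ.<_) eq (r c ¬sh)) ,
      (λ ¬c → subst (ℚ._< _) eq (s ¬c))

    extended : ∃[ z″ ] (∀ g → p⟨ g ⟩ ℕ.≤ p⟨ f ⟩ → Good z″ g)
    extended = let t , fit = fitting in z′ t , λ g g≤f e e<g → case ℕₚ.m≤n⇒m<n∨m≡n g≤f of λ
      { (inj₁ g<f) → fits-resp {g} {z₁ = z} {z′ t} {e} (sym (z′-old t g<f)) (sym (z′-old t (ℕₚ.<-trans e<g g<f)))
          (good g g<f e e<g)
      ; (inj₂ g≡f) → subst (λ g → p⟨ e ⟩ ℕ.< p⟨ g ⟩ → Fits (z′ t) g (z′ t g) e) (pos-injective y (sym g≡f))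
          (λ e<f → fits-resp {f} {z₁ = z} {z′ t} {e} (sym (z′-new t)) (sym (z′-old t e<f)) (fit e e<f)) e<g }

  realize : ∀ p → p ℕ.≤ N → ∃[ z ] (∀ f → p⟨ f ⟩ ℕ.< p → Good z f)
  realize zero    _   = (λ _ → 0ℚ) , λ f ()
  realize (suc p) p<N =
    let z , good  = realize p (ℕₚ.<⇒≤ p<N)
        f , f≡p   = pos-surjective y p p<N
        z″ , good″ = Extend.extended z f (λ g g<f → good g (subst (p⟨ g ⟩ ℕ.<_) f≡p g<f))
    in z″ , λ { g (s≤s g≤p) → good″ g (subst (p⟨ g ⟩ ℕ.≤_) (sym f≡p) g≤p) }

-- The bijection

module RealizedPoint {n K : ℕ} (a : Fin n → ℕ) (y : Fin (suc K ℕ.* n) ↔ Expr n (suc K))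
  (nonnesting : Nonnesting (Link a) y) (first-pos : ∀ {j} → First a j → suc (pos y (j , top)) ≡ a j) where
  private
    k : ℕ
    k = suc K
  open Realization a y nonnesting
  open Nonnesting nonnesting renaming (rightward to link-rightward)

  private
    z : Expr n k → ℚ
    z = proj₁ (realize (k ℕ.* n) ℕₚ.≤-refl)

    z-good : ∀ f → Good z f
    z-good f = proj₂ (realize (k ℕ.* n) ℕₚ.≤-refl) f (pos<N y f)

  point : Fin n → ℚ
  point i = z (i , zero)

  private
    v : Expr n k → ℚ
    v = height point

    -- The heights were chosen expression by expression; that shifts drop by exactly 1 is what makes
    -- them come from a point.
    height≡z : ∀ e → v e ≡ z e
    height≡z (i , m) = go (toℕ m) m refl
      where
      go : ∀ c m → toℕ m ≡ c → v (i , m) ≡ z (i , m)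
      go c       zero    _  = ℚₚ.+-identityʳ (z (i , zero))
      go (suc c) (suc m) eq = trans (height-shift point {i , suc m} {i , Fin.inject₁ m} s)
          (trans (cong (ℚ._+ 1ℚ) (go c (Fin.inject₁ m) (trans (Finₚ.toℕ-inject₁ m) (ℕₚ.suc-injective eq))))
            (sym (proj₁ (proj₂ (z-good (i , Fin.inject₁ m) (i , suc m) (link-rightward (inj₁ s)))) s)))
        where
        s : Shift (i , suc m) (i , Fin.inject₁ m)
        s = refl , cong suc (sym (Finₚ.toℕ-inject₁ m))

  decr : Decreasing v y
  decr = decreasing λ {e} {f} e<f → subst₂ ℚ._<_ (sym (height≡z f)) (sym (height≡z e)) (proj₁ (z-good f e e<f))

  open Heights v (height-shift point) y decr

  contains⇒far : ∀ {e f} → pos y e ℕ.< pos y f → Contains e f → ¬ Shift e f → v f ℚ.+ 1ℚ ℚ.< v e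
  contains⇒far {e} {f} e<f c ¬s = subst₂ (λ s t → s ℚ.+ 1ℚ ℚ.< t) (sym (height≡z f)) (sym (height≡z e))
    (proj₁ (proj₂ (proj₂ (z-good f e e<f))) c ¬s)

  ¬contains⇒near : ∀ {e f} → pos y e ℕ.< pos y f → ¬ Contains e f → v e ℚ.< v f ℚ.+ 1ℚ
  ¬contains⇒near {e} {f} e<f ¬c = subst₂ (λ s t → s ℚ.< t ℚ.+ 1ℚ) (sym (height≡z e)) (sym (height≡z f))
    (proj₂ (proj₂ (proj₂ (z-good f e e<f))) ¬c)

  -- Different expressions received different heights. Drops of exactly 1 were granted to shifts
  -- only, and no shift ends at a top copy.
  generic : Generic {K = K} point
  generic {i} {j} i<j =
    (λ m m′ eq → ℕₚ.<⇒≢ i<j (cong (toℕ ∘ proj₁) (pos-injective y {i , m} {j , m′}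
      (ℕₚ.≤-antisym (v≤⇒pos≥ (ℚₚ.≤-reflexive (sym eq))) (v≤⇒pos≥ (ℚₚ.≤-reflexive eq)))))) ,
    λ eq → case ℕₚ.<-≤-connex (pos y (i , zero)) (pos y (j , top)) of λ
      { (inj₁ lt) → case contains? (i , zero) (j , top) of λ
          { (yes c) → ℚₚ.<-irrefl (sym eq) (contains⇒far lt c ¬-shift-into-top)
          ; (no ¬c) → ℚₚ.<-irrefl eq (¬contains⇒near lt ¬c) }
      ; (inj₂ ge) → ℚₚ.<-irrefl eq (ℚₚ.≤-<-trans (pos≤⇒v≥ ge) (p<p+1 (v (j , top)))) }

  far-edge⇒contains : ∀ {e f : Expr n k} → Edge (FarApart v) e f → Contains e f
  far-edge⇒contains (inj₁ s) = edge-contained (inj₁ s)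
  far-edge⇒contains {e} {f} e→f@(inj₂ (refl , refl , _ , far)) = decidable-stable (contains? e f) λ ¬c →
    ℚₚ.<-asym far (¬contains⇒near (rightward e→f) ¬c)

  link-edge⇒far-edge : ∀ {e f : Expr n k} → Edge (Link a) e f → Edge (FarApart v) e f
  link-edge⇒far-edge (inj₁ s) = inj₁ s
  link-edge⇒far-edge e→f@(inj₂ (refl , refl , l)) =
    inj₂ (refl , refl , proj₁ l , contains⇒far (link-rightward e→f) (edge-contained e→f) ¬-shift-into-top)

  -- A far edge inside a link edge contains a link edge in turn. By nonnesting the innermost edge is
  -- the outermost one, so all three coincide.
  link⇒⇝ : ∀ {i j} → Link a i j → i ⇝ j
  link⇒⇝ {i} {j} l = link-edge⇒far-edge e→f , λ e′ f′ e′→f′ e≤e′ f′≤f →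
    let e₁ , f₁ , e₁→f₁ , e′≤e₁ , f₁≤f′ = far-edge⇒contains e′→f′
        f≤f₁ = targets-≤ e→f e₁→f₁ (ℕₚ.≤-trans e≤e′ e′≤e₁)
        e₁≤e = sources-≤ e₁→f₁ e→f (ℕₚ.≤-trans f₁≤f′ f′≤f)
    in pos-injective y (ℕₚ.≤-antisym (ℕₚ.≤-trans e′≤e₁ e₁≤e) e≤e′) ,
       pos-injective y (ℕₚ.≤-antisym f′≤f (ℕₚ.≤-trans f≤f₁ f₁≤f′))
    where
    e→f : Edge (Link a) (i , zero) (j , top)
    e→f = inj₂ (refl , refl , l)

  ⇝⇒link : ∀ {i j} → i ⇝ j → Link a i j
  ⇝⇒link (e→f , min) with far-edge⇒contains e→f
  ... | e₁ , f₁ , e₁→f₁ , e≤e₁ , f₁≤f with min e₁ f₁ (link-edge⇒far-edge e₁→f₁) e≤e₁ f₁≤f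
  ...   | refl , refl with e₁→f₁
  ...     | inj₁ s           = ⊥-elim (¬-shift-into-top s)
  ...     | inj₂ (_ , _ , l) = l

  isLabelling : IsLabelling a
  isLabelling = (λ i j i⇝j → proj₁ (proj₂ (⇝⇒link i⇝j))) ,
    λ j none → [ (λ first → sym (first-pos first)) , (λ { (i , l) → ⊥-elim (none i (link⇒⇝ l)) }) ]′ (first-or-link a j)

module _ {n K : ℕ} where
  private
    k : ℕ
    k = suc K
    module ≈ᴿ = Setoid (Regions n k)

  sameLabels⇒≈ᴿ : ∀ (q q′ : Fin n → ℚ) (cq : (fromℚ ∘ q) ∈ Complement n k) (cq′ : (fromℚ ∘ q′) ∈ Complement n k) →
    ∀ y y′ (decr : Decreasing (height {k = k} q) y) (decr′ : Decreasing (height {k = k} q′) y′) {a} →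
    Heights.IsLabelling (height {k = k} q) (height-shift q) y decr a →
    Heights.IsLabelling (height {k = k} q′) (height-shift q′) y′ decr′ a → rationalRegion q cq ≈ᴿ rationalRegion q′ cq′
  sameLabels⇒≈ᴿ q q′ cq cq′ y y′ decr decr′ {a} labels labels′ =
    heights⇒SameComponent q q′ cq cq′ S.order
      (λ i<j lt → proj₂ (S.far-transfer (proj₂ (complement⇒generic {K = K} q′ cq′ i<j)) (i<j , lt)))
      -- The near side follows from transferring the far side in the opposite direction, since
      -- genericity excludes equality.
      (λ {i} {j} i<j lt → case ℚₚ.<-cmp (height {k = k} q′ (i , zero)) (height q′ (j , top {K}) ℚ.+ 1ℚ) of λ
        { (tri< lt′ _ _) → lt′
        ; (tri≈ _ eq _)  → ⊥-elim (proj₂ (complement⇒generic {K = K} q′ cq′ i<j) eq)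
        ; (tri> _ _ gt)  → ⊥-elim (ℚₚ.<-asym lt
            (proj₂ (S′.far-transfer (proj₂ (complement⇒generic {K = K} q cq i<j)) (i<j , gt)))) })
    where
    module S = SameLabels (height {k = k} q) (height q′) (height-shift q) (height-shift q′) y y′ decr decr′ {a} labels labels′
    module S′ = SameLabels (height {k = k} q′) (height q) (height-shift q′) (height-shift q) y′ y decr′ decr {a} labels′ labels

  record RationalModel (R : Region n k) : Set₁ where
    field
      q    : Fin n → ℚ
      cq   : (fromℚ ∘ q) ∈ Complement n k
      y    : Fin (k ℕ.* n) ↔ Expr n k
      decr : Decreasing (height {k = k} q) y
      R≈q  : R ≈ᴿ rationalRegion q cq

    open Heights (height {k = k} q) (height-shift q) y decr public

  opaque
    rationalModel : ∀ R → RationalModel R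
    rationalModel R@(x , cx) = record
      { q    = approximation
      ; cq   = cq
      ; y    = ordering
      ; decr = decreasing λ {e} {f} e<f → subst₂ (λ e f → height {k = k} approximation f ℚ.< height approximation e)
          (Inverse.strictlyInverseˡ ordering e) (Inverse.strictlyInverseˡ ordering f) (ordering-decreasing e<f)
      ; R≈q  = Agree⇒SameComponent {x = x} {fromℚ ∘ approximation} cx approximation∈Agree
      }
      where
      open Approximation x cx
      cq : (fromℚ ∘ approximation) ∈ Complement n k
      cq = Agree⇒Complement {x = x} cx {fromℚ ∘ approximation} approximation∈Agree
      open Ordering (height {k = k} approximation) (height-injective approximation (complement⇒generic approximation cq))

  module _ (R : Region n k) where
    open RationalModel (rationalModel R)

    sigma : ParkingFunction n k
    sigma = record
      { sequence  = labelling
      ; isParking = isParking-intro y labelling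
          (λ i → subst (1 ℕ.≤_) (sym (proj₂ (labelling-start i))) (s≤s z≤n))
          (labelling-≤ {labelling} labelling-isLabelling)
      }

    sigma-isSigma : IsSigma R (sequence sigma)
    sigma-isSigma = isSigma-resp {R = rationalRegion q cq} {R} (≈ᴿ.sym {R} {rationalRegion q cq} R≈q)
      (labelling⇒isSigma q cq y decr {labelling} labelling-isLabelling)

  sigma-cong : ∀ {R R′ : Region n k} → R ≈ᴿ R′ → sequence (sigma R) ≗ sequence (sigma R′)
  sigma-cong {R} {R′} R≈R′ = isSigma-unique {R = R′} (isSigma-resp {R = R} {R′} R≈R′ (sigma-isSigma R)) (sigma-isSigma R′)

  sigma-injective : ∀ {R R′ : Region n k} → sequence (sigma R) ≗ sequence (sigma R′) → R ≈ᴿ R′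
  sigma-injective {R} {R′} same =
    ≈ᴿ.trans {R} {rationalRegion M.q M.cq} {R′} M.R≈q
      (≈ᴿ.trans {rationalRegion M.q M.cq} {rationalRegion M′.q M′.cq} {R′}
        (sameLabels⇒≈ᴿ M.q M′.q M.cq M′.cq M.y M′.y M.decr M′.decr {M.labelling} M.labelling-isLabelling labels′)
        (≈ᴿ.sym {R′} {rationalRegion M′.q M′.cq} M′.R≈q))
    where
    module M = RationalModel (rationalModel R)
    module M′ = RationalModel (rationalModel R′)
    labels′ : M′.IsLabelling M.labelling
    labels′ = (λ i j i⇝j → trans (same i) (trans (proj₁ M′.labelling-isLabelling i j i⇝j) (sym (same j)))) ,
              (λ j none → trans (same j) (proj₂ M′.labelling-isLabelling j none))

  sigma-surjective : ∀ (f : ParkingFunction n k) → ∃[ R ] (∀ {R′} → R′ ≈ᴿ R → sequence (sigma R′) ≗ sequence f)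
  sigma-surjective f = R , λ {R′} R′≈R →
    isSigma-unique {R = R} (isSigma-resp {R = R′} {R} R′≈R (sigma-isSigma R′)) R-isSigma
    where
    a = sequence f
    open Filling {K = K} a (isParking f)
    open RealizedPoint {K = K} a filling filling-nonnesting filling-first
    cq = generic⇒complement point generic
    R : Region n k
    R = rationalRegion point cq
    R-isSigma : IsSigma R a
    R-isSigma = labelling⇒isSigma point cq filling decr isLabelling

  σ : Bijection (Regions n k) (ParkingFunctions n k)
  σ = record
    { to        = sigma
    ; cong      = λ {R} {R′} → sigma-cong {R} {R′}
    ; bijective = (λ {R} {R′} → sigma-injective {R} {R′}) , sigma-surjective
    }

  isSigma⇔ : ∀ (R : Region n k) (a : Fin n → ℕ) → IsSigma R a ⇔ (a ≗ sequence (sigma R))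
  isSigma⇔ R a = mk⇔ (λ isSigma → isSigma-unique {R = R} isSigma (sigma-isSigma R)) λ a≗ →
    let y , ord , leftmost = sigma-isSigma R
    in y , ord , λ i → subst (Diagram.IsLeftmostPosition R y (Diagram.Chain R y i)) (sym (a≗ i)) (leftmost i)

theorem3p5 : (n k : ℕ) .{{_ : NonZero n}} .{{_ : NonZero k}} →
    Σ[ σ ∈ Bijection (Regions n k) (ParkingFunctions n k) ]
    ((R : Region n k) (a : Fin n → ℕ) →
    IsSigma R a ⇔ (a ≗ sequence (Bijection.to σ R)))
theorem3p5 n (suc K) = σ , isSigma⇔
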